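{- Let $G=(V,E_G)$ be a weighted graph (the communication network) and let $T=(V,E_T)$ be a rooted spanning tree of $G$. There exists a deterministic $\tilde O(1)$-round Minor-Aggregation algorithm that computes $\mathrm{Cut}_{T,G}(e)$ for all $e\in E_T$, where each tree edge learns its cut value.
   Context: Minor-Aggregation model. The communication network is a connected undirected graph $G=(V,E)$ with $n=|V|$ nodes; both nodes and edges are computational units with private memory. Initially nodes know only their unique $\tilde O(1)$-bit ID (and inputs) and edges know the IDs of their endpoints. Computation proceeds in synchronous rounds, each of three steps: (i) Contraction: each edge $e$ chooses $c_e\in\{\bot,\top\}$, defining the minor $G'=G/\{e:c_e=\top\}$ (self-loops removed), whose vertices (supernodes) are identified with the sets of nodes they contain. (ii) Consensus: each node $v$ chooses an $\tilde O(1)$-bit value $x_v$; for each supernode $s$ all nodes of $s$ learn $y_s=\bigoplus_{v\in s}x_v$ for a predefined aggregation operator $\bigoplus$. (iii) Aggregation: each edge $e$ of $G'$ joining supernodes $a,b$ learns $y_a,y_b$ and chooses $\tilde O(1)$-bit values $z_{e,a},z_{e,b}$; all nodes of each supernode $s$ learn the same aggregate $\bigotimes_{e \text{ incident to } s} z_{e,s}$ for a predefined aggregation operator $\bigotimes$. An aggregation operator maps two $B$-bit messages ($B=\tilde O(1)$) to one $B$-bit message, applied pairwise in arbitrary order to aggregate several messages. $\tilde O(\cdot)$ hides $\mathrm{poly}(\log n)$ factors. Inputs are distributedly stored: each edge knows its weight (positive integers bounded by $\mathrm{poly}(n)$), each edge knows whether it belongs to $T$, and each tree edge knows which endpoint is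 closer to the root. For a tree edge $e$, $\mathrm{Cut}_{T,G}(e)$ is the total weight of the edges $\{u,v\}\in E_G$ whose unique $u$–$v$ path in $T$ contains $e$. -}

module Defs where

open import Data.Nat using (ℕ; zero; suc; _+_; _*_; _^_; _≤_; _<_)
open import Data.Nat.Logarithm using (⌊log₂_⌋)
open import Data.Fin using (Fin; zero; suc)
open import Data.Fin.Subset using (Subset; _∈_; ∣_∣)
open import Data.Bool using (Bool; true; false; if_then_else_)
open import Data.Vec using (lookup)
open import Data.Maybe using (Maybe; just; nothing)
open import Data.Product using (Σ; _×_; _,_; proj₁; proj₂; ∃)
open import Data.Sum using (_⊎_)
open import Data.List using (List; []; _∷_; [_]; _++_; map)
open import Data.List.Relation.Unary.Unique.Propositional using (Unique)
open import Data.List.Relation.Binary.Pointwise using (Pointwise)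
open import Data.List.Relation.Binary.Permutation.Propositional using (_↭_)
import Data.List.Membership.Propositional as LM
open import Relation.Binary.PropositionalEquality using (_≡_)
open import Relation.Nullary using (¬_)
open import Function.Bundles using (_⇔_)

sumFin : (m : ℕ) → (Fin m → ℕ) → ℕ
sumFin zero    f = 0
sumFin (suc m) f = f zero + sumFin m (λ i → f (suc i))

-- the polylog function c · (1 + ⌊log₂ n⌋)^c  (Õ(1) = bounded by such a function)
polylog : ℕ → ℕ → ℕ
polylog c n = c * (suc ⌊log₂ n ⌋) ^ c

-- Graphs: vertices Fin n, edges Fin m, each edge has an (arbitrarily ordered)
-- pair of endpoints.

record Graph (n : ℕ) : Set where
  field
    m        : ℕ
    ends     : Fin m → Fin n × Fin n
    loopless : ∀ f → ¬ (proj₁ (ends f) ≡ proj₂ (ends f))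
    simple   : ∀ f g → (ends f ≡ ends g ⊎ ends f ≡ (proj₂ (ends g) , proj₁ (ends g))) → f ≡ g

module _ {n : ℕ} (G : Graph n) where
  open Graph G

  src dst : Fin m → Fin n
  src f = proj₁ (ends f)
  dst f = proj₂ (ends f)

  Joins : Fin m → Fin n → Fin n → Set
  Joins f u w = ends f ≡ (u , w) ⊎ ends f ≡ (w , u)

  data Reach (P : Fin m → Set) : Fin n → Fin n → Set where
    here : ∀ {u} → Reach P u u
    step : ∀ {u w v} f → P f → Joins f u w → Reach P w v → Reach P u v

  data SPath (P : Fin m → Set) : Fin n → Fin n → List (Fin n) → List (Fin m) → Set where
    stop : ∀ {u} → SPath P u u [ u ] []
    step : ∀ {u w v vs es} f → P f → Joins f u w → ¬ (u LM.∈ vs) →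
           SPath P w v vs es → SPath P u v (u ∷ vs) (f ∷ es)

  AllEdges : Fin m → Set
  AllEdges f = f ≡ f

  Connected : Set
  Connected = ∀ u v → Reach AllEdges u v

  InT : Subset m → Fin m → Set
  InT T f = f ∈ T

  IsSpanningTree : Subset m → Set
  IsSpanningTree T = (∀ u v → Reach (InT T) u v) × n ≡ suc ∣ T ∣

  OnTPath : Subset m → Fin m → Fin n → Fin n → Set
  OnTPath T e u v = Σ (List (Fin n)) λ vs → Σ (List (Fin m)) λ es →
                    SPath (InT T) u v vs es × e LM.∈ es

  CutIs : Subset m → (Fin m → ℕ) → Fin m → ℕ → Set
  CutIs T w e k = Σ (Subset m) λ S →
    (∀ f → (f ∈ S) ⇔ OnTPath T e (src f) (dst f)) ×
    k ≡ sumFin m (λ f → if lookup S f then w f else 0)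

  -- which endpoint of each tree edge is closer to the root r:
  -- up f = just p  with p the endpoint closer to r (the other endpoint's
  -- T-path to r passes through f); up f = nothing for non-tree edges
  ParentInfo : Subset m → Fin n → (Fin m → Maybe (Fin n)) → Set
  ParentInfo T r up = ∀ f →
      (¬ InT T f × up f ≡ nothing)
    ⊎ (InT T f × ((up f ≡ just (src f) × OnTPath T f (dst f) r)
                ⊎ (up f ≡ just (dst f) × OnTPath T f (src f) r)))

-- Aggregation of a (multi)set of messages with a binary operator,
-- applied pairwise in an arbitrary order: Agg op L r means that r is
-- a possible result of aggregating the messages of L (nothing iff L = []).

data Agg {M : Set} (op : M → M → M) : List M → Maybe M → Set where
  none : Agg op [] nothing
  leaf : ∀ x → Agg op [ x ] (just x)
  node : ∀ {L L₁ L₂ a b} → L ↭ (L₁ ++ L₂) → Agg op L₁ (just a) → Agg op L₂ (just b) →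
         Agg op L (just (op a b))

Enumerates : {A : Set} → (A → Set) → List A → Set
Enumerates P L = Unique L × (∀ a → (a LM.∈ L) ⇔ P a)

-- Minor-Aggregation algorithms (deterministic).  Messages have B bits,
-- i.e. are elements of Fin (2 ^ B).  Nodes and edges have arbitrary
-- private state; all round-t behaviour may depend on the round number t.

record Algorithm : Set₁ where
  field
    B R    : ℕ                       -- message bits, number of rounds
    NS ES  : Set
    initN  : ℕ → NS                  -- node knows its ID
    -- edge knows IDs of its endpoints, its weight, and (if a tree edge)
    -- the ID of the endpoint closer to the root (nothing if not in T)
    initE  : ℕ → ℕ → ℕ → Maybe ℕ → ES
    contract  : ℕ → ES → Bool
    xval      : ℕ → NS → Fin (2 ^ B)
    ⊕         : ℕ → Fin (2 ^ B) → Fin (2 ^ B) → Fin (2 ^ B)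
    learnY    : ℕ → NS → Fin (2 ^ B) → NS
    -- an edge of G' learns y of the supernodes of its first / second endpoint
    edgeLearn : ℕ → ES → Fin (2 ^ B) → Fin (2 ^ B) → ES
    -- z values sent to the supernode of the first / second endpoint
    zval      : ℕ → ES → Fin (2 ^ B) × Fin (2 ^ B)
    ⊗         : ℕ → Fin (2 ^ B) → Fin (2 ^ B) → Fin (2 ^ B)
    learnAgg  : ℕ → NS → Maybe (Fin (2 ^ B)) → NS   -- nothing: no incident edges
    out       : ES → ℕ

module Execution (A : Algorithm) {n : ℕ} (G : Graph n) where
  open Algorithm A
  open Graph G

  Config : Set
  Config = (Fin n → NS) × (Fin m → ES)

  Msg : Set
  Msg = Fin (2 ^ B)

  record Step (t : ℕ) (c c' : Config) : Set where
    ns = proj₁ c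
    es = proj₂ c
    Contracted : Fin m → Set
    Contracted f = contract t (es f) ≡ true
    Same : Fin n → Fin n → Set
    Same = Reach G Contracted
    InMinor : Fin m → Set
    InMinor f = ¬ Same (src G f) (dst G f)
    Incident : Fin n → Fin m → Set
    Incident v f = InMinor f × (Same v (src G f) ⊎ Same v (dst G f))
    field
      y    : Fin n → Msg
      yOK  : ∀ v → Σ (List (Fin n)) λ L → Enumerates (Same v) L ×
               Agg (⊕ t) (map (λ u → xval t (ns u)) L) (just (y v))
      es'  : Fin m → ES
      esOK : ∀ f → (InMinor f × es' f ≡ edgeLearn t (es f) (y (src G f)) (y (dst G f)))
                 ⊎ (¬ InMinor f × es' f ≡ es f)
      agg   : Fin n → Maybe Msg
      aggOK : ∀ v → Σ (List (Fin m)) λ L → Enumerates (Incident v) L ×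
                Σ (List Msg) λ Ms →
                Pointwise (λ f z → (Same v (src G f) × z ≡ proj₁ (zval t (es' f)))
                                 ⊎ (Same v (dst G f) × z ≡ proj₂ (zval t (es' f)))) L Ms ×
                Agg (⊗ t) Ms (agg v)
      nsEq : proj₁ c' ≡ (λ v → learnAgg t (learnY t (ns v) (y v)) (agg v))
      esEq : proj₂ c' ≡ es'

  data Run (init : Config) : ℕ → Config → Set where
    start : Run init 0 init
    next  : ∀ {t c c'} → Run init t c → Step t c c' → Run init (suc t) c'

initial : (A : Algorithm) {n : ℕ} (G : Graph n) → (Fin (Graph.m G) → ℕ) → (Fin n → ℕ) →
          (Fin (Graph.m G) → Maybe (Fin n)) → Execution.Config A G
initial A G w ident up =
    (λ v → Algorithm.initN A (ident v))
  , (λ f → Algorithm.initE A (ident (src G f)) (ident (dst G f)) (w f)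
                            (Data.Maybe.map ident (up f)))

-- after R rounds, every tree edge's output is its cut value
-- (for every possible execution, i.e. every order of pairwise aggregation)
ComputesCuts : (A : Algorithm) {n : ℕ} (G : Graph n) → (Fin (Graph.m G) → ℕ) → (Fin n → ℕ) →
               Subset (Graph.m G) → (Fin (Graph.m G) → Maybe (Fin n)) → Set
ComputesCuts A G w ident T up =
  ∀ cfg → Execution.Run A G (initial A G w ident up) (Algorithm.R A) cfg →
  ∀ f → InT G T f → CutIs G T w f (Algorithm.out A (proj₂ cfg f))

{-# OPTIONS --safe #-}

-- Below a tree edge e with child end c, Cut(e) is the weight of the edges leaving the subtree
-- of c.  Four ideas make all these values computable in polylogarithmically many rounds.
--
-- (1) Labels increasing towards the root.  Repeatedly merge clusters of tree edges: first
-- contract the tree edges along which the minimum identifier of the clusters increases towards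
-- the root, then, with the minima of the new clusters, those along which it decreases.  A
-- cluster that still has a parent edge after both steps has at least doubled in size, so
-- 1 + ⌊log n⌋ double steps contract the tree.  The minima met on the way, complemented in the
-- second steps and with later ones more significant, are the digits of a label that strictly
-- increases from child to parent.
--
-- (2) Subtree sums in one round per label bit.  Compare the labels from the top bit down.
-- Among adjacent vertices agreeing on the higher bits, those with current bit 0 lie below those
-- with bit 1; contract each connected piece of the former and hand its sum to the vertex above.
--
-- (3) Rank paths.  Let the rank of v be ⌊log₂ size v⌋ for the subtree sizes found by (2).  Two
-- children of v cannot both have the rank of v, so equal ranks form vertical paths, and
-- different paths of rank k have disjoint subtrees.  Contracting the edges whose child has rank
-- below k leaves, around each vertex x of rank k, exactly the part W of its subtree that does
-- not lie below the next vertex x′ of its path.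
--
-- (4) Cuts along a path.  An edge leaving W towards the subtree of x′ enters Cut(x′) but not
-- Cut(x); any other edge leaving W enters Cut(x) but not Cut(x′).  Hence Cut(x) is the sum,
-- over the vertices of the path up to x, of the second kind of weights minus the first kind,
-- and (2) restricted to the rank paths computes it.
module Submission where

open import Defs
open import Data.Nat using (ℕ; zero; suc; _+_; _*_; _∸_; _^_; _≤_; _<_; _⊓_; ⌊_/2⌋; z≤n; s≤s; s≤s⁻¹; z<s; _/_; _%_; _≡ᵇ_; _<ᵇ_)
import Data.Nat.Properties as ℕₚ
import Data.Nat.DivMod as DM
open import Data.Nat.Logarithm using (⌊log₂_⌋; ⌊log₂⌋-mono-≤; ⌊log₂[2^n]⌋≡n; ⌊log₂⌊n/2⌋⌋≡⌊log₂n⌋∸1)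
open import Data.Nat.Induction using (<-wellFounded)
open import Data.Nat.Solver using (module +-*-Solver)
open import Induction.WellFounded using (Acc; acc)
open import Data.Fin using (Fin; zero; suc; toℕ; fromℕ<; combine)
import Data.Fin.Properties as Finₚ
open import Data.Fin.Properties using (_≟_)
open import Data.Fin.Subset using (Subset; _∈_; ∣_∣)
import Data.Fin.Subset.Properties as Subsetₚ
open import Data.Vec using ([]; _∷_; lookup; tabulate)
import Data.Vec.Properties as Vecₚ
open import Data.Bool using (Bool; true; false; if_then_else_; _∧_; _∨_; not; _xor_)
import Data.Bool.Properties as Boolₚ
open import Data.Maybe using (Maybe; just; nothing; maybe′)
import Data.Maybe as Maybe
import Data.Maybe.Properties as Maybeₚ
open import Data.Product using (Σ; _×_; _,_; proj₁; proj₂; ∃; ∃₂)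
import Data.Product.Properties as Prodₚ
open import Data.Sum using (_⊎_; inj₁; inj₂)
open import Data.Empty using (⊥; ⊥-elim)
open import Data.List using (List; []; _∷_; _++_; map; length; applyUpTo)
open import Data.Nat.ListAction using (sum)
import Data.Nat.ListAction.Properties as ListActionₚ
import Data.List.Properties as Listₚ
open import Data.List.Membership.Propositional using () renaming (_∈_ to _∈ₗ_)
import Data.List.Membership.Propositional.Properties as Memₚ
import Data.List.Membership.DecPropositional as DecMem
open import Data.List.Relation.Unary.Any using (here; there)
open import Data.List.Relation.Unary.All using ([]; _∷_)
import Data.List.Relation.Unary.All as All
open import Data.List.Relation.Unary.AllPairs using ([]; _∷_)
open import Data.List.Relation.Unary.Unique.Propositional using (Unique)
open import Data.List.Relation.Binary.Pointwise using (Pointwise; []; _∷_)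
open import Data.List.Relation.Binary.Permutation.Propositional using (↭-sym)
import Data.List.Relation.Binary.Permutation.Propositional.Properties as Permₚ
open import Relation.Binary.PropositionalEquality using (_≡_; _≢_; refl; sym; trans; cong; cong₂; subst; subst₂; module ≡-Reasoning)
open import Relation.Nullary using (¬_; Dec; yes; no; does)
open import Relation.Nullary.Decidable using (¬?; dec-true; dec-false; does-⇔; _×-dec_; _⊎-dec_)
open import Function using (_∘_; id; case_of_)
open import Function.Bundles using (_⇔_; mk⇔; Equivalence)
open import Function.Definitions using (Injective)

-- Finite sums

infixr 6 _▹_

_▹_ : Bool → ℕ → ℕ
b ▹ x = if b then x else 0

▹-≤ : ∀ b {x} → b ▹ x ≤ x
▹-≤ true  = ℕₚ.≤-refl
▹-≤ false = z≤n

▹-zero : ∀ b → b ▹ 0 ≡ 0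
▹-zero true  = refl
▹-zero false = refl

▹-+ : ∀ b x y → b ▹ (x + y) ≡ (b ▹ x) + (b ▹ y)
▹-+ true  x y = refl
▹-+ false x y = refl

▹-* : ∀ b x q → b ▹ (x * q) ≡ (b ▹ x) * q
▹-* true  x q = refl
▹-* false x q = refl

▹-comm : ∀ a b x → a ▹ b ▹ x ≡ b ▹ a ▹ x
▹-comm true  b     x = refl
▹-comm false true  x = refl
▹-comm false false x = refl

sum-cong : ∀ {n} {f g : Fin n → ℕ} → (∀ i → f i ≡ g i) → sumFin n f ≡ sumFin n g
sum-cong {zero}  eq = refl
sum-cong {suc n} eq = cong₂ _+_ (eq zero) (sum-cong (eq ∘ suc))

sum-mono : ∀ {n} {f g : Fin n → ℕ} → (∀ i → f i ≤ g i) → sumFin n f ≤ sumFin n g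
sum-mono {zero}  le = z≤n
sum-mono {suc n} le = ℕₚ.+-mono-≤ (le zero) (sum-mono (le ∘ suc))

sum-zero : ∀ {n} {f : Fin n → ℕ} → (∀ i → f i ≡ 0) → sumFin n f ≡ 0
sum-zero {zero}  eq = refl
sum-zero {suc n} eq = cong₂ _+_ (eq zero) (sum-zero (eq ∘ suc))

+-interchange : ∀ a b c d → (a + b) + (c + d) ≡ (a + c) + (b + d)
+-interchange = solve 4 (λ a b c d → (a :+ b) :+ (c :+ d) := (a :+ c) :+ (b :+ d)) refl
  where open +-*-Solver

sum-+ : ∀ {n} (f g : Fin n → ℕ) → sumFin n (λ i → f i + g i) ≡ sumFin n f + sumFin n g
sum-+ {zero}  f g = refl
sum-+ {suc n} f g = trans (cong (f zero + g zero +_) (sum-+ (f ∘ suc) (g ∘ suc)))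
                          (+-interchange (f zero) (g zero) _ _)

sum-swap : ∀ {n m} (f : Fin n → Fin m → ℕ) →
           sumFin n (λ i → sumFin m (f i)) ≡ sumFin m (λ j → sumFin n (λ i → f i j))
sum-swap {zero}  {m} f = sym (sum-zero {m} (λ _ → refl))
sum-swap {suc n} {m} f = trans (cong (sumFin m (f zero) +_) (sum-swap (f ∘ suc)))
                               (sym (sum-+ (f zero) _))

sum-* : ∀ {n} (f : Fin n → ℕ) q → sumFin n (λ i → f i * q) ≡ sumFin n f * q
sum-* {zero}  f q = refl
sum-* {suc n} f q = trans (cong (f zero * q +_) (sum-* (f ∘ suc) q))
                          (sym (ℕₚ.*-distribʳ-+ q (f zero) _))

sum-▹ : ∀ {n} b (f : Fin n → ℕ) → b ▹ sumFin n f ≡ sumFin n (λ i → b ▹ f i)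
sum-▹ {n} true  f = refl
sum-▹ {n} false f = sym (sum-zero {n} (λ _ → refl))

sum-const : ∀ n k → sumFin n (λ _ → k) ≡ n * k
sum-const zero    k = refl
sum-const (suc n) k = cong (k +_) (sum-const n k)

sum-bound : ∀ {n} {f : Fin n → ℕ} {k} → (∀ i → f i ≤ k) → sumFin n f ≤ n * k
sum-bound {n} {k = k} le = ℕₚ.≤-trans (sum-mono le) (ℕₚ.≤-reflexive (sum-const n k))

term≤sum : ∀ {n} (f : Fin n → ℕ) j → f j ≤ sumFin n f
term≤sum f zero    = ℕₚ.m≤m+n _ _
term≤sum f (suc j) = ℕₚ.≤-trans (term≤sum (f ∘ suc) j) (ℕₚ.m≤n+m _ (f zero))

sum-only : ∀ {n} (f : Fin n → ℕ) j → (∀ i → i ≢ j → f i ≡ 0) → sumFin n f ≡ f j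
sum-only f zero    z = trans (cong (f zero +_) (sum-zero (λ i → z (suc i) (λ ())))) (ℕₚ.+-identityʳ _)
sum-only f (suc j) z = cong₂ _+_ (z zero (λ ())) (sum-only (f ∘ suc) j λ i i≢j → z (suc i) (i≢j ∘ Finₚ.suc-injective))

≟-refl : ∀ {n} (i : Fin n) → does (i ≟ i) ≡ true
≟-refl i = dec-true (i ≟ i) refl

sum-delta : ∀ {n} (f : Fin n → ℕ) j → sumFin n (λ i → does (i ≟ j) ▹ f i) ≡ f j
sum-delta f j = trans (sum-only _ j λ i i≢j → cong (_▹ f i) (dec-false (i ≟ j) i≢j))
                      (cong (_▹ f j) (≟-refl j))

sum-atMostOne : ∀ {n k} {f : Fin n → ℕ} → (∀ i → f i ≤ k) →
                (∀ i j → f i ≢ 0 → f j ≢ 0 → i ≡ j) → sumFin n f ≤ k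
sum-atMostOne {f = f} le uniq with Finₚ.any? (λ i → ¬? (f i ℕₚ.≟ 0))
... | yes (j , fj≢0) = ℕₚ.≤-trans (ℕₚ.≤-reflexive (sum-only f j only)) (le j)
  where
  only : ∀ i → i ≢ j → f i ≡ 0
  only i i≢j with f i ℕₚ.≟ 0
  ... | yes eq = eq
  ... | no ne  = ⊥-elim (i≢j (uniq i j ne fj≢0))
... | no allZero = ℕₚ.≤-trans (ℕₚ.≤-reflexive (sum-zero λ i → zero-at i)) z≤n
  where
  zero-at : ∀ i → f i ≡ 0
  zero-at i with f i ℕₚ.≟ 0
  ... | yes eq = eq
  ... | no ne  = ⊥-elim (allZero (i , ne))

-- Double counting: each `h (g v)` is spread over all `f` by an indicator. After the swap of the
-- sums, injectivity leaves at most one non-zero indicator per `f`.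
sum-injective : ∀ {n m} (g : Fin n → Fin m) → Injective _≡_ _≡_ g → (h : Fin m → ℕ) →
                sumFin n (λ v → h (g v)) ≤ sumFin m h
sum-injective {n} {m} g inj h = begin
  sumFin n (λ v → h (g v))
    ≡⟨ sum-cong (λ v → sym (sum-delta h (g v))) ⟩
  sumFin n (λ v → sumFin m (λ f → does (f ≟ g v) ▹ h f))
    ≡⟨ sum-swap (λ v f → does (f ≟ g v) ▹ h f) ⟩
  sumFin m (λ f → sumFin n (λ v → does (f ≟ g v) ▹ h f))
    ≤⟨ sum-mono (λ f → sum-atMostOne (λ v → ▹-≤ (does (f ≟ g v))) (atMostOne f)) ⟩
  sumFin m h ∎
  where
  open ℕₚ.≤-Reasoning
  hit : ∀ f v → does (f ≟ g v) ▹ h f ≢ 0 → f ≡ g v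
  hit f v ne with f ≟ g v
  ... | yes eq = eq
  ... | no _   = ⊥-elim (ne refl)
  atMostOne : ∀ f i j → does (f ≟ g i) ▹ h f ≢ 0 → does (f ≟ g j) ▹ h f ≢ 0 → i ≡ j
  atMostOne f i j p q = inj (trans (sym (hit f i p)) (hit f j q))

elem? : ∀ {n} (L : List (Fin n)) (u : Fin n) → Dec (u ∈ₗ L)
elem? L u = DecMem._∈?_ _≟_ u L

-- Aggregates range over duplicate-free enumerations, whereas the analysis uses indicator sums over
-- all indices; this is the bridge between them.
sum-list : ∀ {n} (g : Fin n → ℕ) (L : List (Fin n)) → Unique L →
           sum (map g L) ≡ sumFin n (λ u → does (elem? L u) ▹ g u)
sum-list {n} g []      _          = sym (sum-zero {n} (λ _ → refl))
sum-list {n} g (x ∷ L) (x∉L ∷ ul) = begin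
  g x + sum (map g L)
    ≡⟨ cong₂ _+_ (sym (sum-delta g x)) (sum-list g L ul) ⟩
  sumFin n (λ u → does (u ≟ x) ▹ g u) + sumFin n (λ u → does (elem? L u) ▹ g u)
    ≡⟨ sym (sum-+ (λ u → does (u ≟ x) ▹ g u) (λ u → does (elem? L u) ▹ g u)) ⟩
  sumFin n (λ u → (does (u ≟ x) ▹ g u) + (does (elem? L u) ▹ g u))
    ≡⟨ sum-cong split ⟩
  sumFin n (λ u → does (elem? (x ∷ L) u) ▹ g u) ∎
  where
  open ≡-Reasoning
  split : ∀ u → (does (u ≟ x) ▹ g u) + (does (elem? L u) ▹ g u) ≡ does (elem? (x ∷ L) u) ▹ g u
  split u with u ≟ x | elem? L u
  ... | yes refl | yes u∈L = ⊥-elim (All.lookup x∉L u∈L refl)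
  ... | yes refl | no _    = ℕₚ.+-identityʳ (g u)
  ... | no _     | yes _   = refl
  ... | no _     | no _    = refl

card≡sum : ∀ {m} (T : Subset m) → ∣ T ∣ ≡ sumFin m (λ f → lookup T f ▹ 1)
card≡sum []          = refl
card≡sum (true ∷ T)  = cong suc (card≡sum T)
card≡sum (false ∷ T) = card≡sum T

-- Rooted trees

reach-trans : ∀ {n} {G : Graph n} {P u v w} → Reach G P u v → Reach G P v w → Reach G P u w
reach-trans here             q = q
reach-trans (step f pf j p) q = step f pf j (reach-trans p q)

joins-sym : ∀ {n} {G : Graph n} {f u w} → Joins G f u w → Joins G f w u
joins-sym (inj₁ eq) = inj₂ eq
joins-sym (inj₂ eq) = inj₁ eq

reach-sym : ∀ {n} {G : Graph n} {P u v} → Reach G P u v → Reach G P v u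
reach-sym here            = here
reach-sym {G = G} (step f pf j p) = reach-trans (reach-sym p) (step f pf (joins-sym {G = G} j) here)

reach-map : ∀ {n} {G : Graph n} {P Q u v} → (∀ f → P f → Q f) → Reach G P u v → Reach G Q u v
reach-map g here            = here
reach-map g (step f pf j p) = step f (g f pf) j (reach-map g p)

isTree : Maybe Bool → Bool
isTree (just _) = true
isTree nothing  = false

-- Orientation of an edge: just true if its first endpoint is the parent,
-- just false if its second endpoint is, nothing off the tree.
childSide parentSide : {A : Set} → Maybe Bool → A → A → A
childSide (just true)  a b = b
childSide (just false) a b = a
childSide nothing      a b = a
parentSide (just true)  a b = a
parentSide (just false) a b = b
parentSide nothing      a b = b

-- Only `kind` is visible to the algorithm. `dep` and `pe` serve the analysis: `dep` is a measure
-- for induction towards the root, and `pe` inverts `ch` on tree edges.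
record OrientedTree {n : ℕ} (G : Graph n) : Set where
  open Graph G using (m)
  field
    kind : Fin m → Maybe Bool
    root : Fin n
    dep  : Fin n → ℕ
    pe   : Fin n → Maybe (Fin m)

  tree : Fin m → Bool
  tree f = isTree (kind f)

  ch : Fin m → Fin n
  ch f = childSide (kind f) (src G f) (dst G f)

  pa : Fin m → Fin n
  pa f = parentSide (kind f) (src G f) (dst G f)

  field
    pe-tree : ∀ {v f} → pe v ≡ just f → tree f ≡ true
    pe-ch   : ∀ {v f} → pe v ≡ just f → ch f ≡ v
    ch-pe   : ∀ {f} → tree f ≡ true → pe (ch f) ≡ just f
    pa-dep  : ∀ {f} → tree f ≡ true → dep (pa f) < dep (ch f)
    pe-root : ∀ {v} → pe v ≡ nothing → v ≡ root

_⊆ᵇ_ : {A : Set} → (A → Bool) → (A → Bool) → Set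
P ⊆ᵇ Q = ∀ {f} → P f ≡ true → Q f ≡ true

module Tree {n : ℕ} {G : Graph n} (O : OrientedTree G) where
  open Graph G using (m; ends; loopless)
  open OrientedTree O public

  joins-tree : ∀ {f u w} → Joins G f u w → (u ≡ ch f × w ≡ pa f) ⊎ (u ≡ pa f × w ≡ ch f)
  joins-tree {f} j with kind f
  joins-tree (inj₁ refl) | just true  = inj₂ (refl , refl)
  joins-tree (inj₂ refl) | just true  = inj₁ (refl , refl)
  joins-tree (inj₁ refl) | just false = inj₁ (refl , refl)
  joins-tree (inj₂ refl) | just false = inj₂ (refl , refl)
  joins-tree (inj₁ refl) | nothing    = inj₁ (refl , refl)
  joins-tree (inj₂ refl) | nothing    = inj₂ (refl , refl)

  tree-joins : ∀ f → Joins G f (ch f) (pa f)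
  tree-joins f with kind f
  ... | just true  = inj₂ refl
  ... | just false = inj₁ refl
  ... | nothing    = inj₁ refl

  pe-dep : ∀ {u f} → pe u ≡ just f → dep (pa f) < dep u
  pe-dep {u} {f} eq = subst (λ x → dep (pa f) < dep x) (pe-ch eq) (pa-dep (pe-tree eq))

  -- The ancestor comes first: as a parameter it stays fixed while induction peels parent edges off
  -- the descendant.
  data Below (A : Fin m → Bool) (v : Fin n) : Fin n → Set where
    here : Below A v v
    up   : ∀ {u f} → pe u ≡ just f → A f ≡ true → Below A v (pa f) → Below A v u

  -- A component of the tree edges in `A` is represented by its top, the vertex from which no edge
  -- of `A` leads upwards.
  Top : (Fin m → Bool) → Fin n → Set
  Top A c = ∀ {f} → pe c ≡ just f → A f ≡ false

  module _ {A : Fin m → Bool} where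

    below-dep : ∀ {v u} → Below A v u → dep v ≤ dep u
    below-dep here        = ℕₚ.≤-refl
    below-dep (up eq _ b) = ℕₚ.≤-trans (below-dep b) (ℕₚ.<⇒≤ (pe-dep eq))

    below-weaken : ∀ {B v u} → A ⊆ᵇ B → Below A v u → Below B v u
    below-weaken A⊆B here         = here
    below-weaken A⊆B (up eq a b) = up eq (A⊆B a) (below-weaken A⊆B b)

    below-trans : ∀ {x v u} → Below A x v → Below A v u → Below A x u
    below-trans p here        = p
    below-trans p (up eq a b) = up eq a (below-trans p b)

    below-top : ∀ {v u} → Below A v u → Top A u → u ≡ v
    below-top here         t = refl
    below-top (up eq a _) t = case trans (sym (t eq)) a of λ ()

    -- Both climbs start at `v` and parents are unique, so one is a prefix of the other. What
    -- remains of the longer climb keeps its own edge set.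
    below-compare : ∀ {B b x v} → Below A b v → Below B x v → Below A b x ⊎ Below B x b
    below-compare here          q    = inj₂ q
    below-compare p@(up _ _ _) here = inj₁ p
    below-compare (up eq _ p) (up eq′ _ q) with trans (sym eq) eq′
    ... | refl = below-compare p q

    below-reach : A ⊆ᵇ tree → ∀ {v u} → Below A v u → Reach G (λ f → A f ≡ true) u v
    below-reach A⊆T here = here
    below-reach A⊆T (up {f = f} eq a b) =
      step f a (subst (λ x → Joins G f x (pa f)) (pe-ch eq) (tree-joins f)) (below-reach A⊆T b)

    -- A step down prolongs the climb to `c` and a step up strips its lowest edge; at `c` itself
    -- `Top` forbids a step up. Together with `below-reach` this identifies supernodes with clusters
    -- below a top.
    reach-below : A ⊆ᵇ tree → ∀ {c v u} → Top A c → Below A c v →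
                  Reach G (λ f → A f ≡ true) v u → Below A c u
    reach-below A⊆T t b here = b
    reach-below A⊆T t b (step f a j p) with joins-tree j
    reach-below A⊆T t b           (step f a j p) | inj₂ (refl , refl) =
      reach-below A⊆T t (up (ch-pe (A⊆T a)) a b) p
    reach-below A⊆T t here        (step f a j p) | inj₁ (refl , refl) =
      case trans (sym (t (ch-pe (A⊆T a)))) a of λ ()
    reach-below A⊆T t (up eq _ b) (step f a j p) | inj₁ (refl , refl)
      with trans (sym eq) (ch-pe (A⊆T a))
    ... | refl = reach-below A⊆T t b p

  below-antisym : ∀ {A B u v} → Below A v u → Below B u v → u ≡ v
  below-antisym here        q = refl
  below-antisym (up eq _ b) q = ⊥-elim (ℕₚ.<⇒≱ (pe-dep eq) (ℕₚ.≤-trans (below-dep q) (below-dep b)))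

  climb : ∀ A v → ∃ λ c → Below A c v × Top A c
  climb A v = go v (<-wellFounded (dep v))
    where
    go : ∀ v → Acc _<_ (dep v) → ∃ λ c → Below A c v × Top A c
    go v (acc rs) with pe v in eq
    ... | nothing = v , here , λ eq′ → case trans (sym eq) eq′ of λ ()
    ... | just f with A f in a
    ...   | false = v , here , λ eq′ → subst (λ g → A g ≡ false) (Maybeₚ.just-injective (trans (sym eq) eq′)) a
    ...   | true with go (pa f) (rs (pe-dep eq))
    ...     | c , b , t = c , up eq a b , t

  below-root : ∀ v → Below tree root v
  below-root v with climb tree v
  ... | c , b , t with pe c in eq
  ...   | nothing = subst (λ x → Below tree x v) (pe-root eq) b
  ...   | just f  = case trans (sym (t refl)) (pe-tree eq) of λ ()

  abstract
    below? : ∀ A v u → Dec (Below A v u)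
    below? A v u = go u (<-wellFounded (dep u))
      where
      go : ∀ u → Acc _<_ (dep u) → Dec (Below A v u)
      go u (acc rs) with u ≟ v
      ... | yes refl = yes here
      ... | no u≢v with pe u in eq
      ...   | nothing = no λ { here → u≢v refl ; (up eq′ _ _) → case trans (sym eq) eq′ of λ () }
      ...   | just f with A f in a | go (pa f) (rs (pe-dep eq))
      ...     | false | _ = no λ { here → u≢v refl ; (up eq′ a′ _) → case trans (sym a) (trans (cong A (Maybeₚ.just-injective (trans (sym eq) eq′))) a′) of λ () }
      ...     | true | yes b = yes (up eq a b)
      ...     | true | no ¬b = no λ { here → u≢v refl ; (up eq′ _ b) → ¬b (subst (λ g → Below A v (pa g)) (Maybeₚ.just-injective (trans (sym eq′) eq)) b) }

  sub : (Fin m → Bool) → Fin n → Fin n → Bool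
  sub A v u = does (below? A v u)

  sub-sound : ∀ {A v u} → sub A v u ≡ true → Below A v u
  sub-sound {A} {v} {u} eq with below? A v u
  ... | yes b = b

  sub-complete : ∀ {A v u} → Below A v u → sub A v u ≡ true
  sub-complete {A} {v} {u} = dec-true (below? A v u)

  viaParent : (Fin m → ℕ) → Fin n → ℕ
  viaParent h u = maybe′ h 0 (pe u)

  -- Recursion at the lower end: either `u` is `v`, or the parent of `u` is below `v` and the parent
  -- edge is in `A`. The cases exclude each other because `dep` drops strictly, so the indicators
  -- may be added.
  sub-unfold : ∀ A v u x → sub A v u ▹ x ≡
               (does (u ≟ v) ▹ x) + viaParent (λ f → A f ▹ sub A v (pa f) ▹ x) u
  sub-unfold A v u x with below? A v u | u ≟ v
  sub-unfold A v u x | yes _ | yes refl with pe u in eq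
  ... | nothing = sym (ℕₚ.+-identityʳ x)
  ... | just f rewrite dec-false (below? A v (pa f)) (λ b → ℕₚ.<⇒≱ (pe-dep eq) (below-dep b))
      = sym (trans (cong (x +_) (▹-zero (A f))) (ℕₚ.+-identityʳ x))
  sub-unfold A v u x | yes here | no u≢v = ⊥-elim (u≢v refl)
  sub-unfold A v u x | yes (up eq a b) | no _
    rewrite eq | a | sub-complete b = refl
  sub-unfold A v u x | no ¬b | yes refl = ⊥-elim (¬b here)
  sub-unfold A v u x | no ¬b | no _ with pe u in eq
  ... | nothing = refl
  ... | just f with A f in a
  ...   | false = refl
  ...   | true rewrite dec-false (below? A v (pa f)) (λ b → ¬b (up eq a b)) = refl

  isChild : (Fin m → Bool) → Fin n → Fin n → Bool
  isChild A v w = maybe′ (λ f → A f ∧ does (pa f ≟ v)) false (pe w)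

  isChild-pe : ∀ A v {w f} → pe w ≡ just f → isChild A v w ≡ A f ∧ does (pa f ≟ v)
  isChild-pe A v eq = cong (maybe′ _ false) eq

  isChild-sound : ∀ {A v w} → isChild A v w ≡ true → ∃ λ f → pe w ≡ just f × A f ≡ true × pa f ≡ v
  isChild-sound {A} {v} {w} eq with pe w
  ... | just f with A f in a | pa f ≟ v
  ...   | true | yes p = f , refl , a , p
  ...   | true | no _ = case eq of λ ()

  isChild-complete : ∀ {A w f} → pe w ≡ just f → A f ≡ true → isChild A (pa f) w ≡ true
  isChild-complete {A} {w} {f} eq a = trans (isChild-pe A (pa f) eq) (cong₂ _∧_ a (≟-refl (pa f)))

  -- Recursion at the upper end, by induction on `dep u`: `sub-unfold` carries both sides over to
  -- the parent of `u`.
  sub-children : ∀ A v u x → sub A v u ▹ x ≡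
                 (does (u ≟ v) ▹ x) + sumFin n (λ w → isChild A v w ▹ sub A w u ▹ x)
  sub-children A v u x = go u (<-wellFounded (dep u))
    where
    open ≡-Reasoning
    go : ∀ u → Acc _<_ (dep u) → sub A v u ▹ x ≡
         (does (u ≟ v) ▹ x) + sumFin n (λ w → isChild A v w ▹ sub A w u ▹ x)
    go u (acc rs) = trans (sub-unfold A v u x) (cong ((does (u ≟ v) ▹ x) +_) (sym rest))
      where
      self : sumFin n (λ w → isChild A v w ▹ does (u ≟ w) ▹ x) ≡ isChild A v u ▹ x
      self = begin
        sumFin n (λ w → isChild A v w ▹ does (u ≟ w) ▹ x)
          ≡⟨ sum-cong (λ w → trans (▹-comm (isChild A v w) _ x)
                 (cong (_▹ isChild A v w ▹ x) (does-⇔ (mk⇔ sym sym) (u ≟ w) (w ≟ u)))) ⟩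
        sumFin n (λ w → does (w ≟ u) ▹ isChild A v w ▹ x)
          ≡⟨ sum-delta (λ w → isChild A v w ▹ x) u ⟩
        isChild A v u ▹ x ∎
      rest : sumFin n (λ w → isChild A v w ▹ sub A w u ▹ x) ≡
             viaParent (λ f → A f ▹ sub A v (pa f) ▹ x) u
      rest = begin
        sumFin n (λ w → isChild A v w ▹ sub A w u ▹ x)
          ≡⟨ sum-cong (λ w → trans (cong (isChild A v w ▹_) (sub-unfold A w u x))
                                   (▹-+ (isChild A v w) (does (u ≟ w) ▹ x) _)) ⟩
        sumFin n (λ w → (isChild A v w ▹ does (u ≟ w) ▹ x) +
                        (isChild A v w ▹ viaParent (λ f → A f ▹ sub A w (pa f) ▹ x) u))
          ≡⟨ sum-+ (λ w → isChild A v w ▹ does (u ≟ w) ▹ x) _ ⟩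
        sumFin n (λ w → isChild A v w ▹ does (u ≟ w) ▹ x) +
        sumFin n (λ w → isChild A v w ▹ viaParent (λ f → A f ▹ sub A w (pa f) ▹ x) u)
          ≡⟨ cong (_+ sumFin n (λ w → isChild A v w ▹ viaParent (λ f → A f ▹ sub A w (pa f) ▹ x) u)) self ⟩
        (isChild A v u ▹ x) +
        sumFin n (λ w → isChild A v w ▹ viaParent (λ f → A f ▹ sub A w (pa f) ▹ x) u)
          ≡⟨ parent ⟩
        viaParent (λ f → A f ▹ sub A v (pa f) ▹ x) u ∎
        where
        parent : (isChild A v u ▹ x) +
                 sumFin n (λ w → isChild A v w ▹ viaParent (λ f → A f ▹ sub A w (pa f) ▹ x) u) ≡
                 viaParent (λ f → A f ▹ sub A v (pa f) ▹ x) u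
        parent with pe u in eq
        ... | nothing = sum-zero (λ w → ▹-zero (isChild A v w))
        ... | just f with A f
        ...   | false = sum-zero (λ w → ▹-zero (isChild A v w))
        -- Here `u` is a child of `v` exactly when `pa f` is `v`, so the goal is the induction
        -- hypothesis at `pa f`, reversed.
        ...   | true  = sym (go (pa f) (rs (pe-dep eq)))

  tot : (Fin m → Bool) → (Fin n → ℕ) → Fin n → ℕ
  tot A o v = sumFin n (λ u → sub A v u ▹ o u)

  tot≤sum : ∀ A o v → tot A o v ≤ sumFin n o
  tot≤sum A o v = sum-mono (λ u → ▹-≤ (sub A v u))

  tot-children : ∀ A o v → tot A o v ≡ o v + sumFin n (λ w → isChild A v w ▹ tot A o w)
  tot-children A o v = begin
    sumFin n (λ u → sub A v u ▹ o u)
      ≡⟨ sum-cong (λ u → sub-children A v u (o u)) ⟩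
    sumFin n (λ u → (does (u ≟ v) ▹ o u) + sumFin n (λ w → isChild A v w ▹ sub A w u ▹ o u))
      ≡⟨ sum-+ (λ u → does (u ≟ v) ▹ o u) _ ⟩
    sumFin n (λ u → does (u ≟ v) ▹ o u) + sumFin n (λ u → sumFin n (λ w → isChild A v w ▹ sub A w u ▹ o u))
      ≡⟨ cong₂ _+_ (sum-delta o v)
          (trans (sum-swap (λ u w → isChild A v w ▹ sub A w u ▹ o u))
                 (sum-cong (λ w → sym (sum-▹ (isChild A v w) (λ u → sub A w u ▹ o u))))) ⟩
    o v + sumFin n (λ w → isChild A v w ▹ tot A o w) ∎
    where open ≡-Reasoning

  inCluster : (Fin m → Bool) → Fin n → Bool
  inCluster A w = maybe′ A false (pe w)

  -- Add up the totals of all vertices of the A-cluster with top c: expanded over children,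
  -- every total inside the cluster except that of c occurs on both sides and cancels.
  tot-cluster : ∀ {A Act} → A ⊆ᵇ Act → ∀ o c →
    sumFin n (λ u → sub A c u ▹ (o u + sumFin n (λ w → (isChild Act u w ∧ not (inCluster A w)) ▹ tot Act o w)))
    ≡ tot Act o c
  tot-cluster {A} {Act} A⊆Act o c = ℕₚ.+-cancelʳ-≡ inner _ _ (trans (sym viaChildren) viaTop)
    where
    open ≡-Reasoning
    t = tot Act o
    hang : Fin n → ℕ
    -- `hang u` collects the children of `u` that lie outside its cluster; `inner` collects the
    -- cluster members other than `c`, each reached through its parent.
    hang u = sumFin n (λ w → (isChild Act u w ∧ not (inCluster A w)) ▹ t w)
    inner = sumFin n (λ w → viaParent (λ f → A f ▹ sub A c (pa f) ▹ t w) w)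

    childSplit : ∀ u w → isChild Act u w ▹ t w ≡
                 ((isChild Act u w ∧ not (inCluster A w)) ▹ t w) + (isChild A u w ▹ t w)
    childSplit u w with pe w
    ... | nothing = refl
    ... | just f with A f in a
    ...   | true rewrite A⊆Act a with does (pa f ≟ u)
    ...     | true  = refl
    ...     | false = refl
    childSplit u w | just f | false = trans (cong (_▹ t w) (sym (Boolₚ.∧-identityʳ _))) (sym (ℕₚ.+-identityʳ _))

    gather : ∀ w → sumFin n (λ u → sub A c u ▹ isChild A u w ▹ t w) ≡
                   viaParent (λ f → A f ▹ sub A c (pa f) ▹ t w) w
    gather w with pe w
    ... | nothing = sum-zero (λ u → ▹-zero (sub A c u))
    ... | just f with A f
    ...   | false = sum-zero (λ u → ▹-zero (sub A c u))
    ...   | true  = trans (sum-cong (λ u → trans (▹-comm (sub A c u) _ (t w))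
                       (cong (_▹ sub A c u ▹ t w) (does-⇔ (mk⇔ sym sym) (pa f ≟ u) (u ≟ pa f)))))
                     (sum-delta (λ u → sub A c u ▹ t w) (pa f))

    viaChildren : sumFin n (λ u → sub A c u ▹ t u) ≡ sumFin n (λ u → sub A c u ▹ (o u + hang u)) + inner
    viaChildren = begin
      sumFin n (λ u → sub A c u ▹ t u)
        ≡⟨ sum-cong (λ u → cong (sub A c u ▹_) (trans (tot-children Act o u) (trans (cong (o u +_)
             (trans (sum-cong (childSplit u)) (sum-+ (λ w → (isChild Act u w ∧ not (inCluster A w)) ▹ t w) _)))
             (sym (ℕₚ.+-assoc (o u) (hang u) _))))) ⟩
      sumFin n (λ u → sub A c u ▹ ((o u + hang u) + sumFin n (λ w → isChild A u w ▹ t w)))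
        ≡⟨ sum-cong (λ u → ▹-+ (sub A c u) (o u + hang u) _) ⟩
      sumFin n (λ u → (sub A c u ▹ (o u + hang u)) + (sub A c u ▹ sumFin n (λ w → isChild A u w ▹ t w)))
        ≡⟨ sum-+ (λ u → sub A c u ▹ (o u + hang u)) _ ⟩
      sumFin n (λ u → sub A c u ▹ (o u + hang u)) + sumFin n (λ u → sub A c u ▹ sumFin n (λ w → isChild A u w ▹ t w))
        ≡⟨ cong (sumFin n (λ u → sub A c u ▹ (o u + hang u)) +_)
             (trans (sum-cong (λ u → sum-▹ (sub A c u) (λ w → isChild A u w ▹ t w)))
             (trans (sum-swap (λ u w → sub A c u ▹ isChild A u w ▹ t w)) (sum-cong gather))) ⟩
      sumFin n (λ u → sub A c u ▹ (o u + hang u)) + inner ∎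

    viaTop : sumFin n (λ u → sub A c u ▹ t u) ≡ t c + inner
    viaTop = begin
      sumFin n (λ u → sub A c u ▹ t u)
        ≡⟨ sum-cong (λ u → sub-unfold A c u (t u)) ⟩
      sumFin n (λ u → (does (u ≟ c) ▹ t u) + viaParent (λ f → A f ▹ sub A c (pa f) ▹ t u) u)
        ≡⟨ sum-+ (λ u → does (u ≟ c) ▹ t u) _ ⟩
      sumFin n (λ u → does (u ≟ c) ▹ t u) + inner
        ≡⟨ cong (_+ inner) (sum-delta t c) ⟩
      t c + inner ∎

  -- Every tree edge is the parent edge of exactly one vertex, its child end, so an edge sum over
  -- the tree can be read as a vertex sum.
  sum-tree : (h : Fin m → ℕ) → (∀ f → tree f ≡ false → h f ≡ 0) → sumFin m h ≡ sumFin n (viaParent h)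
  sum-tree h off = begin
    sumFin m h
      ≡⟨ sum-cong (λ f → sym (column f)) ⟩
    sumFin m (λ f → sumFin n (λ v → hit v f))
      ≡⟨ sum-swap (λ f v → hit v f) ⟩
    sumFin n (λ v → sumFin m (hit v))
      ≡⟨ sum-cong row ⟩
    sumFin n (viaParent h) ∎
    where
    open ≡-Reasoning
    hit : Fin n → Fin m → ℕ
    hit v f = maybe′ (λ g → does (f ≟ g) ▹ h f) 0 (pe v)
    row : ∀ v → sumFin m (hit v) ≡ viaParent h v
    row v with pe v
    ... | nothing = sum-zero {m} (λ _ → refl)
    ... | just g  = sum-delta h g
    column : ∀ f → sumFin n (λ v → hit v f) ≡ h f
    column f with tree f in t
    ... | true = trans (sum-only (λ v → hit v f) (ch f) other) here-hit
      where
      here-hit : hit (ch f) f ≡ h f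
      here-hit = trans (cong (maybe′ (λ g → does (f ≟ g) ▹ h f) 0) (ch-pe t)) (cong (_▹ h f) (≟-refl f))
      other : ∀ v → v ≢ ch f → hit v f ≡ 0
      other v v≢ with pe v in eq
      ... | nothing = refl
      ... | just g with f ≟ g
      ...   | yes refl = ⊥-elim (v≢ (sym (pe-ch eq)))
      ...   | no _     = refl
    ... | false = trans (sum-zero none-hit) (sym (off f t))
      where
      none-hit : ∀ v → hit v f ≡ 0
      none-hit v with pe v
      ... | nothing = refl
      ... | just g  = trans (cong (does (f ≟ g) ▹_) (off f t)) (▹-zero (does (f ≟ g)))

  crosses : Fin n → Fin m → Bool
  crosses c f = sub tree c (src G f) xor sub tree c (dst G f)

  cut : (Fin m → ℕ) → Fin n → ℕ
  cut w c = sumFin m (λ f → crosses c f ▹ w f)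

-- The orientation of a spanning tree, and the edges crossing a tree edge

least : {P : ℕ → Set} → (∀ k → Dec (P k)) → ∀ k → P k → ∃ λ j → P j × (∀ i → P i → j ≤ i)
least P? zero    p = zero , p , λ _ _ → z≤n
least {P} P? (suc k) p with P? 0
... | yes p₀ = 0 , p₀ , λ _ _ → z≤n
... | no ¬p₀ with least {P ∘ suc} (P? ∘ suc) k p
...   | j , pj , min = suc j , pj , λ { zero p₀ → ⊥-elim (¬p₀ p₀) ; (suc i) pi → s≤s (min i pi) }

joins? : ∀ {n} (G : Graph n) f u w → Dec (Joins G f u w)
joins? G f u w = Prodₚ.≡-dec _≟_ _≟_ _ _ ⊎-dec Prodₚ.≡-dec _≟_ _≟_ _ _

<⇒<ᵇ≡true : ∀ {a b} → a < b → (a <ᵇ b) ≡ true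
<⇒<ᵇ≡true a<b = Equivalence.to Boolₚ.T-≡ (ℕₚ.<⇒<ᵇ a<b)

≤⇒<ᵇ≡false : ∀ {a b} → b ≤ a → (a <ᵇ b) ≡ false
≤⇒<ᵇ≡false {a} {b} b≤a with a <ᵇ b in eq
... | false = refl
... | true  = ⊥-elim (ℕₚ.<⇒≱ (ℕₚ.<ᵇ⇒< a b (Equivalence.from Boolₚ.T-≡ eq)) b≤a)

<ᵇ≡true⇒< : ∀ {a b} → (a <ᵇ b) ≡ true → a < b
<ᵇ≡true⇒< {a} {b} eq = ℕₚ.<ᵇ⇒< a b (Equivalence.from Boolₚ.T-≡ eq)

<ᵇ≡false⇒≥ : ∀ {a b} → (a <ᵇ b) ≡ false → b ≤ a
<ᵇ≡false⇒≥ {a} {b} eq = ℕₚ.≮⇒≥ λ a<b → case trans (sym eq) (<⇒<ᵇ≡true a<b) of λ ()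

module Spanning {n : ℕ} (G : Graph n) (T : Subset (Graph.m G)) (r : Fin n) (spanning : IsSpanningTree G T) where
  open Graph G using (m; ends; loopless)

  -- A walk of exactly `k` tree edges to `r`. Fixing the length makes the relation decidable, so
  -- that `closest` can pick a shortest walk.
  Near : ℕ → Fin n → Set
  Near zero    v = v ≡ r
  Near (suc k) v = ∃ λ f → f ∈ T × ∃ λ w → Joins G f v w × Near k w

  near? : ∀ k v → Dec (Near k v)
  near? zero    v = v ≟ r
  near? (suc k) v = Finₚ.any? λ f → Subsetₚ._∈?_ f T ×-dec Finₚ.any? λ w → joins? G f v w ×-dec near? k w

  reach⇒near : ∀ {v} → Reach G (InT G T) v r → ∃ λ k → Near k v
  reach⇒near here           = 0 , refl
  reach⇒near (step f i j p) with reach⇒near p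
  ... | k , q = suc k , f , i , _ , j , q

  abstract
    closest : ∀ v → ∃ λ k → Near k v × (∀ i → Near i v → k ≤ i)
    closest v with reach⇒near (proj₁ spanning v r)
    ... | k , q = least (λ k → near? k v) k q

  dist : Fin n → ℕ
  dist v = proj₁ (closest v)

  Link : Fin n → Fin m → Fin n → Set
  Link v f w = f ∈ T × Joins G f v w × dist w < dist v

  -- The first edge of a shortest walk to `r` ends at a vertex that is strictly closer to `r`.
  link : ∀ v → v ≡ r ⊎ ∃₂ (Link v)
  link v with dist v | proj₁ (proj₂ (closest v))
  ... | zero  | v≡r = inj₁ v≡r
  ... | suc k | f , i , w , j , q =
    inj₂ (f , w , i , j , s≤s (proj₂ (proj₂ (closest w)) k q))

  parentEdge : ∀ {v} → v ≡ r ⊎ ∃₂ (Link v) → Maybe (Fin m)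
  parentEdge (inj₁ _)       = nothing
  parentEdge (inj₂ (f , _)) = just f

  pe₀ : Fin n → Maybe (Fin m)
  pe₀ v = parentEdge (link v)

  pe₀-link : ∀ {v f} → pe₀ v ≡ just f → ∃ (Link v f)
  pe₀-link {v} eq with link v | eq
  ... | inj₂ (f , w , l) | refl = w , l

  pe₀-root : ∀ {v} → pe₀ v ≡ nothing → v ≡ r
  pe₀-root {v} eq with link v | eq
  ... | inj₁ v≡r | _ = v≡r

  link-injective : ∀ {v v′ f w w′} → Link v f w → Link v′ f w′ → v ≡ v′
  link-injective (_ , inj₁ refl , d) (_ , inj₁ refl , d′) = refl
  link-injective (_ , inj₁ refl , d) (_ , inj₂ refl , d′) = ⊥-elim (ℕₚ.<-asym d d′)
  link-injective (_ , inj₂ refl , d) (_ , inj₁ refl , d′) = ⊥-elim (ℕₚ.<-asym d d′)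
  link-injective (_ , inj₂ refl , d) (_ , inj₂ refl , d′) = refl

  -- A tree edge that is nobody's parent edge would, assigned to r, extend the injection
  -- v ↦ pe₀ v to all n vertices, whereas T has n - 1 edges.
  covered : ∀ {f} → f ∈ T → ∃ λ v → pe₀ v ≡ just f
  covered {f} f∈T with Finₚ.any? (λ v → Maybeₚ.≡-dec _≟_ (pe₀ v) (just f))
  ... | yes p = p
  ... | no ¬p = ⊥-elim (ℕₚ.<⇒≱ (ℕₚ.≤-reflexive (sym (proj₂ spanning))) n≤∣T∣)
    where
    g′ : Maybe (Fin m) → Fin m
    g′ = maybe′ (λ h → h) f
    g : Fin n → Fin m
    g v = g′ (pe₀ v)
    g-injective : Injective _≡_ _≡_ g
    g-injective {u} {v} eq with pe₀ u in p | pe₀ v in q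
    ... | nothing | nothing = trans (pe₀-root p) (sym (pe₀-root q))
    ... | nothing | just h  = ⊥-elim (¬p (v , trans q (cong just (sym eq))))
    ... | just h  | nothing = ⊥-elim (¬p (u , trans p (cong just eq)))
    ... | just h  | just h′ with refl ← eq = link-injective (proj₂ (pe₀-link p)) (proj₂ (pe₀-link q))
    g∈T : ∀ v → lookup T (g v) ▹ 1 ≡ 1
    g∈T v with pe₀ v in p
    ... | nothing = cong (_▹ 1) (Vecₚ.[]=⇒lookup f∈T)
    ... | just h  = cong (_▹ 1) (Vecₚ.[]=⇒lookup (proj₁ (proj₂ (pe₀-link p))))
    n≤∣T∣ : n ≤ ∣ T ∣
    n≤∣T∣ = begin
      n                                    ≡⟨ sym (ℕₚ.*-identityʳ n) ⟩
      n * 1                                ≡⟨ sym (sum-const n 1) ⟩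
      sumFin n (λ _ → 1)                   ≡⟨ sum-cong (λ v → sym (g∈T v)) ⟩
      sumFin n (λ v → lookup T (g v) ▹ 1)  ≤⟨ sum-injective g g-injective (λ f → lookup T f ▹ 1) ⟩
      sumFin m (λ f → lookup T f ▹ 1)      ≡⟨ sym (card≡sum T) ⟩
      ∣ T ∣                                ∎
      where open ℕₚ.≤-Reasoning

  -- The parent is the end closer to `r`. A tie cannot occur on a tree edge, since by `covered` each
  -- of them is a `Link`.
  kind₀ : Fin m → Maybe Bool
  kind₀ f = if lookup T f then just (dist (src G f) <ᵇ dist (dst G f)) else nothing

  kind₀-∈ : ∀ {f} → f ∈ T → kind₀ f ≡ just (dist (src G f) <ᵇ dist (dst G f))
  kind₀-∈ f∈T rewrite Vecₚ.[]=⇒lookup f∈T = refl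

  ∈-kind₀ : ∀ {f} → isTree (kind₀ f) ≡ true → f ∈ T
  ∈-kind₀ {f} eq with lookup T f in l
  ... | true = Vecₚ.lookup⇒[]= f T l

  link-sides : ∀ {v f w} → Link v f w → childSide (kind₀ f) (src G f) (dst G f) ≡ v ×
                                        parentSide (kind₀ f) (src G f) (dst G f) ≡ w
  link-sides (f∈T , inj₁ refl , d) rewrite kind₀-∈ f∈T | ≤⇒<ᵇ≡false (ℕₚ.<⇒≤ d) = refl , refl
  link-sides (f∈T , inj₂ refl , d) rewrite kind₀-∈ f∈T | <⇒<ᵇ≡true d = refl , refl

  oriented : OrientedTree G
  oriented = record
    { kind = kind₀ ; root = r ; dep = dist ; pe = pe₀
    ; pe-tree = λ eq → cong isTree (kind₀-∈ (proj₁ (proj₂ (pe₀-link eq))))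
    ; pe-ch   = λ eq → proj₁ (link-sides (proj₂ (pe₀-link eq)))
    ; ch-pe   = ch-pe₀
    ; pa-dep  = pa-dep₀
    ; pe-root = pe₀-root
    }
    where
    ch-pe₀ : ∀ {f} → isTree (kind₀ f) ≡ true → pe₀ (childSide (kind₀ f) (src G f) (dst G f)) ≡ just f
    ch-pe₀ t with covered (∈-kind₀ t)
    ... | v , eq = trans (cong pe₀ (proj₁ (link-sides (proj₂ (pe₀-link eq))))) eq
    pa-dep₀ : ∀ {f} → isTree (kind₀ f) ≡ true →
              dist (parentSide (kind₀ f) (src G f) (dst G f)) < dist (childSide (kind₀ f) (src G f) (dst G f))
    pa-dep₀ t with covered (∈-kind₀ t)
    ... | v , eq with pe₀-link eq
    ...   | w , l = subst₂ (λ a b → dist a < dist b) (sym (proj₂ (link-sides l))) (sym (proj₁ (link-sides l))) (proj₂ (proj₂ l))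

  open Tree {G = G} oriented public

  ∈⇒tree : ∀ {f} → f ∈ T → tree f ≡ true
  ∈⇒tree f∈T = cong isTree (kind₀-∈ f∈T)

  -- If `u` already occurs on the simple path built for the rest of the walk, the suffix starting at
  -- `u` cuts off the loop.
  simplePath : ∀ {P u v} → Reach G P u v → ∃₂ (SPath G P u v)
  simplePath here = _ , _ , stop
  simplePath {P} {u} {v} (step f pf j p) with simplePath p
  ... | vs , es , s with elem? vs u
  ...   | yes u∈vs = suffix s u∈vs
    where
    suffix : ∀ {w vs es} → SPath G P w v vs es → u ∈ₗ vs → ∃₂ (SPath G P u v)
    suffix stop               (here refl) = _ , _ , stop
    suffix s@(step _ _ _ _ _) (here refl) = _ , _ , s
    suffix (step _ _ _ _ s)   (there q)   = suffix s q
  ...   | no u∉vs = _ , _ , step f pf j u∉vs s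

  head∈ : ∀ {P u v vs es} → SPath G P u v vs es → u ∈ₗ vs
  head∈ stop             = here refl
  head∈ (step _ _ _ _ _) = here refl

  end∈ : ∀ {P a b vs es e u w} → SPath G P a b vs es → e ∈ₗ es → Joins G e u w → u ∈ₗ vs
  end∈ (step f _ (inj₁ refl) _ s) (here refl) (inj₁ refl) = here refl
  end∈ (step f _ (inj₁ refl) _ s) (here refl) (inj₂ refl) = there (head∈ s)
  end∈ (step f _ (inj₂ refl) _ s) (here refl) (inj₁ refl) = there (head∈ s)
  end∈ (step f _ (inj₂ refl) _ s) (here refl) (inj₂ refl) = here refl
  end∈ (step f _ _ _ s)           (there e∈)  j           = there (end∈ s e∈ j)

  module _ {e : Fin m} (e∈T : e ∈ T) where

    private
      inside : Fin n → Bool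
      inside = sub tree (ch e)

    inside-ch : inside (ch e) ≡ true
    inside-ch = sub-complete here

    inside-pa : inside (pa e) ≡ false
    inside-pa = dec-false (below? tree (ch e) (pa e)) λ b → ℕₚ.<⇒≱ (pa-dep (∈⇒tree e∈T)) (below-dep b)

    -- A climb from `ch g` to `ch e` cannot be empty, for then `g` would be the parent edge `e`;
    -- hence it passes through `pa g`.
    inside-other : ∀ {g} → g ∈ T → g ≢ e → inside (ch g) ≡ inside (pa g)
    inside-other {g} g∈T g≢e = does-⇔ (mk⇔ to (up pg (∈⇒tree g∈T))) (below? tree (ch e) (ch g)) (below? tree (ch e) (pa g))
      where
      pg = ch-pe (∈⇒tree g∈T)
      to : Below tree (ch e) (ch g) → Below tree (ch e) (pa g)
      to b = go refl b
        where
        go : ∀ {u} → u ≡ ch g → Below tree (ch e) u → Below tree (ch e) (pa g)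
        go eq here = ⊥-elim (g≢e (Maybeₚ.just-injective (trans (sym pg) (trans (cong pe (sym eq)) (ch-pe (∈⇒tree e∈T))))))
        go refl (up eq _ b) with trans (sym eq) pg
        ... | refl = b

    joins-other : ∀ {g u w} → g ∈ T → g ≢ e → Joins G g u w → inside u ≡ inside w
    joins-other g∈T g≢e j with joins-tree j
    ... | inj₁ (refl , refl) = inside-other g∈T g≢e
    ... | inj₂ (refl , refl) = sym (inside-other g∈T g≢e)

    joins-self : ∀ {u w} → Joins G e u w → inside u ≡ not (inside w)
    joins-self j with joins-tree j
    ... | inj₁ (refl , refl) = trans inside-ch (cong not (sym inside-pa))
    ... | inj₂ (refl , refl) = trans inside-pa (cong not (sym inside-ch))

    path-avoids : ∀ {u v vs es} → SPath G (InT G T) u v vs es → ¬ e ∈ₗ es → inside u ≡ inside v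
    path-avoids stop                 e∉ = refl
    path-avoids (step f f∈T j _ s) e∉ =
      trans (joins-other f∈T (λ { refl → e∉ (here refl) }) j) (path-avoids s (e∉ ∘ there))

    -- A simple path uses `e` only once: a second use would visit again the vertex from which `e`
    -- was first entered. So membership in the subtree flips exactly once.
    path-uses : ∀ {u v vs es} → SPath G (InT G T) u v vs es → e ∈ₗ es → inside u ≡ not (inside v)
    path-uses (step f f∈T j u∉ s) e∈ with f ≟ e
    ... | yes refl = trans (joins-self j) (cong not (path-avoids s λ e∈es → u∉ (end∈ s e∈es j)))
    path-uses (step f f∈T j u∉ s) (here refl) | no f≢e = ⊥-elim (f≢e refl)
    path-uses (step f f∈T j u∉ s) (there e∈)  | no f≢e = trans (joins-other f∈T f≢e j) (path-uses s e∈)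

    onPath⇒ : ∀ {u v} → OnTPath G T e u v → inside u xor inside v ≡ true
    onPath⇒ {u} {v} (_ , _ , s , e∈) rewrite path-uses s e∈ with inside v
    ... | true  = refl
    ... | false = refl

    onPath⇐ : ∀ {u v} → inside u xor inside v ≡ true → OnTPath G T e u v
    onPath⇐ {u} {v} x with simplePath (proj₁ spanning u v)
    ... | vs , es , s with elem? es e
    ...   | yes e∈ = vs , es , s , e∈
    ...   | no e∉ = case trans (sym x) (trans (cong (_xor inside v) (path-avoids s e∉)) (Boolₚ.xor-same (inside v))) of λ ()

  cut-correct : ∀ w {e} → e ∈ T → CutIs G T w e (cut w (ch e))
  cut-correct w {e} e∈T = tabulate (crosses (ch e)) , mem , sum-cong (λ f → cong (_▹ w f) (sym (look f)))
    where
    look : ∀ f → lookup (tabulate (crosses (ch e))) f ≡ crosses (ch e) f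
    look = Vecₚ.lookup∘tabulate (crosses (ch e))
    mem : ∀ f → (f ∈ tabulate (crosses (ch e))) ⇔ OnTPath G T e (src G f) (dst G f)
    mem f = mk⇔ (λ i → onPath⇐ e∈T (trans (sym (look f)) (Vecₚ.[]=⇒lookup i)))
                (λ p → Vecₚ.lookup⇒[]= f _ (trans (look f) (onPath⇒ e∈T p)))

  -- Vertices below `ch f` are at least as far from `r` as `ch f`, whose distance is positive.
  root-outside : ∀ {f} → f ∈ T → sub tree (ch f) r ≡ false
  root-outside {f} f∈T = dec-false (below? tree (ch f) r) λ b →
    ℕₚ.n≮0 (ℕₚ.≤-trans (pa-dep (∈⇒tree f∈T)) (ℕₚ.≤-trans (below-dep b) (proj₂ (proj₂ (closest r)) 0 refl)))

  -- The left side is the orientation that an edge computes from identifiers in `initE`. If the path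
  -- from an endpoint to `r` uses `f`, that endpoint lies below `ch f`, because `r` does not; since
  -- `pa f` does not lie there either, the endpoint is the child.
  parentInfo-kind : ∀ {toward} (ident : Fin n → ℕ) → Injective _≡_ _≡_ ident → ParentInfo G T r toward → ∀ f →
                    Maybe.map (_≡ᵇ ident (src G f)) (Maybe.map ident (toward f)) ≡ kind f
  parentInfo-kind {toward} ident inj info f with info f
  ... | inj₁ (f∉T , eq) rewrite eq with lookup T f in l
  ...   | true  = ⊥-elim (f∉T (Vecₚ.lookup⇒[]= f T l))
  ...   | false = refl
  parentInfo-kind {toward} ident inj info f | inj₂ (f∈T , inj₁ (eq , p)) =
    trans (cong (Maybe.map (_≡ᵇ ident (src G f)) ∘ Maybe.map ident) eq) (trans (cong just same) (dst-child f∈T inDst))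
    where
    same : (ident (src G f) ≡ᵇ ident (src G f)) ≡ true
    same = Equivalence.to Boolₚ.T-≡ (ℕₚ.≡⇒≡ᵇ (ident (src G f)) _ refl)
    inDst : sub tree (ch f) (dst G f) ≡ true
    inDst with onPath⇒ f∈T p
    ... | x rewrite root-outside f∈T = trans (sym (Boolₚ.xor-identityʳ _)) x
    dst-child : f ∈ T → sub tree (ch f) (dst G f) ≡ true → just true ≡ kind f
    dst-child f∈T i with kind f | inside-pa f∈T
    ... | just true  | _ = refl
    ... | just false | o = case trans (sym i) o of λ ()
    ... | nothing    | o = case trans (sym i) o of λ ()
  parentInfo-kind {toward} ident inj info f | inj₂ (f∈T , inj₂ (eq , p)) =
    trans (cong (Maybe.map (_≡ᵇ ident (src G f)) ∘ Maybe.map ident) eq) (trans (cong just differ) (src-child inSrc))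
    where
    differ : (ident (dst G f) ≡ᵇ ident (src G f)) ≡ false
    differ with ident (dst G f) ≡ᵇ ident (src G f) in q
    ... | false = refl
    ... | true  = ⊥-elim (loopless f (sym (inj (ℕₚ.≡ᵇ⇒≡ _ _ (Equivalence.from Boolₚ.T-≡ q)))))
    inSrc : sub tree (ch f) (src G f) ≡ true
    inSrc with onPath⇒ f∈T p
    ... | x rewrite root-outside f∈T = trans (sym (Boolₚ.xor-identityʳ _)) x
    src-child : sub tree (ch f) (src G f) ≡ true → just false ≡ kind f
    src-child i with kind f in k | inside-pa f∈T
    ... | just true  | o = case trans (sym i) o of λ ()
    ... | just false | _ = refl
    ... | nothing    | _ = case trans (sym (cong isTree k)) (∈⇒tree f∈T) of λ ()

-- Executions of round sequences

-- `lab` is the label under construction, `val` the summand or partial sum of the current stage, and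
-- `pid` the least identifier on the rank path.
record NState : Set where
  constructor nst
  field
    nid lab val size pid : ℕ

-- Superscripts mark copies of values at the child and at the parent end. `flag` marks the edges
-- contracted by the labelling phases; `res` is the still encoded answer.
record EState : Set where
  constructor est
  field
    wt   : ℕ
    kd   : Maybe Bool
    flag : Bool
    labᶜ labᵖ sizeᶜ sizeᵖ res : ℕ

-- A round over unbounded numbers.  The aggregation operator is always addition; the
-- consensus operator is minimum or addition.
record Round : Set where
  field
    con   : EState → Bool
    x     : NState → ℕ
    isMin : Bool
    lY    : NState → ℕ → NState
    eL    : EState → ℕ → ℕ → EState
    z     : EState → ℕ → ℕ → ℕ × ℕ
    lA    : NState → ℕ → NState

open Round

idle : Round
idle = record { con = λ _ → false ; x = λ _ → 0 ; isMin = false ; lY = λ s _ → s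
              ; eL = λ s _ _ → s ; z = λ _ _ _ → 0 , 0 ; lA = λ s _ → s }

get : List Round → ℕ → Round
get []       _       = idle
get (ρ ∷ ρs) zero    = ρ
get (ρ ∷ ρs) (suc t) = get ρs t

-- Out-of-range values become 0.
clamp : ∀ B → ℕ → Fin (2 ^ B)
clamp B k with k ℕₚ.<? 2 ^ B
... | yes k< = fromℕ< k<
... | no _   = fromℕ< (ℕₚ.m^n>0 2 B)

toℕ-clamp : ∀ B {k} → k < 2 ^ B → toℕ (clamp B k) ≡ k
toℕ-clamp B {k} k< with k ℕₚ.<? 2 ^ B
... | yes k<′ = Finₚ.toℕ-fromℕ< k<′
... | no k≮   = ⊥-elim (k≮ k<)

consensus : Bool → ℕ → ℕ → ℕ
consensus true  = _⊓_
consensus false = _+_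

-- The second component of an edge state holds the values to be sent in the current round.
algorithm : ℕ → List Round → (EState → ℕ) → Algorithm
algorithm B ρs output = record
  { B = B ; R = length ρs
  ; NS = NState ; ES = EState × (ℕ × ℕ)
  ; initN = λ i → nst i 0 0 0 0
  ; initE = λ a b w p → est w (Maybe.map (_≡ᵇ a) p) false 0 0 0 0 0 , (0 , 0)
  ; contract = λ t s → con (get ρs t) (proj₁ s)
  ; xval = λ t s → clamp B (x (get ρs t) s)
  ; ⊕ = λ t a b → clamp B (consensus (isMin (get ρs t)) (toℕ a) (toℕ b))
  ; learnY = λ t s y → lY (get ρs t) s (toℕ y)
  ; edgeLearn = λ t s a b → eL (get ρs t) (proj₁ s) (toℕ a) (toℕ b) , z (get ρs t) (proj₁ s) (toℕ a) (toℕ b)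
  ; zval = λ t s → clamp B (proj₁ (proj₂ s)) , clamp B (proj₂ (proj₂ s))
  ; ⊗ = λ t a b → clamp B (toℕ a + toℕ b)
  ; learnAgg = λ t s a → lA (get ρs t) s (maybe′ toℕ 0 a)
  ; out = λ s → output (proj₁ s)
  }

-- Every partial sum is bounded by the full sum, so `clamp` never acts, whatever the order of
-- aggregation. Receiving nothing counts as 0, the empty sum.
agg-+ : ∀ {B L r} → Agg (λ a b → clamp B (toℕ a + toℕ b)) L r → sum (map toℕ L) < 2 ^ B →
        maybe′ toℕ 0 r ≡ sum (map toℕ L)
agg-+ none lt = refl
agg-+ (leaf x) lt = sym (ℕₚ.+-identityʳ _)
agg-+ {B} {L} (node {L₁ = L₁} {L₂} {a} {b} perm p q) lt = begin
  toℕ (clamp B (toℕ a + toℕ b))  ≡⟨ toℕ-clamp B (subst (_< 2 ^ B) (sym parts) lt) ⟩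
  toℕ a + toℕ b                  ≡⟨ parts ⟩
  sum (map toℕ L)                ∎
  where
  open ≡-Reasoning
  whole : sum (map toℕ L) ≡ sum (map toℕ L₁) + sum (map toℕ L₂)
  whole = trans (ListActionₚ.sum-↭ (Permₚ.map⁺ toℕ perm))
                (trans (cong sum (Listₚ.map-++ toℕ L₁ L₂)) (ListActionₚ.sum-++ (map toℕ L₁) _))
  parts : toℕ a + toℕ b ≡ sum (map toℕ L)
  parts = trans (cong₂ _+_ (agg-+ {B} p (ℕₚ.≤-<-trans (ℕₚ.≤-trans (ℕₚ.m≤m+n _ _) (ℕₚ.≤-reflexive (sym whole))) lt))
                           (agg-+ {B} q (ℕₚ.≤-<-trans (ℕₚ.≤-trans (ℕₚ.m≤n+m _ (sum (map toℕ L₁))) (ℕₚ.≤-reflexive (sym whole))) lt)))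
                (sym whole)

-- A minimum of two messages is one of them and therefore always in range, so `clamp` is harmless.
agg-⊓ : ∀ {B L r} → Agg (λ a b → clamp B (toℕ a ⊓ toℕ b)) L (just r) →
        (∃ λ k → k ∈ₗ L × toℕ r ≡ toℕ k) × (∀ k → k ∈ₗ L → toℕ r ≤ toℕ k)
agg-⊓ (leaf x) = (x , here refl , refl) , λ { k (here refl) → ℕₚ.≤-refl }
agg-⊓ {B} {L} (node {L₁ = L₁} {L₂} {a} {b} perm p q) with agg-⊓ {B} p | agg-⊓ {B} q
... | (k₁ , k₁∈ , e₁) , le₁ | (k₂ , k₂∈ , e₂) , le₂ = attained , lower
  where
  val : toℕ (clamp B (toℕ a ⊓ toℕ b)) ≡ toℕ a ⊓ toℕ b
  val = toℕ-clamp B (ℕₚ.≤-<-trans (ℕₚ.m⊓n≤m (toℕ a) (toℕ b)) (Finₚ.toℕ<n a))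
  attained : ∃ λ k → k ∈ₗ L × toℕ (clamp B (toℕ a ⊓ toℕ b)) ≡ toℕ k
  attained with ℕₚ.⊓-sel (toℕ a) (toℕ b)
  ... | inj₁ eq = k₁ , Permₚ.∈-resp-↭ (↭-sym perm) (Memₚ.∈-++⁺ˡ k₁∈) , trans val (trans eq e₁)
  ... | inj₂ eq = k₂ , Permₚ.∈-resp-↭ (↭-sym perm) (Memₚ.∈-++⁺ʳ L₁ k₂∈) , trans val (trans eq e₂)
  lower : ∀ k → k ∈ₗ L → toℕ (clamp B (toℕ a ⊓ toℕ b)) ≤ toℕ k
  lower k k∈ with Memₚ.∈-++⁻ L₁ (Permₚ.∈-resp-↭ perm k∈)
  ... | inj₁ i = ℕₚ.≤-trans (ℕₚ.≤-reflexive val) (ℕₚ.≤-trans (ℕₚ.m⊓n≤m (toℕ a) (toℕ b)) (le₁ k i))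
  ... | inj₂ i = ℕₚ.≤-trans (ℕₚ.≤-reflexive val) (ℕₚ.≤-trans (ℕₚ.m⊓n≤n (toℕ a) (toℕ b)) (le₂ k i))

map-cong-∈ : ∀ {A B : Set} {g h : A → B} (L : List A) → (∀ u → u ∈ₗ L → g u ≡ h u) → map g L ≡ map h L
map-cong-∈ []      eq = refl
map-cong-∈ (u ∷ L) eq = cong₂ _∷_ (eq u (here refl)) (map-cong-∈ L (λ v i → eq v (there i)))

module Semantics (B : ℕ) {n : ℕ} (G : Graph n) where
  open Graph G using (m)

  Conf : Set
  Conf = (Fin n → NState) × (Fin m → EState)

  -- The effect of a round in terms of natural numbers. Range conditions are premises of single
  -- fields, so that a stage has to prove only those it relies on. `same` is Boolean in order to act
  -- as an indicator in sums.
  record Sem (ρ : Round) (c c′ : Conf) : Set where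
    ns = proj₁ c
    st = proj₂ c
    field
      same          : Fin n → Fin n → Bool
      same-sound    : ∀ {u v} → same u v ≡ true → Reach G (λ f → con ρ (st f) ≡ true) u v
      same-complete : ∀ {u v} → Reach G (λ f → con ρ (st f) ≡ true) u v → same u v ≡ true
      y a           : Fin n → ℕ
    merged : Fin m → Bool
    merged f = same (src G f) (dst G f)
    total : Fin n → ℕ
    total v = sumFin n (λ u → same v u ▹ x ρ (ns u))
    sent : Fin m → ℕ × ℕ
    sent f = z ρ (st f) (y (src G f)) (y (dst G f))
    -- For an unmerged edge at most one of the two summands survives, as its ends belong to
    -- different supernodes.
    received : Fin n → ℕ
    received v = sumFin m (λ f → not (merged f) ▹
                   ((same v (src G f) ▹ proj₁ (sent f)) + (same v (dst G f) ▹ proj₂ (sent f))))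
    field
      y-sum   : isMin ρ ≡ false → ∀ v → total v < 2 ^ B → y v ≡ total v
      y-min   : isMin ρ ≡ true → (∀ u → x ρ (ns u) < 2 ^ B) → ∀ v →
                (∃ λ u → same v u ≡ true × y v ≡ x ρ (ns u)) × (∀ u → same v u ≡ true → y v ≤ x ρ (ns u))
      agg     : ∀ v → received v < 2 ^ B → a v ≡ received v
      st-new  : ∀ f → proj₂ c′ f ≡ (if merged f then st f else eL ρ (st f) (y (src G f)) (y (dst G f)))
      ns-new  : ∀ v → proj₁ c′ v ≡ lA ρ (lY ρ (ns v) (y v)) (a v)

  module _ (ρs : List Round) (output : EState → ℕ) where
    open Execution (algorithm B ρs output) G using (Config; Run; Step)

    strip : Config → Conf
    strip c = proj₁ c , proj₁ ∘ proj₂ c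

    step⇒sem : ∀ {t c c′} → Step t c c′ → Sem (get ρs t) (strip c) (strip c′)
    step⇒sem {t} {c} {c′} S = record
      { same = same ; same-sound = sound ; same-complete = complete
      ; y = yᴺ ; a = aᴺ ; y-sum = y-sum′ ; y-min = y-min′ ; agg = agg′ ; st-new = st-new′
      ; ns-new = λ v → cong (λ g → g v) (Step.nsEq S) }
      where
      open Step S using (Same; ns; es; yOK; esOK; aggOK)
      ρ = get ρs t
      yᴺ aᴺ : Fin n → ℕ
      yᴺ v = toℕ (Step.y S v)
      aᴺ v = maybe′ toℕ 0 (Step.agg S v)
      class : Fin n → List (Fin n)
      class v = proj₁ (yOK v)
      class-iff : ∀ v u → (u ∈ₗ class v) ⇔ Same v u
      class-iff v = proj₂ (proj₁ (proj₂ (yOK v)))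
      -- The enumeration of each supernode supplied by `yOK` makes connectivity decidable.
      same : Fin n → Fin n → Bool
      same v u = does (elem? (class v) u)
      complete : ∀ {u v} → Same u v → same u v ≡ true
      complete {u} {v} p = dec-true (elem? (class u) v) (Equivalence.from (class-iff u v) p)
      sound : ∀ {u v} → same u v ≡ true → Same u v
      sound {u} {v} eq with elem? (class u) v
      ... | yes i = Equivalence.to (class-iff u v) i
      notSame : ∀ {u v} → ¬ Same u v → same u v ≡ false
      notSame ¬p = Boolₚ.¬-not (λ eq → ¬p (sound eq))

      xᴺ : Fin n → ℕ
      xᴺ u = x ρ (ns u)
      y-sum′ : isMin ρ ≡ false → ∀ v → sumFin n (λ u → same v u ▹ xᴺ u) < 2 ^ B →
               yᴺ v ≡ sumFin n (λ u → same v u ▹ xᴺ u)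
      y-sum′ isSum v lt = trans (agg-+ {B} (op-+ (proj₂ (proj₂ (yOK v)))) (subst (_< 2 ^ B) (sym value) lt)) value
        where
        op-+ : ∀ {L r} → Agg (λ a b → clamp B (consensus (isMin ρ) (toℕ a) (toℕ b))) L r →
               Agg (λ a b → clamp B (toℕ a + toℕ b)) L r
        op-+ rewrite isSum = λ p → p
        small : ∀ u → u ∈ₗ class v → xᴺ u < 2 ^ B
        small u i = ℕₚ.≤-<-trans (ℕₚ.≤-trans (ℕₚ.≤-reflexive (cong (_▹ xᴺ u) (sym (dec-true (elem? (class v) u) i))))
                                 (term≤sum (λ u → same v u ▹ xᴺ u) u)) lt
        value : sum (map toℕ (map (λ u → clamp B (xᴺ u)) (class v))) ≡ sumFin n (λ u → same v u ▹ xᴺ u)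
        value = trans (cong sum (trans (sym (Listₚ.map-∘ (class v)))
                  (map-cong-∈ (class v) (λ u i → toℕ-clamp B (small u i)))))
                  (sum-list xᴺ (class v) (proj₁ (proj₁ (proj₂ (yOK v)))))

      y-min′ : isMin ρ ≡ true → (∀ u → xᴺ u < 2 ^ B) → ∀ v →
               (∃ λ u → same v u ≡ true × yᴺ v ≡ xᴺ u) × (∀ u → same v u ≡ true → yᴺ v ≤ xᴺ u)
      y-min′ isMin′ small v with agg-⊓ {B} (op-⊓ (proj₂ (proj₂ (yOK v))))
        where
        op-⊓ : ∀ {L r} → Agg (λ a b → clamp B (consensus (isMin ρ) (toℕ a) (toℕ b))) L r →
               Agg (λ a b → clamp B (toℕ a ⊓ toℕ b)) L r
        op-⊓ rewrite isMin′ = λ p → p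
      ... | (k , k∈ , eq) , le with Memₚ.∈-map⁻ (λ u → clamp B (xᴺ u)) k∈
      ...   | u , u∈ , refl = (u , dec-true (elem? (class v) u) u∈ , trans eq (toℕ-clamp B (small u))) ,
                λ w sw → ℕₚ.≤-trans (le _ (Memₚ.∈-map⁺ (λ u → clamp B (xᴺ u)) (Equivalence.from (class-iff v w) (sound sw))))
                                    (ℕₚ.≤-reflexive (toℕ-clamp B (small w)))

      merged : Fin m → Bool
      merged f = same (src G f) (dst G f)

      -- The messages are computed from the state before the update by `eL`.
      learnt : Fin m → EState × (ℕ × ℕ)
      learnt f = eL ρ (proj₁ (es f)) (yᴺ (src G f)) (yᴺ (dst G f)) , z ρ (proj₁ (es f)) (yᴺ (src G f)) (yᴺ (dst G f))

      es-minor : ∀ f → merged f ≡ false → Step.es' S f ≡ learnt f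
      es-minor f eq with esOK f
      ... | inj₁ (_ , q) = q
      ... | inj₂ (¬m , _) = ⊥-elim (¬m λ p → case trans (sym eq) (complete p) of λ ())

      es-merged : ∀ f → merged f ≡ true → Step.es' S f ≡ es f
      es-merged f eq with esOK f
      ... | inj₁ (m′ , _) = ⊥-elim (m′ (sound eq))
      ... | inj₂ (_ , q) = q

      st-new′ : ∀ f → proj₁ (proj₂ c′ f) ≡ (if merged f then proj₁ (es f) else proj₁ (learnt f))
      st-new′ f = trans (cong (λ g → proj₁ (g f)) (Step.esEq S)) (go (merged f) refl)
        where
        go : ∀ b → merged f ≡ b → proj₁ (Step.es' S f) ≡ (if b then proj₁ (es f) else proj₁ (learnt f))
        go true  eq = cong proj₁ (es-merged f eq)
        go false eq = cong proj₁ (es-minor f eq)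

      sent : Fin m → ℕ × ℕ
      sent f = proj₂ (learnt f)

      agg′ : ∀ v → sumFin m (λ f → not (merged f) ▹
                     ((same v (src G f) ▹ proj₁ (sent f)) + (same v (dst G f) ▹ proj₂ (sent f)))) < 2 ^ B →
             aᴺ v ≡ sumFin m (λ f → not (merged f) ▹
                     ((same v (src G f) ▹ proj₁ (sent f)) + (same v (dst G f) ▹ proj₂ (sent f))))
      agg′ v lt with aggOK v
      ... | L , (uniq , iff) , Ms , pw , ag = trans (agg-+ {B} ag (subst (_< 2 ^ B) (sym value) lt)) value
        where
        zz : Fin m → ℕ
        zz f = (same v (src G f) ▹ proj₁ (sent f)) + (same v (dst G f) ▹ proj₂ (sent f))

        notMerged : ∀ {f} → f ∈ₗ L → merged f ≡ false
        notMerged {f} i = notSame (proj₁ (Equivalence.to (iff f) i))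

        small : ∀ {f} → f ∈ₗ L → zz f < 2 ^ B
        small {f} i = ℕₚ.≤-<-trans (ℕₚ.≤-trans (ℕₚ.≤-reflexive (cong (λ b → not b ▹ zz f) (sym (notMerged i))))
                                              (term≤sum (λ f → not (merged f) ▹ zz f) f)) lt

        message : ∀ {f k} → f ∈ₗ L →
          ((Same v (src G f) × k ≡ clamp B (proj₁ (proj₂ (Step.es' S f)))) ⊎
           (Same v (dst G f) × k ≡ clamp B (proj₂ (proj₂ (Step.es' S f))))) → toℕ k ≡ zz f
        message {f} i (inj₁ (p , refl)) rewrite es-minor f (notMerged i) =
          trans (toℕ-clamp B (subst (_< 2 ^ B) eq (small i))) (sym eq)
          where
          eq : zz f ≡ proj₁ (sent f)
          eq rewrite complete p | notSame {v} {dst G f} (λ q → proj₁ (Equivalence.to (iff f) i) (reach-trans (reach-sym p) q))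
            = ℕₚ.+-identityʳ _
        message {f} i (inj₂ (p , refl)) rewrite es-minor f (notMerged i) =
          trans (toℕ-clamp B (subst (_< 2 ^ B) eq (small i))) (sym eq)
          where
          eq : zz f ≡ proj₂ (sent f)
          eq rewrite complete p | notSame {v} {src G f} (λ q → proj₁ (Equivalence.to (iff f) i) (reach-trans (reach-sym q) p))
            = refl

        messages : ∀ {L′ Ms} → (∀ {f} → f ∈ₗ L′ → f ∈ₗ L) →
          Pointwise (λ f k → (Same v (src G f) × k ≡ clamp B (proj₁ (proj₂ (Step.es' S f)))) ⊎
                             (Same v (dst G f) × k ≡ clamp B (proj₂ (proj₂ (Step.es' S f))))) L′ Ms →
          sum (map toℕ Ms) ≡ sum (map zz L′)
        messages inc []       = refl
        messages inc (k ∷ ks) = cong₂ _+_ (message (inc (here refl)) k) (messages (inc ∘ there) ks)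

        -- An unmerged edge missing from `L` has no end in the supernode of `v`, so its term
        -- vanishes.
        present : ∀ f → does (elem? L f) ▹ zz f ≡ not (merged f) ▹ zz f
        present f with elem? L f
        ... | yes i = cong (λ b → not b ▹ zz f) (sym (notMerged i))
        ... | no f∉ with merged f in mf
        ...   | true  = refl
        ...   | false with same v (src G f) in s | same v (dst G f) in d
        ...     | false | false = refl
        ...     | true  | _     = ⊥-elim (f∉ (Equivalence.from (iff f)
                    ((λ p → case trans (sym mf) (complete p) of λ ()) , inj₁ (sound s))))
        ...     | false | true  = ⊥-elim (f∉ (Equivalence.from (iff f)
                    ((λ p → case trans (sym mf) (complete p) of λ ()) , inj₂ (sound d))))

        value : sum (map toℕ Ms) ≡ sumFin m (λ f → not (merged f) ▹ zz f)
        value = trans (messages (λ i → i) pw) (trans (sum-list zz L uniq) (sum-cong present))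

  Exec : List Round → Conf → Conf → Set
  Exec []       c c′ = c ≡ c′
  Exec (ρ ∷ ρs) c c′ = ∃ λ d → Sem ρ c d × Exec ρs d c′

  -- `Run` grows at its last round whereas `Exec` is read from its first.
  exec-snoc : ∀ (g : ℕ → Round) t {c d e} → Exec (applyUpTo g t) c d → Sem (g t) d e → Exec (applyUpTo g (suc t)) c e
  exec-snoc g zero    refl         s = _ , s , refl
  exec-snoc g (suc t) (d , s₀ , p) s = d , s₀ , exec-snoc (g ∘ suc) t p s

  applyUpTo-get : ∀ ρs → applyUpTo (get ρs) (length ρs) ≡ ρs
  applyUpTo-get []       = refl
  applyUpTo-get (ρ ∷ ρs) = cong (ρ ∷_) (applyUpTo-get ρs)

  run⇒exec : ∀ ρs output {init c} → Execution.Run (algorithm B ρs output) G init (length ρs) c →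
             Exec ρs (strip ρs output init) (strip ρs output c)
  run⇒exec ρs output {init} {c} run = subst (λ us → Exec us _ _) (applyUpTo-get ρs) (go run)
    where
    go : ∀ {t c} → Execution.Run (algorithm B ρs output) G init t c →
         Exec (applyUpTo (get ρs) t) (strip ρs output init) (strip ρs output c)
    go Execution.start = refl
    go (Execution.next {t} run s) = exec-snoc (get ρs) t (go run) (step⇒sem ρs output s)

  Hoare : (Conf → Set) → List Round → (Conf → Set) → Set
  Hoare P ρs Q = ∀ {c c′} → P c → Exec ρs c c′ → Q c′

  exec-++ : ∀ ρs {σs c e} → Exec (ρs ++ σs) c e → ∃ λ d → Exec ρs c d × Exec σs d e
  exec-++ []       p           = _ , refl , p
  exec-++ (ρ ∷ ρs) (d , s , p) with exec-++ ρs p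
  ... | e , q , r = e , (d , s , q) , r

-- Labels increasing towards the root

open NState
open EState

-- `e` exceeds all labels built so far, so `dig y` becomes a new leading digit. With `id` an edge is
-- flagged when the minimum grows towards the root; the complement `D ∸ suc y` reverses the
-- comparison. Old flags are kept, so clusters only grow.
phase : (ℕ → ℕ) → ℕ → Round
phase dig e = record
  { con   = flag
  ; x     = nid
  ; isMin = true
  ; lY    = λ s y → record s { lab = dig y * e + lab s }
  ; eL    = λ s a b → record s { flag = flag s ∨ (isTree (kd s) ∧ (dig (childSide (kd s) a b) <ᵇ dig (parentSide (kd s) a b))) }
  ; z     = λ _ _ _ → 0 , 0
  ; lA    = λ s _ → s
  }

phases : ℕ → ℕ → List Round
phases D zero    = []
phases D (suc k) = phases D k ++ phase id ((D * D) ^ k) ∷ phase (λ y → D ∸ suc y) (D * (D * D) ^ k) ∷ []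

*+-< : ∀ {d D l e} → d < D → l < e → d * e + l < D * e
*+-< {d} {D} {l} {e} d<D l<e = begin-strict
  d * e + l  <⟨ ℕₚ.+-monoʳ-< (d * e) l<e ⟩
  d * e + e  ≡⟨ ℕₚ.+-comm (d * e) e ⟩
  suc d * e  ≤⟨ ℕₚ.*-monoˡ-≤ e d<D ⟩
  D * e      ∎
  where open ℕₚ.≤-Reasoning

childSide-map : ∀ {A C : Set} (g : A → C) k a b → childSide k (g a) (g b) ≡ g (childSide k a b)
childSide-map g (just true)  a b = refl
childSide-map g (just false) a b = refl
childSide-map g nothing      a b = refl

parentSide-map : ∀ {A C : Set} (g : A → C) k a b → parentSide k (g a) (g b) ≡ g (parentSide k a b)
parentSide-map g (just true)  a b = refl
parentSide-map g (just false) a b = refl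
parentSide-map g nothing      a b = refl

module Labelling (B : ℕ) {n : ℕ} (G : Graph n) (O : OrientedTree G)
  (w : Fin (Graph.m G) → ℕ) (ident : Fin n → ℕ) (ident-injective : Injective _≡_ _≡_ ident)
  (D : ℕ) (ident<D : ∀ v → ident v < D) (D≤ : D ≤ 2 ^ B) where

  open Graph G using (m)
  open Semantics B G
  open Tree O

  Conn : (Fin m → Bool) → Fin n → Fin n → Set
  Conn F = Reach G (λ f → F f ≡ true)

  IsMin : (Fin m → Bool) → (Fin n → ℕ) → Set
  IsMin F y = ∀ v → (∃ λ u → Conn F v u × y v ≡ ident u) × (∀ u → Conn F v u → y v ≤ ident u)

  isMin-conn : ∀ {F y} → IsMin F y → ∀ {u v} → Conn F u v → y u ≡ y v
  isMin-conn mn {u} {v} p with mn u | mn v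
  ... | (a , pa , ea) , la | (b , pb , eb) , lb = ℕₚ.≤-antisym
    (ℕₚ.≤-trans (la b (reach-trans p pb)) (ℕₚ.≤-reflexive (sym eb)))
    (ℕₚ.≤-trans (lb a (reach-trans (reach-sym p) pa)) (ℕₚ.≤-reflexive (sym ea)))

  -- Identifiers are unique, so equal minima are attained at the same vertex, which belongs to both
  -- components.
  isMin-same : ∀ {F y} → IsMin F y → ∀ {u v} → y u ≡ y v → Conn F u v
  isMin-same {F} mn {u} {v} eq with mn u | mn v
  ... | (a , pa , ea) , _ | (b , pb , eb) , _ =
    reach-trans pa (subst (λ t → Conn F t v) (sym (ident-injective (trans (sym ea) (trans eq eb)))) (reach-sym pb))

  isMin<D : ∀ {F y} → IsMin F y → ∀ v → y v < D
  isMin<D mn v with mn v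
  ... | (a , _ , ea) , _ = subst (_< D) (sym ea) (ident<D a)

  sem-min : ∀ {ρ c c′} → (S : Sem ρ c c′) → isMin ρ ≡ true → (∀ v → Round.x ρ (proj₁ c v) ≡ ident v) →
            (F : Fin m → Bool) → (∀ f → con ρ (proj₂ c f) ≡ F f) → IsMin F (Sem.y S)
  sem-min {ρ} {c} S im xs F cons v with Sem.y-min S im (λ u → subst (_< 2 ^ B) (sym (xs u)) (ℕₚ.<-≤-trans (ident<D u) D≤)) v
  ... | (u , su , eq) , le =
    (u , reach-map (λ f p → trans (sym (cons f)) p) (Sem.same-sound S su) , trans eq (xs u)) ,
    λ t p → ℕₚ.≤-trans (le t (Sem.same-complete S (reach-map (λ f q → trans (cons f) q) p))) (ℕₚ.≤-reflexive (xs t))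

  -- Invariant of the phases: `F` is the set of edges that the next phase contracts, and along it
  -- labels already increase. When `F` is the whole tree, labels increase towards the root
  -- everywhere.
  record Labelled (e : ℕ) (F : Fin m → Bool) (c : Conf) : Set where
    field
      label    : Fin n → ℕ
      nodes    : ∀ v → proj₁ c v ≡ nst (ident v) (label v) 0 0 0
      edges    : ∀ f → proj₂ c f ≡ est (w f) (kind f) (F f) 0 0 0 0 0
      F⊆tree   : F ⊆ᵇ tree
      label<   : ∀ v → label v < e
      monotone : ∀ {f} → F f ≡ true → label (ch f) < label (pa f)

  extend : (ℕ → ℕ) → (Fin m → Bool) → (Fin n → ℕ) → Fin m → Bool
  extend dig F y f = F f ∨ (tree f ∧ (dig (y (ch f)) <ᵇ dig (y (pa f))))

  -- Along an old edge of `F` both ends receive the same digit and the old order persists; along a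
  -- newly flagged edge the new leading digit decides.
  phase-step : ∀ {dig e F c c′} → (∀ {k} → k < D → dig k < D) → Labelled e F c → Sem (phase dig e) c c′ →
               ∃ λ y → IsMin F y × Labelled (D * e) (extend dig F y) c′
  phase-step {dig} {e} {F} {c} {c′} dig<D Λ S = y , min , record
    { label = label′
    ; nodes = λ v → trans (ns-new v) (cong (λ s → record s { lab = dig (y v) * e + lab s }) (nodes v))
    ; edges = edges′
    ; F⊆tree = λ {f} p → ext⊆ f p
    ; label< = λ v → *+-< (dig<D (isMin<D min v)) (label< v)
    ; monotone = mono
    }
    where
    open Labelled Λ
    open Sem S
    F-con : ∀ f → flag (proj₂ c f) ≡ F f
    F-con f = cong flag (edges f)
    min : IsMin F y
    min = sem-min S refl (λ v → cong nid (nodes v)) F F-con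
    label′ : Fin n → ℕ
    label′ v = dig (y v) * e + label v
    F′ = extend dig F y
    -- A merged edge does not update its state. This agrees with `extend`, since both ends share the
    -- minimum and the strict comparison fails.
    merged⇒ : ∀ f → merged f ≡ true → F′ f ≡ F f
    merged⇒ f eq = trans (cong (λ b → F f ∨ (tree f ∧ b)) (≤⇒<ᵇ≡false (ℕₚ.≤-reflexive (cong dig (sym equal)))))
                         (trans (cong (F f ∨_) (Boolₚ.∧-zeroʳ (tree f))) (Boolₚ.∨-identityʳ (F f)))
      where
      ends-equal : y (src G f) ≡ y (dst G f)
      ends-equal = isMin-conn min (reach-map (λ g p → trans (sym (F-con g)) p) (same-sound eq))
      equal : y (ch f) ≡ y (pa f)
      equal with kind f
      ... | just true  = sym ends-equal
      ... | just false = ends-equal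
      ... | nothing    = ends-equal
    edges′ : ∀ f → proj₂ c′ f ≡ est (w f) (kind f) (F′ f) 0 0 0 0 0
    edges′ f = trans (st-new f) (go (merged f) refl)
      where
      go : ∀ b → merged f ≡ b → (if b then proj₂ c f else eL (phase dig e) (proj₂ c f) (y (src G f)) (y (dst G f)))
                                ≡ est (w f) (kind f) (F′ f) 0 0 0 0 0
      go true eq rewrite merged⇒ f eq = edges f
      go false eq rewrite edges f | childSide-map y (kind f) (src G f) (dst G f)
                                  | parentSide-map y (kind f) (src G f) (dst G f) = refl
    ext⊆ : ∀ f → F′ f ≡ true → tree f ≡ true
    ext⊆ f p with F f in q | tree f in t
    ... | true  | _     = trans (sym t) (F⊆tree q)
    ... | false | true  = refl
    ... | false | false = p
    mono : ∀ {f} → F′ f ≡ true → label′ (ch f) < label′ (pa f)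
    mono {f} p with F f in q | tree f
    ... | true  | _ = subst (λ k → label′ (ch f) < dig k * e + label (pa f))
                            (isMin-conn min (step f q (tree-joins f) here)) (ℕₚ.+-monoʳ-< (dig (y (ch f)) * e) (monotone q))
    ... | false | true = ℕₚ.<-≤-trans (*+-< {dig (y (ch f))} {dig (y (pa f))} (<ᵇ≡true⇒< p) (label< (ch f))) (ℕₚ.m≤m+n _ _)
    ... | false | false = case p of λ ()

  count : (Fin m → Bool) → Fin n → ℕ
  count F c = sumFin n (λ u → sub F c u ▹ 1)

  count≤n : ∀ F c → count F c ≤ n
  count≤n F c = ℕₚ.≤-trans (sum-bound (λ u → ▹-≤ (sub F c u))) (ℕₚ.≤-reflexive (ℕₚ.*-identityʳ n))

  -- The progress measure: a cluster with a parent edge still to be contracted has at least `2 ^ j`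
  -- vertices.
  Big : ℕ → (Fin m → Bool) → Set
  Big j F = ∀ {f} → tree f ≡ true → F f ≡ false → 2 ^ j ≤ count F (ch f)

  big-zero : ∀ F → Big 0 F
  big-zero F {f} _ _ = ℕₚ.≤-trans (ℕₚ.≤-reflexive (cong (_▹ 1) (sym (sub-complete {F} {ch f} here))))
                                  (term≤sum (λ u → sub F (ch f) u ▹ 1) (ch f))

  topOf : ∀ {F f} → tree f ≡ true → F f ≡ false → Top F (ch f)
  topOf {F} t q eq = subst (λ g → F g ≡ false) (Maybeₚ.just-injective (trans (sym (ch-pe t)) eq)) q

  ∨-false : ∀ {a b} → a ∨ b ≡ false → a ≡ false × b ≡ false
  ∨-false {false} {false} _ = refl , refl

  -- The only edge leading up out of the `F`-cluster of `ch f` is `f`, which is not in `F₁`. So a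
  -- walk in `F₁` must leave the cluster downwards, through an edge `g` to the top of another
  -- cluster.
  exit : ∀ {F F₁ f} → F ⊆ᵇ tree → F₁ ⊆ᵇ tree → tree f ≡ true → F f ≡ false → F₁ f ≡ false →
         ∀ {v u} → Conn F₁ v u → Below F (ch f) v → ¬ Below F (ch f) u →
         ∃ λ g → F₁ g ≡ true × F g ≡ false × Below F (ch f) (pa g) × ¬ Below F (ch f) (ch g)
  exit F⊆ F₁⊆ t q q₁ here b ¬b = ⊥-elim (¬b b)
  exit {F} {F₁} {f} F⊆ F₁⊆ t q q₁ (step {w = v′} g pg j p) b ¬b with below? F (ch f) v′
  ... | yes b′ = exit F⊆ F₁⊆ t q q₁ p b′ ¬b
  ... | no ¬b′ = g , pg , Fg , leave (joins-tree j) b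
    where
    Fg : F g ≡ false
    Fg = Boolₚ.¬-not λ eq → ¬b′ (reach-below F⊆ (topOf t q) b (step g eq j here))
    leave : ∀ {v} → (v ≡ ch g × v′ ≡ pa g) ⊎ (v ≡ pa g × v′ ≡ ch g) → Below F (ch f) v →
            Below F (ch f) (pa g) × ¬ Below F (ch f) (ch g)
    leave (inj₂ (refl , refl)) bv = bv , ¬b′
    leave (inj₁ (refl , refl)) bv = case trans (sym q₁) (subst (λ h → F₁ h ≡ true) same-edge pg) of λ ()
      where
      same-edge : g ≡ f
      same-edge = Maybeₚ.just-injective (trans (sym (ch-pe (F₁⊆ pg)))
                    (trans (cong pe (below-top bv (topOf (F₁⊆ pg) Fg))) (ch-pe t)))

  -- Let the tree edge f with child end c survive both phases.  Surviving the first phase gives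
  -- y₀ (pa f) ≤ y₀ c, surviving the second y₁ c ≤ y₁ (pa f) ≤ y₀ (pa f).  If the cluster of c
  -- had absorbed nothing, y₁ c = y₀ c would force y₀ c = y₀ (pa f), impossible across f.
  -- Hence the cluster of c has absorbed another non-root cluster, and its size has doubled.
  big-double : ∀ {j F y₀ y₁} → F ⊆ᵇ tree → extend id F y₀ ⊆ᵇ tree → Big j F → IsMin F y₀ → IsMin (extend id F y₀) y₁ →
               Big (suc j) (extend (λ y → D ∸ suc y) (extend id F y₀) y₁)
  big-double {j} {F} {y₀} {y₁} F⊆ F₁⊆ big min₀ min₁ {f} t q₂ = begin
    2 * 2 ^ j                                      ≡⟨ cong (2 ^ j +_) (ℕₚ.+-identityʳ (2 ^ j)) ⟩
    2 ^ j + 2 ^ j                                  ≤⟨ ℕₚ.+-mono-≤ (big t q₀) (big (F₁⊆ F₁g) Fg) ⟩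
    count F (ch f) + count F (ch g)                ≡⟨ sym (sum-+ (λ u → sub F (ch f) u ▹ 1) _) ⟩
    sumFin n (λ u → (sub F (ch f) u ▹ 1) + (sub F (ch g) u ▹ 1))  ≤⟨ sum-mono both ⟩
    count F₂ (ch f)                                ∎
    where
    open ℕₚ.≤-Reasoning
    F₁ = extend id F y₀
    F₂ = extend (λ y → D ∸ suc y) F₁ y₁
    q₁ : F₁ f ≡ false
    q₁ = proj₁ (∨-false q₂)
    q₀ : F f ≡ false
    q₀ = proj₁ (∨-false q₁)
    F⊆F₁ : F ⊆ᵇ F₁
    F⊆F₁ p rewrite p = refl
    F₁⊆F₂ : F₁ ⊆ᵇ F₂
    F₁⊆F₂ p rewrite p = refl
    order₀ : y₀ (pa f) ≤ y₀ (ch f)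
    order₀ with proj₂ (∨-false {F f} q₁)
    ... | eq rewrite t = <ᵇ≡false⇒≥ eq
    order₁ : y₁ (ch f) ≤ y₁ (pa f)
    order₁ with proj₂ (∨-false {F₁ f} q₂)
    ... | eq rewrite t = ℕₚ.≮⇒≥ λ lt → ℕₚ.<⇒≱ (ℕₚ.∸-monoʳ-< (s≤s lt) (isMin<D min₁ (ch f))) (<ᵇ≡false⇒≥ eq)
    shrink : ∀ v → y₁ v ≤ y₀ v
    shrink v with min₀ v
    ... | (a , pa , ea) , _ = ℕₚ.≤-trans (proj₂ (min₁ v) a (reach-map (λ h p → F⊆F₁ p) pa)) (ℕₚ.≤-reflexive (sym ea))
    low : ∃ λ u → Conn F₁ (ch f) u × y₁ (ch f) ≡ ident u
    low = proj₁ (min₁ (ch f))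
    u₀ = proj₁ low
    -- Were `u₀` in the old cluster, its identifier would bound `y₀ (ch f)` from above, and the
    -- inequalities would close up to `y₀ (ch f) ≡ y₀ (pa f)`, putting `pa f` below `ch f`.
    outside : ¬ Below F (ch f) u₀
    outside b = ℕₚ.<⇒≱ (pa-dep t) (below-dep (reach-below F⊆ (topOf t q₀) here (isMin-same min₀
      (ℕₚ.≤-antisym
        (ℕₚ.≤-trans (proj₂ (min₀ (ch f)) u₀ (reach-sym (below-reach F⊆ b)))
          (ℕₚ.≤-trans (ℕₚ.≤-reflexive (sym (proj₂ (proj₂ low)))) (ℕₚ.≤-trans order₁ (shrink (pa f)))))
        order₀))))
    found : ∃ λ g → F₁ g ≡ true × F g ≡ false × Below F (ch f) (pa g) × ¬ Below F (ch f) (ch g)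
    found = exit F⊆ F₁⊆ t q₀ q₁ (proj₁ (proj₂ low)) here outside
    g = proj₁ found
    F₁g = proj₁ (proj₂ found)
    Fg = proj₁ (proj₂ (proj₂ found))
    pg = proj₁ (proj₂ (proj₂ (proj₂ found)))
    ¬cg = proj₂ (proj₂ (proj₂ (proj₂ found)))
    F⊆F₂ : F ⊆ᵇ F₂
    F⊆F₂ {h} p = F₁⊆F₂ {h} (F⊆F₁ {h} p)
    -- The old clusters of `ch f` and `ch g` are disjoint, and both lie in the new cluster of
    -- `ch f`, the second one by way of `g`.
    both : ∀ u → (sub F (ch f) u ▹ 1) + (sub F (ch g) u ▹ 1) ≤ sub F₂ (ch f) u ▹ 1
    both u with below? F (ch f) u | below? F (ch g) u
    ... | no _   | no _  = z≤n
    ... | yes b  | no _  = ℕₚ.≤-reflexive (cong (_▹ 1) (sym (sub-complete (below-weaken (λ {h} → F⊆F₂ {h}) b))))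
    ... | no _   | yes d = ℕₚ.≤-reflexive (cong (_▹ 1) (sym (sub-complete
          (below-trans (up (ch-pe (F₁⊆ F₁g)) (F₁⊆F₂ {g} F₁g) (below-weaken (λ {h} → F⊆F₂ {h}) pg)) (below-weaken (λ {h} → F⊆F₂ {h}) d)))))
    ... | yes b  | yes d with below-compare b d
    ...   | inj₁ cd = ⊥-elim (¬cg cd)
    ...   | inj₂ dc = ⊥-elim (¬cg (subst (Below F (ch f)) (below-top dc (topOf t q₀)) here))

  Phased : ℕ → Conf → Set
  Phased k c = ∃ λ F → Big k F × Labelled ((D * D) ^ k) F c

  phases-correct : ∀ k {P : Conf → Set} → (∀ {c} → P c → Phased 0 c) → Hoare P (phases D k) (Phased k)
  phases-correct zero    init p refl = init p
  phases-correct (suc k) init p e with exec-++ (phases D k) e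
  ... | _ , e₁ , e₂ = double (phases-correct k init p e₁) e₂
    where
    dig<D : ∀ {y} → y < D → D ∸ suc y < D
    dig<D {y} y<D = ℕₚ.∸-monoʳ-< {D} {suc y} {0} z<s y<D
    double : Hoare (Phased k) (phase id ((D * D) ^ k) ∷ phase (λ y → D ∸ suc y) (D * (D * D) ^ k) ∷ []) (Phased (suc k))
    double (F , big , Λ) (_ , S₁ , c₂ , S₂ , refl) with phase-step (λ p → p) Λ S₁
    ... | y₀ , min₀ , Λ₁ with phase-step dig<D Λ₁ S₂
    ...   | y₁ , min₁ , Λ₂ = _ , big-double {k} (Labelled.F⊆tree Λ) (Labelled.F⊆tree Λ₁) big min₀ min₁ ,
              subst (λ e → Labelled e (extend (λ y → D ∸ suc y) (extend id F y₀) y₁) c₂) (sym (ℕₚ.*-assoc D D ((D * D) ^ k))) Λ₂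

  -- A remaining edge would have a cluster of more than `n` vertices below it.
  all-flagged : ∀ {k F} → n < 2 ^ k → Big k F → ∀ {f} → tree f ≡ true → F f ≡ true
  all-flagged {k} {F} n<2^k big {f} t with F f in q
  ... | true  = refl
  ... | false = ⊥-elim (ℕₚ.<⇒≱ n<2^k (ℕₚ.≤-trans (big t q) (count≤n F (ch f))))

-- Subtree sums

-- With nothing contracted every vertex is its own supernode, so consensus merely passes its value
-- to the incident edges.
share : (NState → ℕ) → (NState → NState) → (EState → ℕ → ℕ → EState) → Round
share xv set learn = record
  { con = λ _ → false ; x = xv ; isMin = false ; lY = λ s _ → set s ; eL = learn ; z = λ _ _ _ → 0 , 0 ; lA = λ s _ → s }

≡ᵇ-true : ∀ {a b} → a ≡ b → (a ≡ᵇ b) ≡ true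
≡ᵇ-true {a} {b} eq = dec-true (a ℕₚ.≟ b) eq

≡ᵇ-false : ∀ {a b} → a ≢ b → (a ≡ᵇ b) ≡ false
≡ᵇ-false {a} {b} ne = dec-false (a ℕₚ.≟ b) ne

≡ᵇ-sound : ∀ a b → (a ≡ᵇ b) ≡ true → a ≡ b
≡ᵇ-sound a b eq = ℕₚ.≡ᵇ⇒≡ a b (Equivalence.from Boolₚ.T-≡ eq)

≡ᵇ-unsound : ∀ {a b} → (a ≡ᵇ b) ≡ false → a ≢ b
≡ᵇ-unsound ne eq = case trans (sym ne) (≡ᵇ-true eq) of λ ()

∧-true : ∀ a {b} → a ∧ b ≡ true → a ≡ true × b ≡ true
∧-true true {true} _ = refl , refl

bool-iff : ∀ {a b} → (a ≡ true → b ≡ true) → (b ≡ true → a ≡ true) → a ≡ b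
bool-iff {true}  {b}     f g = sym (f refl)
bool-iff {false} {true}  f g = g refl
bool-iff {false} {false} f g = refl

not-true : ∀ {b} → not b ≡ true → b ≡ false
not-true {false} _ = refl

-- pre b k = ⌊ k / 2 ^ b ⌋
pre : ℕ → ℕ → ℕ
pre zero    k = k
pre (suc b) k = ⌊ pre b k /2⌋

pre-mono : ∀ b {k l} → k ≤ l → pre b k ≤ pre b l
pre-mono zero    le = le
pre-mono (suc b) le = ℕₚ.⌊n/2⌋-mono (pre-mono b le)

half-cases : ∀ k → k ≡ ⌊ k /2⌋ + ⌊ k /2⌋ ⊎ k ≡ suc (⌊ k /2⌋ + ⌊ k /2⌋)
half-cases zero          = inj₁ refl
half-cases (suc zero)    = inj₂ refl
half-cases (suc (suc k)) with half-cases k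
... | inj₁ eq = inj₁ (cong suc (trans (cong suc eq) (sym (ℕₚ.+-suc ⌊ k /2⌋ ⌊ k /2⌋))))
... | inj₂ eq = inj₂ (cong suc (cong suc (trans eq (sym (ℕₚ.+-suc ⌊ k /2⌋ ⌊ k /2⌋)))))

half-< : ∀ {k l} → k < l + l → ⌊ k /2⌋ < l
half-< {k} {l} k< = ℕₚ.≰⇒> λ l≤ → ℕₚ.<⇒≱ k< (ℕₚ.≤-trans (ℕₚ.+-mono-≤ l≤ l≤) (double≤ k))
  where
  double≤ : ∀ k → ⌊ k /2⌋ + ⌊ k /2⌋ ≤ k
  double≤ k with half-cases k
  ... | inj₁ eq = ℕₚ.≤-reflexive (sym eq)
  ... | inj₂ eq = ℕₚ.≤-trans (ℕₚ.n≤1+n _) (ℕₚ.≤-reflexive (sym eq))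

pre-< : ∀ b {k c} → k < 2 ^ (b + c) → pre b k < 2 ^ c
pre-< zero    k< = k<
pre-< (suc b) {k} {c} k< = half-< (subst (pre b k <_) (cong (2 ^ c +_) (ℕₚ.+-identityʳ (2 ^ c)))
                             (pre-< b {k} {suc c} (subst (λ e → k < 2 ^ e) (sym (ℕₚ.+-suc b c)) k<)))

pre-zero : ∀ b {k} → k < 2 ^ b → pre b k ≡ 0
pre-zero b {k} k< = ℕₚ.n<1⇒n≡0 (pre-< b {k} {0} (subst (λ e → k < 2 ^ e) (sym (ℕₚ.+-identityʳ b)) k<))

isEven : ℕ → Bool
isEven k = k ≡ᵇ ⌊ k /2⌋ + ⌊ k /2⌋

even-below : ∀ {k l} → k ≤ l → isEven l ≡ true → ⌊ k /2⌋ ≡ ⌊ l /2⌋ → k ≡ l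
even-below {k} {l} k≤l ev eq with half-cases k
... | inj₁ q = trans q (trans (cong (λ h → h + h) eq) (sym (≡ᵇ-sound l _ ev)))
... | inj₂ q = ⊥-elim (ℕₚ.<⇒≱ (ℕₚ.≤-reflexive (sym (trans q (cong suc (trans (cong (λ h → h + h) eq) (sym (≡ᵇ-sound l _ ev))))))) k≤l)

-- Two different numbers with the same half `h` are `2 * h` and `2 * h + 1`. For the labels of a
-- child and its parent this says that the first differing bit is 0 at the child and 1 at the
-- parent.
split-even : ∀ {k l} → k ≤ l → k ≢ l → ⌊ k /2⌋ ≡ ⌊ l /2⌋ → isEven k ≡ true × isEven l ≡ false
split-even {k} {l} k≤l k≢l eq with half-cases k
... | inj₁ q = ≡ᵇ-true q , Boolₚ.¬-not λ ev → k≢l (even-below k≤l ev eq)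
... | inj₂ q with half-cases l
...   | inj₁ q′ = ⊥-elim (k≢l (even-below k≤l (≡ᵇ-true q′) eq))
...   | inj₂ q′ = ⊥-elim (k≢l (trans q (trans (cong (λ h → suc (h + h)) eq) (sym q′))))

setVal : NState → ℕ → NState
setVal s k = record s { val = k }

-- The edge delivers in the round of the highest bit in which the labels of its ends differ. Since
-- labels increase along tree edges, this happens exactly once.
moves : (EState → Bool) → ℕ → EState → Bool
moves act b s = act s ∧ ((pre (suc b) (labᶜ s) ≡ᵇ pre (suc b) (labᵖ s)) ∧ not (pre b (labᶜ s) ≡ᵇ pre b (labᵖ s)))

toParent : Maybe Bool → ℕ → ℕ × ℕ
toParent (just true)  k = k , 0
toParent (just false) k = 0 , k
toParent nothing      k = 0 , k

-- Only pieces with current bit 0 are contracted. Vertices with bit 1 stay single, so each receives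
-- just the sums of its own children.
trie : (EState → Bool) → ℕ → Round
trie act b = record
  { con   = λ s → act s ∧ (isEven (pre b (labᶜ s)) ∧ (pre b (labᶜ s) ≡ᵇ pre b (labᵖ s)))
  ; x     = val
  ; isMin = false
  ; lY    = λ s _ → s
  ; eL    = λ s _ _ → s
  ; z     = λ s p q → toParent (kd s) (moves act b s ▹ childSide (kd s) p q)
  ; lA    = λ s k → setVal s (val s + k)
  }

descend : (EState → Bool) → ℕ → List Round
descend act zero    = []
descend act (suc b) = trie act b ∷ descend act b

module Stages (B : ℕ) {n : ℕ} (G : Graph n) (O : OrientedTree G) where
  open Graph G using (m; loopless)
  open Semantics B G
  open Tree O

  share-step : ∀ {xv set learn c c′} → (∀ v → xv (proj₁ c v) < 2 ^ B) → Sem (share xv set learn) c c′ →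
               (∀ v → proj₁ c′ v ≡ set (proj₁ c v)) ×
               (∀ f → proj₂ c′ f ≡ learn (proj₂ c f) (xv (proj₁ c (src G f))) (xv (proj₁ c (dst G f))))
  share-step {xv} {set} {learn} {c} {c′} small S = ns-new , edges
    where
    open Sem S
    trivial : ∀ {u v} → Reach G (λ f → false ≡ true) u v → u ≡ v
    trivial here = refl
    total-self : ∀ v → total v ≡ xv (proj₁ c v)
    total-self v = trans (sum-only _ v (λ u u≢v → cong (_▹ xv (proj₁ c u)) (Boolₚ.¬-not λ s → u≢v (sym (trivial (same-sound s))))))
                         (cong (_▹ xv (proj₁ c v)) (same-complete here))
    y-self : ∀ v → y v ≡ xv (proj₁ c v)
    y-self v = trans (y-sum refl v (subst (_< 2 ^ B) (sym (total-self v)) (small v))) (total-self v)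
    edges : ∀ f → proj₂ c′ f ≡ learn (proj₂ c f) (xv (proj₁ c (src G f))) (xv (proj₁ c (dst G f)))
    edges f = trans (st-new f) (trans (cong (λ b → if b then proj₂ c f else learn (proj₂ c f) (y (src G f)) (y (dst G f)))
                                         (Boolₚ.¬-not {merged f} λ s → loopless f (trivial (same-sound s))))
                                      (cong₂ (learn (proj₂ c f)) (y-self (src G f)) (y-self (dst G f))))

  module Trie (act : EState → Bool) (M : ℕ) (base : Fin n → NState) (E : Fin m → EState) (o label : Fin n → ℕ)
    (E-kd : ∀ f → kd (E f) ≡ kind f)
    (E-labᶜ : ∀ f → labᶜ (E f) ≡ label (ch f)) (E-labᵖ : ∀ f → labᵖ (E f) ≡ label (pa f))
    (act⊆tree : (act ∘ E) ⊆ᵇ tree)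
    (monotone : ∀ {f} → tree f ≡ true → label (ch f) < label (pa f))
    (label< : ∀ v → label v < 2 ^ M)
    (small : sumFin n o < 2 ^ B) where

    Act : Fin m → Bool
    Act = act ∘ E

    differ : ℕ → Fin n → Fin n → Bool
    differ b v w = not (pre b (label w) ≡ᵇ pre b (label v))

    -- The invariant: after treating the bits from `b` upwards, `v` has received the totals of
    -- exactly those children whose labels differ from its own in these bits. For `M` these are no
    -- children, for 0 all of them.
    valAt : ℕ → Fin n → ℕ
    valAt b v = o v + sumFin n (λ w → (isChild Act v w ∧ differ b v w) ▹ tot Act o w)

    Inv : ℕ → Conf → Set
    Inv b c = (∀ v → proj₁ c v ≡ setVal (base v) (valAt b v)) × (∀ f → proj₂ c f ≡ E f)

    valAt-top : ∀ v → valAt M v ≡ o v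
    valAt-top v = trans (cong (o v +_) (sum-zero λ w → trans (cong (λ b → (isChild Act v w ∧ not b) ▹ tot Act o w)
                    (≡ᵇ-true (trans (pre-zero M (label< w)) (sym (pre-zero M (label< v))))))
                    (cong (_▹ tot Act o w) (Boolₚ.∧-zeroʳ (isChild Act v w))))) (ℕₚ.+-identityʳ (o v))

    child-label : ∀ {v w} → isChild Act v w ≡ true → label w < label v
    child-label {v} {w} ic with isChild-sound {Act} {v} {w} ic
    ... | f , eq , a , refl = subst (λ u → label u < label (pa f)) (pe-ch eq) (monotone (pe-tree eq))

    valAt-zero : ∀ v → valAt 0 v ≡ tot Act o v
    valAt-zero v = sym (trans (tot-children Act o v) (cong (o v +_) (sum-cong λ w → cong (_▹ tot Act o w) (all-differ w))))
      where
      all-differ : ∀ w → isChild Act v w ≡ isChild Act v w ∧ differ 0 v w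
      all-differ w = bool-iff (λ ic → cong₂ _∧_ ic (cong not (≡ᵇ-false (ℕₚ.<⇒≢ (child-label {v} {w} ic))))) (proj₁ ∘ ∧-true (isChild Act v w))

    valAt≤tot : ∀ b v → valAt b v ≤ tot Act o v
    valAt≤tot b v = ℕₚ.≤-trans (ℕₚ.+-monoʳ-≤ (o v) (sum-mono λ w → drop (isChild Act v w) (differ b v w) (tot Act o w)))
                               (ℕₚ.≤-reflexive (sym (tot-children Act o v)))
      where
      drop : ∀ p q k → (p ∧ q) ▹ k ≤ p ▹ k
      drop true  q k = ▹-≤ q
      drop false q k = z≤n

    module Step (b : ℕ) where

      A : Fin m → Bool
      A f = Act f ∧ (isEven (pre b (label (ch f))) ∧ (pre b (label (ch f)) ≡ᵇ pre b (label (pa f))))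

      A⊆Act : A ⊆ᵇ Act
      A⊆Act {f} p = proj₁ (∧-true (Act f) p)

      A⊆tree : A ⊆ᵇ tree
      A⊆tree {f} p = act⊆tree (A⊆Act {f} p)

      Moves : Fin m → Bool
      Moves f = Act f ∧ ((pre (suc b) (label (ch f)) ≡ᵇ pre (suc b) (label (pa f))) ∧
                         not (pre b (label (ch f)) ≡ᵇ pre b (label (pa f))))

      evenAt : Fin n → Bool
      evenAt v = isEven (pre b (label v))

      moves-parts : ∀ {f} → Moves f ≡ true → Act f ≡ true ×
                    pre (suc b) (label (ch f)) ≡ pre (suc b) (label (pa f)) ×
                    (pre b (label (ch f)) ≡ᵇ pre b (label (pa f))) ≡ false
      moves-parts {f} mv with ∧-true (Act f) mv
      ... | a , rest with ∧-true (pre (suc b) (label (ch f)) ≡ᵇ pre (suc b) (label (pa f))) rest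
      ...   | eq , ne = a , ≡ᵇ-sound (pre (suc b) (label (ch f))) _ eq , not-true ne

      moves-tree : Moves ⊆ᵇ tree
      moves-tree {f} mv = act⊆tree (proj₁ (moves-parts {f} mv))

      moves-parity : ∀ {f} → Moves f ≡ true → evenAt (ch f) ≡ true × evenAt (pa f) ≡ false
      moves-parity {f} mv with moves-parts {f} mv
      ... | a , eq , ne = split-even (pre-mono b (ℕₚ.<⇒≤ (monotone (act⊆tree a)))) (≡ᵇ-unsound ne) eq

      moves-A : ∀ {f} → Moves f ≡ true → A f ≡ false
      moves-A {f} mv = trans (cong (λ p → Act f ∧ (evenAt (ch f) ∧ p)) (proj₂ (proj₂ (moves-parts {f} mv))))
                             (trans (cong (Act f ∧_) (Boolₚ.∧-zeroʳ (evenAt (ch f)))) (Boolₚ.∧-zeroʳ (Act f)))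

      moves-top : ∀ {f} → Moves f ≡ true → Top A (ch f)
      moves-top {f} mv eq = subst (λ g → A g ≡ false) (Maybeₚ.just-injective (trans (sym (ch-pe (moves-tree {f} mv))) eq)) (moves-A {f} mv)

      A-even : ∀ {g} → A g ≡ true → evenAt (ch g) ≡ true × evenAt (pa g) ≡ true
      A-even {g} p with ∧-true (evenAt (ch g)) (proj₂ (∧-true (Act g) p))
      ... | ev , eq = ev , subst (λ k → isEven k ≡ true) (≡ᵇ-sound (pre b (label (ch g))) (pre b (label (pa g))) eq) ev

      below-even : ∀ {c u} → evenAt c ≡ true → Below A c u → evenAt u ≡ true
      below-even ev here = ev
      below-even ev (up {f = g} eq a _) = subst (λ v → evenAt v ≡ true) (pe-ch eq) (proj₁ (A-even {g} a))

      odd-alone : ∀ {u v} → evenAt u ≡ false → Reach G (λ f → A f ≡ true) u v → u ≡ v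
      odd-alone od here = refl
      odd-alone od (step g a j _) with joins-tree j
      ... | inj₁ (refl , _) = case trans (sym od) (proj₁ (A-even {g} a)) of λ ()
      ... | inj₂ (refl , _) = case trans (sym od) (proj₂ (A-even {g} a)) of λ ()

      -- If a child of `u` agrees with it on the higher bits, its smaller label forces bit 0 as
      -- well, so the edge is contracted. Hence the values in a contracted piece are the summands of
      -- `tot-cluster`.
      even-valAt : ∀ {u} → evenAt u ≡ true →
        valAt (suc b) u ≡ o u + sumFin n (λ w → (isChild Act u w ∧ not (inCluster A w)) ▹ tot Act o w)
      even-valAt {u} ev = cong (o u +_) (sum-cong λ w → cong (_▹ tot Act o w) (bool-iff (to w) (from w)))
        where

        same⇒A : ∀ {w f} → pe w ≡ just f → Act f ≡ true → pa f ≡ u → pre (suc b) (label w) ≡ pre (suc b) (label u) → A f ≡ true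
        same⇒A {w} {f} eq a refl p with even-below (pre-mono b (ℕₚ.<⇒≤ (subst (λ v → label v < label (pa f)) (pe-ch eq) (monotone (pe-tree eq))))) ev p
        ... | q rewrite a | pe-ch eq | q = cong₂ _∧_ ev (≡ᵇ-true {pre b (label (pa f))} refl)
        A⇒same : ∀ {w f} → pe w ≡ just f → pa f ≡ u → A f ≡ true → pre (suc b) (label w) ≡ pre (suc b) (label u)
        A⇒same {w} {f} eq refl p = cong ⌊_/2⌋ (subst (λ v → pre b (label v) ≡ pre b (label (pa f))) (pe-ch eq)
                                     (≡ᵇ-sound (pre b (label (ch f))) _ (proj₂ (∧-true (isEven (pre b (label (ch f)))) (proj₂ (∧-true (Act f) p))))))
        to : ∀ w → isChild Act u w ∧ differ (suc b) u w ≡ true → isChild Act u w ∧ not (inCluster A w) ≡ true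
        to w p with ∧-true (isChild Act u w) p
        ... | ic , d with isChild-sound {Act} {u} {w} ic
        ...   | f , eq , a , pf = cong₂ _∧_ ic (cong not (trans (cong (maybe′ A false) eq)
                 (Boolₚ.¬-not λ Af → ≡ᵇ-unsound (not-true d) (A⇒same eq pf Af))))
        from : ∀ w → isChild Act u w ∧ not (inCluster A w) ≡ true → isChild Act u w ∧ differ (suc b) u w ≡ true
        from w p with ∧-true (isChild Act u w) p
        ... | ic , d with isChild-sound {Act} {u} {w} ic
        ...   | f , eq , a , pf = cong₂ _∧_ ic (cong not (≡ᵇ-false λ s →
                 case trans (sym (not-true d)) (trans (cong (maybe′ A false) eq) (same⇒A eq a pf s)) of λ ()))

      delivered : Fin n → ℕ
      delivered v = sumFin m (λ f → (Moves f ∧ does (pa f ≟ v)) ▹ tot Act o (ch f))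

      -- A child that differs from `v` in the bits from `b` upwards either differs above `b` already
      -- or first at `b`; the latter children deliver in this round.
      valAt-step : ∀ v → valAt (suc b) v + delivered v ≡ valAt b v
      valAt-step v = trans (ℕₚ.+-assoc (o v) _ _) (cong (o v +_) (trans (cong (sumFin n hi +_) nodewise) (trans (sym (sum-+ hi lo)) (sum-cong combine′))))
        where
        hi lo : Fin n → ℕ
        hi w = (isChild Act v w ∧ differ (suc b) v w) ▹ tot Act o w
        lo w = (isChild Act v w ∧ ((pre (suc b) (label w) ≡ᵇ pre (suc b) (label v)) ∧ differ b v w)) ▹ tot Act o w
        nodewise : delivered v ≡ sumFin n lo
        nodewise = trans (sum-tree _ off) (sum-cong at)
          where
          off : ∀ f → tree f ≡ false → (Moves f ∧ does (pa f ≟ v)) ▹ tot Act o (ch f) ≡ 0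
          off f t = cong (λ b → (b ∧ does (pa f ≟ v)) ▹ tot Act o (ch f)) (Boolₚ.¬-not λ mv → case trans (sym t) (moves-tree {f} mv) of λ ())
          at : ∀ w → viaParent (λ f → (Moves f ∧ does (pa f ≟ v)) ▹ tot Act o (ch f)) w ≡ lo w
          at w with pe w in eq
          ... | nothing = refl
          ... | just f with pa f ≟ v
          ...   | yes refl rewrite pe-ch eq | Boolₚ.∧-identityʳ (Act f) | Boolₚ.∧-identityʳ (Act f ∧ ((pre (suc b) (label w) ≡ᵇ pre (suc b) (label (pa f))) ∧ differ b (pa f) w)) = refl
          ...   | no _ rewrite Boolₚ.∧-zeroʳ (Moves f) | Boolₚ.∧-zeroʳ (Act f) = refl
        combine′ : ∀ w → hi w + lo w ≡ (isChild Act v w ∧ differ b v w) ▹ tot Act o w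
        combine′ w with isChild Act v w
        ... | false = refl
        ... | true with pre b (label w) ≡ᵇ pre b (label v) in p
        ...   | true rewrite ≡ᵇ-true (cong ⌊_/2⌋ (≡ᵇ-sound (pre b (label w)) (pre b (label v)) p)) = refl
        ...   | false with pre (suc b) (label w) ≡ᵇ pre (suc b) (label v)
        ...     | true  = refl
        ...     | false = ℕₚ.+-identityʳ _

      inv-step : ∀ {c c′} → Inv (suc b) c → Sem (trie act b) c c′ → Inv b c′
      inv-step {c} {c′} (nodes , edges) S = nodes′ , edges′
        where
        open Sem S
        con-A : ∀ f → con (trie act b) (st f) ≡ A f
        con-A f rewrite edges f | E-labᶜ f | E-labᵖ f = refl
        toA : ∀ {u v} → same u v ≡ true → Reach G (λ f → A f ≡ true) u v
        toA s = reach-map (λ f p → trans (sym (con-A f)) p) (same-sound s)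
        fromA : ∀ {u v} → Reach G (λ f → A f ≡ true) u v → same u v ≡ true
        fromA p = same-complete (reach-map (λ f q → trans (con-A f) q) p)

        same-sub : ∀ {c u} → Top A c → same c u ≡ sub A c u
        same-sub t = bool-iff (λ s → sub-complete (reach-below (λ {g} → A⊆tree {g}) t here (toA s)))
                              (λ s → fromA (reach-sym (below-reach (λ {g} → A⊆tree {g}) (sub-sound s))))

        -- The supernode of `ch f` is the piece with top `ch f`; by `even-valAt` and `tot-cluster`
        -- its values add up to the whole total of `ch f`.
        y-child : ∀ {f} → Moves f ≡ true → y (ch f) ≡ tot Act o (ch f)
        y-child {f} mv = trans (y-sum refl (ch f) (subst (_< 2 ^ B) (sym total-tot) (ℕₚ.≤-<-trans (tot≤sum Act o (ch f)) small))) total-tot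
          where
          at : ∀ u → same (ch f) u ▹ val (ns u) ≡
                     sub A (ch f) u ▹ (o u + sumFin n (λ w → (isChild Act u w ∧ not (inCluster A w)) ▹ tot Act o w))
          at u rewrite same-sub {ch f} {u} (moves-top {f} mv) with below? A (ch f) u
          ... | no _   = refl
          ... | yes bl = trans (cong val (nodes u)) (even-valAt (below-even (proj₁ (moves-parity {f} mv)) bl))
          total-tot : total (ch f) ≡ tot Act o (ch f)
          total-tot = trans (sum-cong at) (tot-cluster (λ {g} → A⊆Act {g}) o (ch f))

        sent-eq : ∀ f → sent f ≡ toParent (kind f) (Moves f ▹ y (ch f))
        sent-eq f rewrite edges f | E-labᶜ f | E-labᵖ f | E-kd f | childSide-map y (kind f) (src G f) (dst G f) = refl

        same-parent : ∀ {f} v → Moves f ≡ true → same v (pa f) ≡ does (pa f ≟ v)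
        same-parent {f} v mv = bool-iff (λ s → dec-true (pa f ≟ v) (odd-alone (proj₂ (moves-parity {f} mv)) (reach-sym (toA s)))) back
          where
          back : does (pa f ≟ v) ≡ true → same v (pa f) ≡ true
          back d with pa f ≟ v
          ... | yes refl = same-complete here

        unmerged : ∀ {f} → Moves f ≡ true → merged f ≡ false
        unmerged {f} mv = Boolₚ.¬-not λ s → ℕₚ.<⇒≱ (pa-dep (moves-tree {f} mv)) (below-dep (reach-below (λ {g} → A⊆tree {g}) (moves-top {f} mv) here (child-parent (toA s))))
          where
          child-parent : Reach G (λ f → A f ≡ true) (src G f) (dst G f) → Reach G (λ f → A f ≡ true) (ch f) (pa f)
          child-parent p with kind f
          ... | just true  = reach-sym p
          ... | just false = p
          ... | nothing    = p

        toParent-sum : ∀ v f k → (same v (src G f) ▹ proj₁ (toParent (kind f) k)) + (same v (dst G f) ▹ proj₂ (toParent (kind f) k))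
                               ≡ same v (pa f) ▹ k
        toParent-sum v f k with kind f
        ... | just true  = trans (cong ((same v (src G f) ▹ k) +_) (▹-zero (same v (dst G f)))) (ℕₚ.+-identityʳ _)
        ... | just false = cong (_+ (same v (dst G f) ▹ k)) (▹-zero (same v (src G f)))
        ... | nothing    = cong (_+ (same v (dst G f) ▹ k)) (▹-zero (same v (src G f)))

        received-eq : ∀ v → received v ≡ delivered v
        received-eq v = sum-cong λ f → trans (cong (λ p → not (merged f) ▹ ((same v (src G f) ▹ proj₁ p) + (same v (dst G f) ▹ proj₂ p))) (sent-eq f))
          (trans (cong (not (merged f) ▹_) (toParent-sum v f (Moves f ▹ y (ch f)))) (at f (Moves f) refl))
          where
          at : ∀ f b → Moves f ≡ b → not (merged f) ▹ same v (pa f) ▹ b ▹ y (ch f) ≡ (b ∧ does (pa f ≟ v)) ▹ tot Act o (ch f)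
          at f true mv rewrite unmerged {f} mv | same-parent {f} v mv | y-child {f} mv = refl
          at f false _ = trans (cong (not (merged f) ▹_) (▹-zero (same v (pa f)))) (▹-zero (not (merged f)))

        a-eq : ∀ v → a v ≡ delivered v
        a-eq v = trans (agg v (subst (_< 2 ^ B) (sym (received-eq v)) bound)) (received-eq v)
          where
          -- What arrives is part of the new value, and this never exceeds the final total of `v`.
          bound : delivered v < 2 ^ B
          bound = ℕₚ.≤-<-trans (ℕₚ.≤-trans (ℕₚ.m≤n+m (delivered v) (valAt (suc b) v))
                    (ℕₚ.≤-trans (ℕₚ.≤-reflexive (valAt-step v)) (ℕₚ.≤-trans (valAt≤tot b v) (tot≤sum Act o v)))) small

        nodes′ : ∀ v → proj₁ c′ v ≡ setVal (base v) (valAt b v)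
        nodes′ v = trans (ns-new v) (trans (cong (λ s → setVal s (val s + a v)) (nodes v))
                     (cong (setVal (base v)) (trans (cong (valAt (suc b) v +_) (a-eq v)) (valAt-step v))))
        edges′ : ∀ f → proj₂ c′ f ≡ E f
        edges′ f = trans (st-new f) (trans (Boolₚ.if-eta (merged f)) (edges f))

    descend-correct : ∀ b → Hoare (Inv b) (descend act b) (Inv 0)
    descend-correct zero    i refl        = i
    descend-correct (suc b) i (_ , s , e) = descend-correct b (Step.inv-step b i s) e

    totals : Hoare (λ c → (∀ v → proj₁ c v ≡ setVal (base v) (o v)) × (∀ f → proj₂ c f ≡ E f)) (descend act M)
                   (λ c → (∀ v → proj₁ c v ≡ setVal (base v) (tot Act o v)) × (∀ f → proj₂ c f ≡ E f))
    totals (nodes , edges) e with descend-correct M ((λ v → trans (nodes v) (cong (setVal (base v)) (sym (valAt-top v)))) , edges) e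
    ... | nodes′ , edges′ = (λ v → trans (nodes′ v) (cong (setVal (base v)) (valAt-zero v))) , edges′

-- Rank paths

2^log≤ : ∀ {k} → 1 ≤ k → 2 ^ ⌊log₂ k ⌋ ≤ k
2^log≤ {k} = go k (<-wellFounded k)
  where
  go : ∀ k → Acc _<_ k → 1 ≤ k → 2 ^ ⌊log₂ k ⌋ ≤ k
  go 1 _ _ = ℕₚ.≤-refl
  go k@(suc (suc j)) (acc rs) _ = begin
    2 ^ ⌊log₂ k ⌋                    ≡⟨ cong (2 ^_) (sym (ℕₚ.m+[n∸m]≡n log≥1)) ⟩
    2 * 2 ^ (⌊log₂ k ⌋ ∸ 1)          ≡⟨ cong (λ l → 2 * 2 ^ l) (sym (⌊log₂⌊n/2⌋⌋≡⌊log₂n⌋∸1 k)) ⟩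
    2 * 2 ^ ⌊log₂ ⌊ k /2⌋ ⌋          ≤⟨ ℕₚ.*-monoʳ-≤ 2 (go ⌊ k /2⌋ (rs (ℕₚ.⌊n/2⌋<n (suc j))) (s≤s z≤n)) ⟩
    2 * ⌊ k /2⌋                      ≡⟨ cong (⌊ k /2⌋ +_) (ℕₚ.+-identityʳ ⌊ k /2⌋) ⟩
    ⌊ k /2⌋ + ⌊ k /2⌋                ≤⟨ ℕₚ.+-monoʳ-≤ ⌊ k /2⌋ (ℕₚ.⌊n/2⌋≤⌈n/2⌉ k) ⟩
    ⌊ k /2⌋ + Data.Nat.⌈ k /2⌉       ≡⟨ ℕₚ.⌊n/2⌋+⌈n/2⌉≡n k ⟩
    k                                ∎
    where
    open ℕₚ.≤-Reasoning
    log≥1 : 1 ≤ ⌊log₂ k ⌋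
    log≥1 = ⌊log₂⌋-mono-≤ {2} {k} (s≤s (s≤s z≤n))

n<2^[1+log] : ∀ n → n < 2 ^ suc ⌊log₂ n ⌋
n<2^[1+log] n = ℕₚ.≰⇒> λ le → ℕₚ.<⇒≱ (ℕₚ.n<1+n ⌊log₂ n ⌋)
  (ℕₚ.≤-trans (ℕₚ.≤-reflexive (sym (⌊log₂[2^n]⌋≡n (suc ⌊log₂ n ⌋)))) (⌊log₂⌋-mono-≤ le))

sum-two : ∀ {n} (f : Fin n → ℕ) {i j} → i ≢ j → f i + f j ≤ sumFin n f
sum-two {n} f {i} {j} i≢j = begin
  f i + f j
    ≡⟨ cong₂ _+_ (sym (sum-delta f i)) (sym (sum-delta f j)) ⟩
  sumFin n (λ k → does (k ≟ i) ▹ f k) + sumFin n (λ k → does (k ≟ j) ▹ f k)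
    ≡⟨ sym (sum-+ (λ k → does (k ≟ i) ▹ f k) _) ⟩
  sumFin n (λ k → (does (k ≟ i) ▹ f k) + (does (k ≟ j) ▹ f k))
    ≤⟨ sum-mono pointwise ⟩
  sumFin n f ∎
  where
  open ℕₚ.≤-Reasoning
  pointwise : ∀ k → (does (k ≟ i) ▹ f k) + (does (k ≟ j) ▹ f k) ≤ f k
  pointwise k with k ≟ i | k ≟ j
  ... | yes refl | yes refl = ⊥-elim (i≢j refl)
  ... | yes _    | no _     = ℕₚ.≤-reflexive (ℕₚ.+-identityʳ (f k))
  ... | no _     | yes _    = ℕₚ.≤-refl
  ... | no _     | no _     = z≤n

-- Membership of a vertex in W (the part hanging off x), in the part X below the
-- successor of x on its path, and in the whole subtree of x.
data Region : Bool → Bool → Bool → Set where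
  hanging : Region true  false true
  beneath : Region false true  true
  outside : Region false false false

-- The contribution of one edge of weight `k` to the relation between consecutive cuts on a path,
-- checked for all placements of its two ends.
region-balance : ∀ {W X S W′ X′ S′} → Region W X S → Region W′ X′ S′ → ∀ k →
  (((W xor W′) ∧ not (S ∧ S′)) ▹ k) + ((X xor X′) ▹ k) ≡ ((S xor S′) ▹ k) + (((W xor W′) ∧ (S ∧ S′)) ▹ k)
region-balance hanging hanging k = refl
region-balance hanging beneath k = refl
region-balance hanging outside k = refl
region-balance beneath hanging k = refl
region-balance beneath beneath k = refl
region-balance beneath outside k = sym (ℕₚ.+-identityʳ k)
region-balance outside hanging k = refl
region-balance outside beneath k = sym (ℕₚ.+-identityʳ k)
region-balance outside outside k = refl

module Ranks {n : ℕ} {G : Graph n} (O : OrientedTree G) (w : Fin (Graph.m G) → ℕ) where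
  open Graph G using (m)
  open Tree O

  sz : Fin n → ℕ
  sz = tot tree (λ _ → 1)

  sz≤n : ∀ v → sz v ≤ n
  sz≤n v = ℕₚ.≤-trans (tot≤sum tree (λ _ → 1) v) (ℕₚ.≤-reflexive (trans (sum-const n 1) (ℕₚ.*-identityʳ n)))

  sz-pos : ∀ v → 1 ≤ sz v
  sz-pos v = ℕₚ.≤-trans (ℕₚ.m≤m+n 1 _) (ℕₚ.≤-reflexive (sym (tot-children tree (λ _ → 1) v)))

  sz-child : ∀ {u f} → pe u ≡ just f → sz u < sz (pa f)
  sz-child {u} {f} eq = begin-strict
    sz u                                                   ≡⟨ cong (_▹ sz u) (sym (isChild-complete {tree} eq (pe-tree eq))) ⟩
    isChild tree (pa f) u ▹ sz u                           ≤⟨ term≤sum (λ w → isChild tree (pa f) w ▹ sz w) u ⟩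
    sumFin n (λ w → isChild tree (pa f) w ▹ sz w)          <⟨ ℕₚ.n<1+n _ ⟩
    1 + sumFin n (λ w → isChild tree (pa f) w ▹ sz w)      ≡⟨ sym (tot-children tree (λ _ → 1) (pa f)) ⟩
    sz (pa f)                                              ∎
    where open ℕₚ.≤-Reasoning

  sz-below : ∀ {v u} → Below tree v u → sz u ≤ sz v
  sz-below here        = ℕₚ.≤-refl
  sz-below (up eq _ b) = ℕₚ.≤-trans (ℕₚ.<⇒≤ (sz-child eq)) (sz-below b)

  rk : Fin n → ℕ
  rk v = ⌊log₂ sz v ⌋

  rk-below : ∀ {v u} → Below tree v u → rk u ≤ rk v
  rk-below b = ⌊log₂⌋-mono-≤ (sz-below b)

  -- The edges of the rank paths.
  level : Fin m → Bool
  level f = tree f ∧ (rk (ch f) ≡ᵇ rk (pa f))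

  level-sound : ∀ {f} → level f ≡ true → tree f ≡ true × rk (ch f) ≡ rk (pa f)
  level-sound {f} p with ∧-true (tree f) p
  ... | t , q = t , ≡ᵇ-sound (rk (ch f)) (rk (pa f)) q

  level⊆tree : level ⊆ᵇ tree
  level⊆tree {f} p = proj₁ (level-sound {f} p)

  level-pe : ∀ {u f} → pe u ≡ just f → rk u ≡ rk (pa f) → level f ≡ true
  level-pe {u} {f} eq r = cong₂ _∧_ (pe-tree eq) (≡ᵇ-true (trans (cong rk (pe-ch eq)) r))

  level-child : ∀ {v u} → isChild level v u ≡ true → ∃ λ f → pe u ≡ just f × pa f ≡ v × rk u ≡ rk v
  level-child {v} {u} ic with isChild-sound {level} {v} {u} ic
  ... | f , eq , l , refl = f , eq , refl , trans (cong rk (sym (pe-ch eq))) (proj₂ (level-sound {f} l))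

  -- Two subtrees of size at least 2 ^ k below v would give v rank at least k + 1.
  level-unique : ∀ {v a b} → isChild level v a ≡ true → isChild level v b ≡ true → a ≡ b
  level-unique {v} {a} {b} ca cb with a ≟ b
  ... | yes eq = eq
  ... | no a≢b with level-child {v} {a} ca | level-child {v} {b} cb
  ...   | f , ea , refl , ra | g , eb , pb , rb = ⊥-elim (ℕₚ.<⇒≱ (ℕₚ.n<1+n (rk v)) (begin
      suc (rk v)                                        ≡⟨ sym (⌊log₂[2^n]⌋≡n (suc (rk v))) ⟩
      ⌊log₂ 2 ^ suc (rk v) ⌋                            ≤⟨ ⌊log₂⌋-mono-≤ doubled ⟩
      rk v                                              ∎))
    where
    open ℕₚ.≤-Reasoning
    child-tree : ∀ {u h} → pe u ≡ just h → pa h ≡ v → isChild tree v u ≡ true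
    child-tree {u} eq p = subst (λ t → isChild tree t u ≡ true) p (isChild-complete {tree} eq (pe-tree eq))
    doubled : 2 ^ suc (rk v) ≤ sz v
    doubled = begin
      2 ^ suc (rk v)                                     ≡⟨ cong (2 ^ rk v +_) (ℕₚ.+-identityʳ _) ⟩
      2 ^ rk v + 2 ^ rk v                                ≡⟨ cong₂ (λ i j → 2 ^ i + 2 ^ j) (sym ra) (sym rb) ⟩
      2 ^ rk a + 2 ^ rk b                                ≤⟨ ℕₚ.+-mono-≤ (2^log≤ (sz-pos a)) (2^log≤ (sz-pos b)) ⟩
      sz a + sz b                                        ≡⟨ cong₂ (λ i j → (i ▹ sz a) + (j ▹ sz b)) (sym (child-tree ea refl)) (sym (child-tree eb pb)) ⟩
      (isChild tree v a ▹ sz a) + (isChild tree v b ▹ sz b)  ≤⟨ sum-two (λ u → isChild tree v u ▹ sz u) a≢b ⟩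
      sumFin n (λ u → isChild tree v u ▹ sz u)           ≤⟨ ℕₚ.n≤1+n _ ⟩
      1 + sumFin n (λ u → isChild tree v u ▹ sz u)       ≡⟨ sym (tot-children tree (λ _ → 1) v) ⟩
      sz v                                               ∎

  low : ℕ → Fin m → Bool
  low k f = tree f ∧ (rk (ch f) <ᵇ k)

  low⊆tree : ∀ {k} → low k ⊆ᵇ tree
  low⊆tree {k} {f} p = proj₁ (∧-true (tree f) p)

  low-rk : ∀ {k u f} → pe u ≡ just f → low k f ≡ true → rk u < k
  low-rk {k} {u} {f} eq p = subst (λ v → rk v < k) (pe-ch eq) (<ᵇ≡true⇒< (proj₂ (∧-true (tree f) p)))

  rk-low : ∀ {k u f} → pe u ≡ just f → rk u < k → low k f ≡ true
  rk-low {k} {u} {f} eq r = cong₂ _∧_ (pe-tree eq) (<⇒<ᵇ≡true (subst (λ v → rk v < k) (sym (pe-ch eq)) r))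

  low-below-high : ∀ {k c u} → Below (low k) c u → k ≤ rk u → u ≡ c
  low-below-high here _ = refl
  low-below-high {k} (up eq a _) r = ⊥-elim (ℕₚ.<⇒≱ (low-rk {k} eq a) r)

  high-top : ∀ {k c} → k ≤ rk c → Top (low k) c
  high-top {k} r {f} eq = Boolₚ.¬-not λ p → ℕₚ.<⇒≱ (low-rk {k} eq p) r

  -- The parent edge of a top is not low, so its child end has rank at least `k`. At the root, which
  -- has no parent edge, the vertex `x` of rank `k` below it gives the bound.
  top-high : ∀ {k x c} → rk x ≡ k → Top (low k) c → k ≤ rk c
  top-high {k} {x} {c} rx t with pe c in eq
  ... | nothing = subst₂ (λ a v → a ≤ rk v) rx (sym (pe-root eq)) (rk-below (below-root x))
  ... | just f  = ℕₚ.≮⇒≥ λ r → case trans (sym (t refl)) (rk-low eq r) of λ ()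

  module At (x : Fin n) where

    k : ℕ
    k = rk x

    W : Fin n → Bool
    W = sub (low k) x

    S : Fin n → Bool
    S = sub tree x

    W⇒S : ∀ {u} → Below (low k) x u → Below tree x u
    W⇒S = below-weaken (λ {f} → low⊆tree {k} {f})

    -- Going down from `x`, let `u` be the first vertex reached by an edge that is not low. Its
    -- parent has rank at least `k` and so is `x` by `low-below-high`; then `u` is the next vertex
    -- of the path.
    locate : ∀ {u} → Below tree x u → Below (low k) x u ⊎ ∃ λ v → isChild level x v ≡ true × Below tree v u
    locate here = inj₁ here
    locate {u} (up {f = f} eq t b) with locate b
    ... | inj₂ (v , c , b′) = inj₂ (v , c , up eq t b′)
    ... | inj₁ b′ with rk u ℕₚ.<? k
    ...   | yes r = inj₁ (up eq (rk-low eq r) b′)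
    ...   | no r with low-below-high b′ (ℕₚ.≤-trans (ℕₚ.≮⇒≥ r) (rk-below (up {A = tree} eq t here)))
    ...     | refl = inj₂ (u , isChild-complete {level} eq (level-pe eq (ℕₚ.≤-antisym (rk-below (up {A = tree} eq t here)) (ℕₚ.≮⇒≥ r))) , here)

    child-below : ∀ {v} → isChild level x v ≡ true → Below tree x v
    child-below {v} c with level-child {x} {v} c
    ... | f , eq , refl , _ = up eq (pe-tree eq) here

    exclusive : ∀ {v u} → isChild level x v ≡ true → Below (low k) x u → Below tree v u → ⊥
    exclusive {v} c p q with level-child {x} {v} c | below-compare p q
    ... | f , eq , refl , r | inj₁ b = ℕₚ.<⇒≢ (sz-child eq) (cong sz (low-below-high b (ℕₚ.≤-reflexive (sym r))))
    ... | f , eq , refl , r | inj₂ b = ℕₚ.<⇒≱ (sz-child eq) (sz-below b)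

    -- An edge leaving `W` leads beneath the next path vertex exactly when both of its ends are in
    -- `S`. This form applies also at the lower end of a path, where there is no next vertex.
    plus minus : Fin m → Bool
    plus  f = (W (src G f) xor W (dst G f)) ∧ not (S (src G f) ∧ S (dst G f))
    minus f = (W (src G f) xor W (dst G f)) ∧ (S (src G f) ∧ S (dst G f))

  ap am : Fin n → ℕ
  ap x = sumFin m (λ f → At.plus x f ▹ w f)
  am x = sumFin m (λ f → At.minus x f ▹ w f)

  -- By `level-unique` the sum has at most one term, the cut of the next path vertex. Where the path
  -- ends, `region-balance` applies with an empty part beneath.
  balance : ∀ x → ap x + sumFin n (λ v → isChild level x v ▹ cut w v) ≡ cut w x + am x
  balance x with Finₚ.any? (λ v → isChild level x v Boolₚ.≟ true)
  ... | yes (v , c) = begin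
      ap x + sumFin n (λ v → isChild level x v ▹ cut w v)
        ≡⟨ cong (ap x +_) (trans (sum-only _ v others) (cong (_▹ cut w v) c)) ⟩
      ap x + cut w v
        ≡⟨ sym (sum-+ (λ f → At.plus x f ▹ w f) _) ⟩
      sumFin m (λ f → (At.plus x f ▹ w f) + (crosses v f ▹ w f))
        ≡⟨ sum-cong (λ f → region-balance (region (src G f)) (region (dst G f)) (w f)) ⟩
      sumFin m (λ f → (crosses x f ▹ w f) + (At.minus x f ▹ w f))
        ≡⟨ sum-+ (λ f → crosses x f ▹ w f) _ ⟩
      cut w x + am x ∎
    where
    open ≡-Reasoning
    open At x
    others : ∀ u → u ≢ v → isChild level x u ▹ cut w u ≡ 0
    others u u≢v = cong (_▹ cut w u) (Boolₚ.¬-not λ c′ → u≢v (level-unique {x} c′ c))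
    region : ∀ u → Region (W u) (sub tree v u) (S u)
    region u with below? (low k) x u | below? tree v u | below? tree x u
    ... | yes p | yes q | _     = ⊥-elim (exclusive c p q)
    ... | yes p | no _  | yes _ = hanging
    ... | yes p | no _  | no ¬s = ⊥-elim (¬s (W⇒S p))
    ... | no _  | yes _ | yes _ = beneath
    ... | no _  | yes q | no ¬s = ⊥-elim (¬s (below-trans (child-below c) q))
    ... | no _  | no _  | no _  = outside
    ... | no ¬p | no ¬q | yes s with locate s
    ...   | inj₁ p = ⊥-elim (¬p p)
    ...   | inj₂ (v′ , c′ , q) = ⊥-elim (¬q (subst (λ t → Below tree t u) (level-unique {x} c′ c) q))
  ... | no ¬c = begin
      ap x + sumFin n (λ v → isChild level x v ▹ cut w v)
        ≡⟨ cong (ap x +_) (sum-zero λ v → cong (_▹ cut w v) (Boolₚ.¬-not λ c → ¬c (v , c))) ⟩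
      ap x + 0
        ≡⟨ cong (ap x +_) (sym (sum-zero {m} λ _ → refl)) ⟩
      ap x + sumFin m (λ f → 0)
        ≡⟨ sym (sum-+ (λ f → At.plus x f ▹ w f) _) ⟩
      sumFin m (λ f → (At.plus x f ▹ w f) + 0)
        ≡⟨ sum-cong (λ f → region-balance (region (src G f)) (region (dst G f)) (w f)) ⟩
      sumFin m (λ f → (crosses x f ▹ w f) + (At.minus x f ▹ w f))
        ≡⟨ sum-+ (λ f → crosses x f ▹ w f) _ ⟩
      cut w x + am x ∎
    where
    open ≡-Reasoning
    open At x
    region : ∀ u → Region (W u) false (S u)
    region u with below? (low k) x u | below? tree x u
    ... | yes p | yes _ = hanging
    ... | yes p | no ¬s = ⊥-elim (¬s (W⇒S p))
    ... | no _  | no _  = outside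
    ... | no ¬p | yes s with locate s
    ...   | inj₁ p = ⊥-elim (¬p p)
    ...   | inj₂ (v′ , c′ , q) = ⊥-elim (¬c (v′ , c′))

  -- `balance` telescopes down the path. The negative weights stand on the right so that no
  -- subtraction is involved.
  path-sums : ∀ x → tot level ap x ≡ cut w x + tot level am x
  path-sums x = go x (<-wellFounded (sz x))
    where
    open ≡-Reasoning
    go : ∀ x → Acc _<_ (sz x) → tot level ap x ≡ cut w x + tot level am x
    go x (acc rs) = begin
      tot level ap x
        ≡⟨ tot-children level ap x ⟩
      ap x + sumFin n (λ v → isChild level x v ▹ tot level ap v)
        ≡⟨ cong (ap x +_) (trans (sum-cong child) (sum-+ (λ v → isChild level x v ▹ cut w v) _)) ⟩
      ap x + (sumFin n (λ v → isChild level x v ▹ cut w v) + sumFin n (λ v → isChild level x v ▹ tot level am v))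
        ≡⟨ sym (ℕₚ.+-assoc (ap x) _ _) ⟩
      (ap x + sumFin n (λ v → isChild level x v ▹ cut w v)) + sumFin n (λ v → isChild level x v ▹ tot level am v)
        ≡⟨ cong (_+ sumFin n (λ v → isChild level x v ▹ tot level am v)) (balance x) ⟩
      (cut w x + am x) + sumFin n (λ v → isChild level x v ▹ tot level am v)
        ≡⟨ ℕₚ.+-assoc (cut w x) (am x) _ ⟩
      cut w x + (am x + sumFin n (λ v → isChild level x v ▹ tot level am v))
        ≡⟨ cong (cut w x +_) (sym (tot-children level am x)) ⟩
      cut w x + tot level am x ∎
      where
      child : ∀ v → isChild level x v ▹ tot level ap v ≡ (isChild level x v ▹ cut w v) + (isChild level x v ▹ tot level am v)
      child v with isChild level x v in c
      ... | false = refl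
      ... | true with level-child {x} {v} c
      ...   | f , eq , refl , _ = go v (rs (sz-child eq))

  -- Ranks never decrease on the way up, so equal ranks at both ends force the same rank in between.
  level-reach : ∀ {v u} → Below tree v u → rk u ≡ rk v → Reach G (λ f → level f ≡ true) u v
  level-reach here _ = here
  level-reach {v} {u} (up {f = f} eq t b) r =
    step f (level-pe eq up-eq) (subst (λ s → Joins G f s (pa f)) (pe-ch eq) (tree-joins f)) (level-reach b (trans (sym up-eq) r))
    where
    up-eq : rk u ≡ rk (pa f)
    up-eq = ℕₚ.≤-antisym (rk-below (up {A = tree} eq t here)) (ℕₚ.≤-trans (rk-below b) (ℕₚ.≤-reflexive (sym r)))

  -- By `level-unique` a component of `level` does not branch, so a walk in it stays comparable with
  -- its start.
  level-comparable : ∀ {u v} → Reach G (λ f → level f ≡ true) u v → Below level u v ⊎ Below level v u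
  level-comparable here = inj₁ here
  level-comparable (step f l j p) with joins-tree j | level-comparable p
  ... | inj₁ (refl , refl) | inj₂ b = inj₂ (up (ch-pe (level⊆tree {f} l)) l b)
  ... | inj₂ (refl , refl) | inj₁ b = inj₁ (below-trans (up (ch-pe (level⊆tree {f} l)) l here) b)
  ... | inj₂ (refl , refl) | inj₂ here = inj₁ (up (ch-pe (level⊆tree {f} l)) l here)
  ... | inj₂ (refl , refl) | inj₂ (up eq _ b) with trans (sym eq) (ch-pe (level⊆tree {f} l))
  ...   | refl = inj₂ b
  level-comparable (step f l j p) | inj₁ (refl , refl) | inj₁ b = descendInto b
    where
    pf = ch-pe (level⊆tree {f} l)
    -- The delicate case is a step up to `pa f` before the walk ends lower down. The climb from `v`
    -- back to `pa f` arrives through a level child, which must be `ch f`.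
    descendInto : ∀ {v} → Below level (pa f) v → Below level (ch f) v ⊎ Below level v (ch f)
    descendInto here = inj₂ (up pf l here)
    descendInto (up {u} {g} eq lg b) with descendInto b
    ... | inj₁ b′ = inj₁ (up eq lg b′)
    ... | inj₂ b′ with below-step b′
      where
      below-step : ∀ {v} → Below level v (ch f) → v ≡ ch f ⊎ Below level v (pa f)
      below-step here = inj₁ refl
      below-step (up eq _ b) with trans (sym eq) pf
      ... | refl = inj₂ b
    ...   | inj₁ refl-eq = inj₁ (up eq lg (subst (Below level (ch f)) (sym refl-eq) here))
    ...   | inj₂ b″ with below-antisym b b″
    ...     | eq-pa = inj₁ (subst (Below level (ch f)) (level-unique {pa f}
                  (isChild-complete {level} pf l)
                  (subst (λ t → isChild level t u ≡ true) eq-pa (isChild-complete {level} eq lg))) here)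

  module Compare (pd : Fin n → ℕ)
    (pd-conn : ∀ {u v} → Reach G (λ f → level f ≡ true) u v → pd u ≡ pd v)
    (pd-same : ∀ {u v} → pd u ≡ pd v → Reach G (λ f → level f ≡ true) u v) (x : Fin n) where
    open At x

    -- An edge leaving `W` towards `v` knows only the top `c` of the supernode of `v`. If `v` is
    -- below `x`, then `c` lies between the next path vertex and `v` and has rank `k`, so it is on
    -- the path of `x`, with a smaller size. Conversely, a common path makes `c` and `x` comparable,
    -- and the smaller size puts `c` below.
    compare : ∀ {c v} → Below (low k) c v → Top (low k) c → W v ≡ false →
              ((pd x ≡ᵇ pd c) ∧ (sz c <ᵇ sz x)) ≡ S v
    compare {c} {v} bc tc Wv = bool-iff to from
      where
      to : (pd x ≡ᵇ pd c) ∧ (sz c <ᵇ sz x) ≡ true → S v ≡ true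
      to p with ∧-true (pd x ≡ᵇ pd c) p
      ... | same , less with level-comparable (pd-same (≡ᵇ-sound (pd x) (pd c) same))
      ...   | inj₁ b = sub-complete (below-trans (below-weaken (λ {f} → level⊆tree {f}) b) (below-weaken (λ {f} → low⊆tree {k} {f}) bc))
      ...   | inj₂ b = ⊥-elim (ℕₚ.<⇒≱ (<ᵇ≡true⇒< less) (sz-below (below-weaken (λ {f} → level⊆tree {f}) b)))
      from : S v ≡ true → (pd x ≡ᵇ pd c) ∧ (sz c <ᵇ sz x) ≡ true
      from s with locate (sub-sound s)
      ... | inj₁ b = case trans (sym Wv) (sub-complete b) of λ ()
      ... | inj₂ (x′ , ic , b) with level-child {x} {x′} ic
      ...   | f , eq , refl , r = cong₂ _∧_ (≡ᵇ-true (sym (pd-conn (level-reach cx rkc))))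
                                          (<⇒<ᵇ≡true (ℕₚ.≤-<-trans (sz-below cx′) (sz-child eq)))
        where
        cx′ : Below tree x′ c
        cx′ with below-compare bc b
        ... | inj₂ q = q
        ... | inj₁ q = subst (λ t → Below tree t c) (sym (low-below-high q (ℕₚ.≤-reflexive (sym r)))) here
        cx : Below tree x c
        cx = below-trans (child-below ic) cx′
        rkc : rk c ≡ rk x
        rkc = ℕₚ.≤-antisym (rk-below cx) (top-high {k} {x} refl tc)

-- Path identifiers and the charging rounds.

treeEdge : EState → Bool
treeEdge s = isTree (kd s)

sameRank : EState → Bool
sameRank s = isTree (kd s) ∧ (⌊log₂ sizeᶜ s ⌋ ≡ᵇ ⌊log₂ sizeᵖ s ⌋)

shareLabels shareSizes shareTotals pathIds : Round
-- The 1 is the summand of the size computation that follows; `pathIds` resets `val` to 0 for the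
-- weights.
shareLabels = share lab (λ s → setVal s 1)
  (λ s a b → record s { labᶜ = childSide (kd s) a b ; labᵖ = parentSide (kd s) a b })
shareSizes = share val (λ s → record s { size = val s })
  (λ s a b → record s { sizeᶜ = childSide (kd s) a b ; sizeᵖ = parentSide (kd s) a b })
shareTotals = share val id (λ s a b → record s { res = childSide (kd s) a b })
pathIds = record
  { con = sameRank ; x = nid ; isMin = true ; lY = λ s y → record s { pid = y ; val = 0 }
  ; eL = λ s _ _ → s ; z = λ _ _ _ → 0 , 0 ; lA = λ s _ → s }

-- A size s ≤ n and a path identifier p travel as s + p (1 + n).  The weights counted
-- positively and those counted negatively are packed into one number in base q + 1.
charge : ℕ → ℕ → EState → ℕ → ℕ → ℕ
charge n q s a b = if (a / suc n ≡ᵇ b / suc n) ∧ (b % suc n <ᵇ a % suc n) then wt s * suc q else wt s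

-- Only the top of a supernode can have rank `k` or more. So the sum of the `x` values is the code
-- of the top, or 0 if its rank is smaller.
rankRound : ℕ → ℕ → ℕ → Round
rankRound n q k = record
  { con   = λ s → isTree (kd s) ∧ (⌊log₂ sizeᶜ s ⌋ <ᵇ k)
  ; x     = λ s → not (⌊log₂ size s ⌋ <ᵇ k) ▹ (size s + pid s * suc n)
  ; isMin = false
  ; lY    = λ s _ → s
  ; eL    = λ s _ _ → s
  ; z     = λ s a b → charge n q s a b , charge n q s b a
  ; lA    = λ s a → if ⌊log₂ size s ⌋ ≡ᵇ k then setVal s a else s
  }

rankRounds : ℕ → ℕ → ℕ → List Round
rankRounds n q zero    = []
rankRounds n q (suc k) = rankRound n q k ∷ rankRounds n q k

unpack-% : ∀ {s n} p → s ≤ n → (s + p * suc n) % suc n ≡ s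
unpack-% {s} {n} p s≤n = trans (DM.[m+kn]%n≡m%n s p (suc n)) (DM.m<n⇒m%n≡m (s≤s s≤n))

unpack-/ : ∀ {s n} p → s ≤ n → (s + p * suc n) / suc n ≡ p
unpack-/ {s} {n} p s≤n = begin
  (s + p * suc n) / suc n          ≡⟨ DM.+-distrib-/ s (p * suc n) no-carry ⟩
  s / suc n + p * suc n / suc n    ≡⟨ cong₂ _+_ (DM.m<n⇒m/n≡0 (s≤s s≤n)) (DM.m*n/n≡m p (suc n)) ⟩
  p                                ∎
  where
  open ≡-Reasoning
  no-carry : s % suc n + p * suc n % suc n < suc n
  no-carry = subst (_< suc n) (sym (trans (cong₂ _+_ (DM.m<n⇒m%n≡m (s≤s s≤n)) (DM.m*n%n≡0 p (suc n))) (ℕₚ.+-identityʳ s))) (s≤s s≤n)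

module RankStage (B : ℕ) {n : ℕ} (G : Graph n) (O : OrientedTree G) (w : Fin (Graph.m G) → ℕ)
  (ident label pd : Fin n → ℕ) (E : Fin (Graph.m G) → EState) (q : ℕ) where

  open Graph G using (m)
  open Semantics B G
  open Tree O
  open Ranks O w

  enc packed : Fin n → ℕ
  enc v    = sz v + pd v * suc n
  packed v = ap v + am v * suc q

  -- The rounds run from high to low rank, so before the round for rank `k` the vertices of rank at
  -- least `suc k` hold their weights and all others hold 0.
  stored : ℕ → Fin n → ℕ
  stored j v = not (rk v <ᵇ j) ▹ packed v

  Inv : ℕ → Conf → Set
  Inv j c = (∀ v → proj₁ c v ≡ nst (ident v) (label v) (stored j v) (sz v) (pd v)) × (∀ f → proj₂ c f ≡ E f)

  module _
    (E-kd : ∀ f → kd (E f) ≡ kind f) (E-wt : ∀ f → wt (E f) ≡ w f) (E-sizeᶜ : ∀ f → sizeᶜ (E f) ≡ sz (ch f))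
    (pd-conn : ∀ {u v} → Reach G (λ f → level f ≡ true) u v → pd u ≡ pd v)
    (pd-same : ∀ {u v} → pd u ≡ pd v → Reach G (λ f → level f ≡ true) u v)
    (enc< : ∀ v → enc v < 2 ^ B) (packed< : ∀ v → packed v < 2 ^ B) where

    rank-step : ∀ {k c c′} → Inv (suc k) c → Sem (rankRound n q k) c c′ → Inv k c′
    rank-step {k} {c} {c′} (nodes , edges) sem = nodes′ , λ f → trans (st-new f) (trans (Boolₚ.if-eta (merged f)) (edges f))
      where
      open Sem sem
      con-low : ∀ f → con (rankRound n q k) (st f) ≡ low k f
      con-low f rewrite edges f | E-kd f | E-sizeᶜ f = refl
      Low : Fin n → Fin n → Set
      Low = Reach G (λ f → low k f ≡ true)
      toLow : ∀ {u v} → same u v ≡ true → Low u v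
      toLow s = reach-map (λ f p → trans (sym (con-low f)) p) (same-sound s)
      fromLow : ∀ {u v} → Low u v → same u v ≡ true
      fromLow p = same-complete (reach-map (λ f r → trans (con-low f) r) p)
      same-sub : ∀ {t v u} → Top (low k) t → Below (low k) t v → same v u ≡ sub (low k) t u
      same-sub t b = bool-iff (λ s → sub-complete (reach-below (λ {f} → low⊆tree {k} {f}) t b (toLow s)))
        (λ s → fromLow (reach-trans (below-reach (λ {f} → low⊆tree {k} {f}) b)
                                    (reach-sym (below-reach (λ {f} → low⊆tree {k} {f}) (sub-sound s)))))

      -- A vertex of rank `k` ensures through `top-high` that every supernode has a top of rank at
      -- least `k`, which supplies the code.
      module _ (x : Fin n) (rx : rk x ≡ k) where

        y-top : ∀ {t v} → Top (low k) t → Below (low k) t v → y v ≡ enc t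
        y-top {t} {v} tt bt = trans (y-sum refl v (subst (_< 2 ^ B) (sym total-enc) (enc< t))) total-enc
          where
          value : ∀ u → Round.x (rankRound n q k) (ns u) ≡ not (rk u <ᵇ k) ▹ enc u
          value u rewrite nodes u = refl
          others : ∀ u → u ≢ t → same v u ▹ Round.x (rankRound n q k) (ns u) ≡ 0
          others u u≢t rewrite same-sub {u = u} tt bt | value u with below? (low k) t u
          ... | no _  = refl
          ... | yes b with rk u <ᵇ k in r
          ...   | true  = refl
          ...   | false = ⊥-elim (u≢t (low-below-high {k} b (<ᵇ≡false⇒≥ {rk u} r)))
          total-enc : total v ≡ enc t
          total-enc = trans (sum-only _ t others) (trans (cong₂ _▹_ (trans (same-sub tt bt) (sub-complete here)) (value t))
                            (cong (λ b → not b ▹ enc t) (≤⇒<ᵇ≡false (top-high {k} rx tt))))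

        open At x using (W; S; plus; minus)

        x-top : Top (low k) x
        x-top = high-top {k} (ℕₚ.≤-reflexive (sym rx))

        same-W : ∀ u → same x u ≡ W u
        same-W u = trans (same-sub x-top here) (cong (λ j → sub (low j) x u) (sym rx))

        charged : ∀ f {u v} → W u ≡ true → W v ≡ false →
                  charge n q (st f) (y u) (y v) ≡ (if S v then w f * suc q else w f)
        charged f {u} {v} Wu Wv with climb (low k) v
        ... | t , bt , tt rewrite y-top tt bt
                                | y-top x-top (subst (λ j → Below (low j) x u) rx (sub-sound Wu))
                                | unpack-/ (pd x) (sz≤n x) | unpack-/ (pd t) (sz≤n t)
                                | unpack-% (pd x) (sz≤n x) | unpack-% (pd t) (sz≤n t)
                                | edges f | E-wt f
                                | Compare.compare pd pd-conn pd-same x (subst (λ j → Below (low j) t v) (sym rx) bt)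
                                    (subst (λ j → Top (low j) t) (sym rx) (λ {f} → tt {f})) Wv = refl

        S-from-W : ∀ {u} → W u ≡ true → S u ≡ true
        S-from-W Wu = sub-complete (At.W⇒S x (sub-sound Wu))

        W-closed : ∀ {u v} → W u ≡ true → W v ≡ false → ¬ Reach G (λ f → con (rankRound n q k) (st f) ≡ true) u v
        W-closed {u} {v} Wu Wv p = case trans (sym Wv) (trans (sym (same-W v))
          (same-complete (reach-trans (same-sound (trans (same-W u) Wu)) p))) of λ ()

        unmergedˡ : ∀ f → W (src G f) ≡ true → W (dst G f) ≡ false → merged f ≡ false
        unmergedˡ f Ws Wd = Boolₚ.¬-not λ s → W-closed Ws Wd (same-sound s)

        unmergedʳ : ∀ f → W (dst G f) ≡ true → W (src G f) ≡ false → merged f ≡ false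
        unmergedʳ f Wd Ws = Boolₚ.¬-not λ s → W-closed Wd Ws (reach-sym (same-sound s))

        -- An edge within `W` is merged and an edge avoiding `W` is not incident. Otherwise the end
        -- in `W` lies in `S`, so membership of the other end in `S` alone decides between `plus`
        -- and `minus`.
        term : ∀ f → not (merged f) ▹ ((same x (src G f) ▹ proj₁ (sent f)) + (same x (dst G f) ▹ proj₂ (sent f)))
                     ≡ (plus f ▹ w f) + (minus f ▹ w f) * suc q
        term f rewrite same-W (src G f) | same-W (dst G f) with W (src G f) in Ws | W (dst G f) in Wd
        ... | true | true = cong (λ b → not b ▹ (proj₁ (sent f) + proj₂ (sent f)))
              (same-complete (reach-trans (reach-sym (same-sound (trans (same-W (src G f)) Ws))) (same-sound (trans (same-W (dst G f)) Wd))))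
        ... | false | false = ▹-zero (not (merged f))
        ... | true | false rewrite unmergedˡ f Ws Wd | charged f Ws Wd | S-from-W Ws with S (dst G f)
        ...   | true  = ℕₚ.+-identityʳ _
        ...   | false = refl
        term f | false | true rewrite unmergedʳ f Wd Ws | charged f Wd Ws | S-from-W Wd with S (src G f)
        ...   | true  = refl
        ...   | false = sym (ℕₚ.+-identityʳ _)

        received-packed : received x ≡ packed x
        received-packed = trans (sum-cong term) (trans (sum-+ (λ f → plus f ▹ w f) _)
                            (cong (ap x +_) (sum-* (λ f → minus f ▹ w f) (suc q))))

        a-packed : a x ≡ packed x
        a-packed = trans (agg x (subst (_< 2 ^ B) (sym received-packed) (packed< x))) received-packed

      nodes′ : ∀ v → proj₁ c′ v ≡ nst (ident v) (label v) (stored k v) (sz v) (pd v)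
      nodes′ v = trans (ns-new v) (trans (cong (λ s → lA (rankRound n q k) s (a v)) (nodes v)) update)
        where
        update : lA (rankRound n q k) (nst (ident v) (label v) (stored (suc k) v) (sz v) (pd v)) (a v)
                 ≡ nst (ident v) (label v) (stored k v) (sz v) (pd v)
        update with rk v ≡ᵇ k in eq
        ... | true = cong (λ t → nst (ident v) (label v) t (sz v) (pd v))
                       (trans (a-packed v r) (cong (λ b → not b ▹ packed v) (sym (≤⇒<ᵇ≡false (ℕₚ.≤-reflexive (sym r))))))
          where
          r : rk v ≡ k
          r = ≡ᵇ-sound (rk v) k eq
        ... | false = cong (λ b → nst (ident v) (label v) (not b ▹ packed v) (sz v) (pd v))
                        (bool-iff (λ p → <⇒<ᵇ≡true (ℕₚ.≤∧≢⇒< (s≤s⁻¹ (<ᵇ≡true⇒< {rk v} {suc k} p)) (≡ᵇ-unsound {rk v} {k} eq)))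
                                  (λ p → <⇒<ᵇ≡true (ℕₚ.m<n⇒m<1+n (<ᵇ≡true⇒< {rk v} {k} p))))

    rank-rounds : ∀ k → Hoare (Inv k) (rankRounds n q k) (Inv 0)
    rank-rounds zero    i refl        = i
    rank-rounds (suc k) i (_ , s , e) = rank-rounds k (rank-step i s) e

-- The complete program and its correctness.

program : (n L K M q : ℕ) → List Round
program n L K M q =
  phases (2 ^ L) K ++
  shareLabels ∷ descend treeEdge M ++
  shareSizes ∷ pathIds ∷ rankRounds n q K ++
  descend sameRank M ++
  shareTotals ∷ []

output : ℕ → EState → ℕ
output q s = res s % suc q ∸ res s / suc q

-- `L` is the number of identifier bits, `K` counts both the double phases and the ranks, `M` is the
-- number of label bits, and `X` bounds the charged weights summed over all vertices.
module Correctness (B L K M X n : ℕ) (G : Graph n) (w : Fin (Graph.m G) → ℕ) (ident : Fin n → ℕ)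
  (oriented : OrientedTree G) (toward : Fin (Graph.m G) → Maybe (Fin n))
  (ident-injective : Injective _≡_ _≡_ ident) (ident< : ∀ v → ident v < 2 ^ L)
  (toward-kind : ∀ f → Maybe.map (_≡ᵇ ident (src G f)) (Maybe.map ident (toward f)) ≡ OrientedTree.kind oriented f)
  (log<K : ⌊log₂ n ⌋ < K) (n<2^K : n < 2 ^ K) (L+K≤B : L + K ≤ B) (M≤B : M ≤ B)
  (label-range : (2 ^ L * 2 ^ L) ^ K ≡ 2 ^ M) (packed-range : suc X * suc X ≤ 2 ^ B)
  (total-weight : n * sumFin (Graph.m G) w ≤ X) where

  open Graph G using (m)
  open Tree oriented
  open Ranks oriented w
  open Semantics B G
  open Stages B G oriented

  2^-mono : ∀ {i j} → i ≤ j → 2 ^ i ≤ 2 ^ j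
  2^-mono = ℕₚ.^-monoʳ-≤ 2

  open Labelling B G oriented w ident ident-injective (2 ^ L) ident< (2^-mono (ℕₚ.≤-trans (ℕₚ.m≤m+n L K) L+K≤B))

  n<2^B : n < 2 ^ B
  n<2^B = ℕₚ.<-≤-trans n<2^K (2^-mono (ℕₚ.≤-trans (ℕₚ.m≤n+m K L) L+K≤B))

  2^M≤2^B : 2 ^ M ≤ 2 ^ B
  2^M≤2^B = 2^-mono M≤B

  sum-ap≤ : sumFin n ap ≤ X
  sum-ap≤ = ℕₚ.≤-trans (sum-bound λ x → sum-mono λ f → ▹-≤ (At.plus x f)) total-weight

  sum-am≤ : sumFin n am ≤ X
  sum-am≤ = ℕₚ.≤-trans (sum-bound λ x → sum-mono λ f → ▹-≤ (At.minus x f)) total-weight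

  packed : Fin n → ℕ
  packed v = ap v + am v * suc X

  sum-packed : sumFin n packed < 2 ^ B
  sum-packed = begin-strict
    sumFin n packed                          ≡⟨ trans (sum-+ ap _) (cong (sumFin n ap +_) (sum-* am (suc X))) ⟩
    sumFin n ap + sumFin n am * suc X        ≤⟨ ℕₚ.+-mono-≤ sum-ap≤ (ℕₚ.*-monoˡ-≤ (suc X) sum-am≤) ⟩
    -- The largest two-digit number in base `suc X`, one less than the square of the base.
    X + X * suc X                            <⟨ ℕₚ.n<1+n _ ⟩
    suc X * suc X                            ≤⟨ packed-range ⟩
    2 ^ B                                    ∎
    where open ℕₚ.≤-Reasoning

  tot-packed : ∀ v → tot level packed v ≡ tot level ap v + tot level am v * suc X
  tot-packed v = begin
    sumFin n (λ u → sub level v u ▹ packed u)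
      ≡⟨ sum-cong (λ u → trans (▹-+ (sub level v u) (ap u) _) (cong ((sub level v u ▹ ap u) +_) (▹-* (sub level v u) (am u) (suc X)))) ⟩
    sumFin n (λ u → (sub level v u ▹ ap u) + (sub level v u ▹ am u) * suc X)
      ≡⟨ sum-+ (λ u → sub level v u ▹ ap u) _ ⟩
    tot level ap v + sumFin n (λ u → (sub level v u ▹ am u) * suc X)
      ≡⟨ cong (tot level ap v +_) (sum-* (λ u → sub level v u ▹ am u) (suc X)) ⟩
    tot level ap v + tot level am v * suc X ∎
    where open ≡-Reasoning

  -- The low digit is at most `X`, so the two digits separate cleanly; by `path-sums` their
  -- difference is the cut.
  decode : ∀ v → tot level packed v % suc X ∸ tot level packed v / suc X ≡ cut w v
  decode v rewrite tot-packed v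
                 | unpack-% (tot level am v) (ℕₚ.≤-trans (tot≤sum level ap v) sum-ap≤)
                 | unpack-/ (tot level am v) (ℕₚ.≤-trans (tot≤sum level ap v) sum-ap≤)
                 | path-sums v = ℕₚ.m+n∸n≡m (cut w v) (tot level am v)

  Is : (Fin n → NState) → (Fin m → EState) → Conf → Set
  Is N E c = (∀ v → proj₁ c v ≡ N v) × (∀ f → proj₂ c f ≡ E f)

  module Labels (F : Fin m → Bool) (label : Fin n → ℕ) (label< : ∀ v → label v < 2 ^ M)
    (label-up : ∀ {f} → tree f ≡ true → label (ch f) < label (pa f)) where

    state : ℕ → ℕ → ℕ → Fin n → NState
    state k s p v = nst (ident v) (label v) k s p

    E₀ E₁ E₂ E₃ : Fin m → EState
    E₀ f = est (w f) (kind f) (F f) 0 0 0 0 0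
    E₁ f = est (w f) (kind f) (F f) (label (ch f)) (label (pa f)) 0 0 0
    E₂ f = est (w f) (kind f) (F f) (label (ch f)) (label (pa f)) (sz (ch f)) (sz (pa f)) 0
    E₃ f = est (w f) (kind f) (F f) (label (ch f)) (label (pa f)) (sz (ch f)) (sz (pa f)) (tot level packed (ch f))

    labels-shared : ∀ {c c′} → Is (λ v → state 0 0 0 v) E₀ c → Sem shareLabels c c′ → Is (λ v → state 1 0 0 v) E₁ c′
    labels-shared {c} {c′} (nodes , edges) s = (λ v → trans (proj₁ shared v) (cong (λ s → setVal s 1) (nodes v))) , edges′
      where
      shared : (∀ v → proj₁ c′ v ≡ setVal (proj₁ c v) 1) ×
               (∀ f → proj₂ c′ f ≡ eL shareLabels (proj₂ c f) (lab (proj₁ c (src G f))) (lab (proj₁ c (dst G f))))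
      shared = share-step (λ v → subst (λ s → lab s < 2 ^ B) (sym (nodes v)) (ℕₚ.<-≤-trans (label< v) 2^M≤2^B)) s
      edges′ : ∀ f → proj₂ c′ f ≡ E₁ f
      edges′ f = trans (proj₂ shared f) go
        where
        go : eL shareLabels (proj₂ c f) (lab (proj₁ c (src G f))) (lab (proj₁ c (dst G f))) ≡ E₁ f
        go rewrite edges f | nodes (src G f) | nodes (dst G f)
                 | childSide-map label (kind f) (src G f) (dst G f) | parentSide-map label (kind f) (src G f) (dst G f) = refl

    sizes-computed : ∀ {c c′} → Is (λ v → state 1 0 0 v) E₁ c → Exec (descend treeEdge M) c c′ → Is (λ v → state (sz v) 0 0 v) E₁ c′
    sizes-computed = Trie.totals treeEdge M (λ v → state 0 0 0 v) E₁ (λ _ → 1) label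
      (λ _ → refl) (λ _ → refl) (λ _ → refl) (λ t → t) label-up label<
      (subst (_< 2 ^ B) (sym (trans (sum-const n 1) (ℕₚ.*-identityʳ n))) n<2^B)

    sizes-shared : ∀ {c c′} → Is (λ v → state (sz v) 0 0 v) E₁ c → Sem shareSizes c c′ → Is (λ v → state (sz v) (sz v) 0 v) E₂ c′
    sizes-shared {c} {c′} (nodes , edges) s = (λ v → trans (proj₁ shared v) (cong (λ s → record s { size = val s }) (nodes v))) , edges′
      where
      shared : (∀ v → proj₁ c′ v ≡ record (proj₁ c v) { size = val (proj₁ c v) }) ×
               (∀ f → proj₂ c′ f ≡ eL shareSizes (proj₂ c f) (val (proj₁ c (src G f))) (val (proj₁ c (dst G f))))
      shared = share-step (λ v → subst (λ s → val s < 2 ^ B) (sym (nodes v)) (ℕₚ.≤-<-trans (sz≤n v) n<2^B)) s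
      edges′ : ∀ f → proj₂ c′ f ≡ E₂ f
      edges′ f = trans (proj₂ shared f) go
        where
        go : eL shareSizes (proj₂ c f) (val (proj₁ c (src G f))) (val (proj₁ c (dst G f))) ≡ E₂ f
        go rewrite edges f | nodes (src G f) | nodes (dst G f)
                 | childSide-map sz (kind f) (src G f) (dst G f) | parentSide-map sz (kind f) (src G f) (dst G f) = refl

    paths-named : ∀ {c c′} → Is (λ v → state (sz v) (sz v) 0 v) E₂ c → Sem pathIds c c′ →
                  ∃ λ pd → IsMin level pd × Is (λ v → state 0 (sz v) (pd v) v) E₂ c′
    paths-named {c} {c′} (nodes , edges) s = Sem.y s ,
      sem-min s refl (λ v → cong nid (nodes v)) level (λ f → cong sameRank (edges f)) ,
      (λ v → trans (Sem.ns-new s v) (cong (λ t → record t { pid = Sem.y s v ; val = 0 }) (nodes v))) ,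
      (λ f → trans (Sem.st-new s f) (trans (Boolₚ.if-eta (Sem.merged s f)) (edges f)))

    module Paths (pd : Fin n → ℕ) (pd-min : IsMin level pd) where

      module RS = RankStage B G oriented w ident label pd E₂ X

      enc< : ∀ v → RS.enc v < 2 ^ B
      enc< v = begin-strict
        sz v + pd v * suc n     ≡⟨ ℕₚ.+-comm (sz v) _ ⟩
        pd v * suc n + sz v     <⟨ *+-< (isMin<D pd-min v) (s≤s (sz≤n v)) ⟩
        2 ^ L * suc n           ≤⟨ ℕₚ.*-monoʳ-≤ (2 ^ L) n<2^K ⟩
        2 ^ L * 2 ^ K           ≡⟨ sym (ℕₚ.^-distribˡ-+-* 2 L K) ⟩
        2 ^ (L + K)             ≤⟨ 2^-mono L+K≤B ⟩
        2 ^ B                   ∎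
        where open ℕₚ.≤-Reasoning

      nothing-stored : ∀ v → RS.stored K v ≡ 0
      nothing-stored v = cong (λ b → not b ▹ packed v) (<⇒<ᵇ≡true (ℕₚ.≤-<-trans (⌊log₂⌋-mono-≤ (sz≤n v)) log<K))

      weights-stored : ∀ {c c′} → Is (λ v → state 0 (sz v) (pd v) v) E₂ c → Exec (rankRounds n X K) c c′ →
                       Is (λ v → state (packed v) (sz v) (pd v) v) E₂ c′
      weights-stored (nodes , edges) = RS.rank-rounds (λ _ → refl) (λ _ → refl) (λ _ → refl)
        (isMin-conn pd-min) (isMin-same pd-min) enc< (λ v → ℕₚ.≤-<-trans (term≤sum packed v) sum-packed) K
        ((λ v → trans (nodes v) (cong (λ k → state k (sz v) (pd v) v) (sym (nothing-stored v)))) , edges)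

      weights-summed : ∀ {c c′} → Is (λ v → state (packed v) (sz v) (pd v) v) E₂ c → Exec (descend sameRank M) c c′ →
                       Is (λ v → state (tot level packed v) (sz v) (pd v) v) E₂ c′
      weights-summed = Trie.totals sameRank M (λ v → state 0 (sz v) (pd v) v) E₂ packed label
        (λ _ → refl) (λ _ → refl) (λ _ → refl) (λ {f} → level⊆tree {f}) label-up label< sum-packed

      totals-shared : ∀ {c c′} → Is (λ v → state (tot level packed v) (sz v) (pd v) v) E₂ c → Sem shareTotals c c′ →
                      ∀ f → proj₂ c′ f ≡ E₃ f
      totals-shared {c} {c′} (nodes , edges) s f = trans (proj₂ shared f) go
        where
        shared : (∀ v → proj₁ c′ v ≡ proj₁ c v) ×
                 (∀ f → proj₂ c′ f ≡ eL shareTotals (proj₂ c f) (val (proj₁ c (src G f))) (val (proj₁ c (dst G f))))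
        shared = share-step (λ v → subst (λ s → val s < 2 ^ B) (sym (nodes v)) (ℕₚ.≤-<-trans (tot≤sum level packed v) sum-packed)) s
        go : eL shareTotals (proj₂ c f) (val (proj₁ c (src G f))) (val (proj₁ c (dst G f))) ≡ E₃ f
        go rewrite edges f | nodes (src G f) | nodes (dst G f)
                 | childSide-map (tot level packed) (kind f) (src G f) (dst G f) = refl

  finish : ∀ {c c′} → Phased K c →
           Exec (shareLabels ∷ descend treeEdge M ++ shareSizes ∷ pathIds ∷ rankRounds n X K ++ descend sameRank M ++ shareTotals ∷ []) c c′ →
           ∀ f → output X (proj₂ c′ f) ≡ cut w (ch f)
  finish (F , big , Λ) (c₁ , s₁ , e₁) f with exec-++ (descend treeEdge M) e₁
  ... | c₂ , e₂ , c₃ , s₃ , c₄ , s₄ , e₄ with exec-++ (rankRounds n X K) e₄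
  ...   | c₅ , e₅ , e₅′ with exec-++ (descend sameRank M) e₅′
  ...     | c₆ , e₆ , c₇ , s₇ , refl = trans (cong (output X) final) (decode (ch f))
    where
    open Labelled Λ
    -- After `K` double phases every tree edge is flagged, so labels increase along the whole tree.
    module N = Labels F label (λ v → subst (label v <_) label-range (label< v)) (λ t → monotone (all-flagged {K} n<2^K big t))
    named = N.paths-named (N.sizes-shared (N.sizes-computed (N.labels-shared (nodes , edges) s₁) e₂) s₃) s₄
    module P = N.Paths (proj₁ named) (proj₁ (proj₂ named))
    final : proj₂ c₇ f ≡ N.E₃ f
    final = P.totals-shared (P.weights-summed (P.weights-stored (proj₂ (proj₂ named)) e₅) e₆) s₇ f

  start-labelled : Phased 0 (strip (program n L K M X) (output X) (initial (algorithm B (program n L K M X) (output X)) G w ident toward))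
  start-labelled = (λ _ → false) , big-zero _ , record
    { label = λ _ → 0
    ; nodes = λ _ → refl
    ; edges = λ f → cong (λ k → est (w f) k false 0 0 0 0 0) (toward-kind f)
    ; F⊆tree = λ ()
    ; label< = λ _ → s≤s z≤n
    ; monotone = λ ()
    }

  correct : ∀ cfg → Execution.Run (algorithm B (program n L K M X) (output X)) G
                      (initial (algorithm B (program n L K M X) (output X)) G w ident toward) (length (program n L K M X)) cfg →
            ∀ f → output X (proj₁ (proj₂ cfg f)) ≡ cut w (ch f)
  correct cfg run with exec-++ (phases (2 ^ L) K) (run⇒exec (program n L K M X) (output X) run)
  ... | _ , e₁ , e₂ = finish (phases-correct K (λ p → p) start-labelled e₁) e₂

-- Bounds on the number of rounds and on message lengths.

length-phases : ∀ D k → length (phases D k) ≡ k + k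
length-phases D zero    = refl
length-phases D (suc k) = begin
  length (phases D k ++ _)      ≡⟨ Listₚ.length-++ (phases D k) ⟩
  length (phases D k) + 2       ≡⟨ cong (_+ 2) (length-phases D k) ⟩
  k + k + 2                     ≡⟨ ℕₚ.+-comm (k + k) 2 ⟩
  suc (suc (k + k))             ≡⟨ cong suc (sym (ℕₚ.+-suc k k)) ⟩
  suc k + suc k                 ∎
  where open ≡-Reasoning

length-descend : ∀ act b → length (descend act b) ≡ b
length-descend act zero    = refl
length-descend act (suc b) = cong suc (length-descend act b)

length-rankRounds : ∀ n q k → length (rankRounds n q k) ≡ k
length-rankRounds n q zero    = refl
length-rankRounds n q (suc k) = cong suc (length-rankRounds n q k)

length-program : ∀ n L K M q → length (program n L K M q) ≡ (K + K) + suc (M + (2 + (K + (M + 1))))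
length-program n L K M q = begin
  length (program n L K M q)
    ≡⟨ Listₚ.length-++ (phases (2 ^ L) K) ⟩
  length (phases (2 ^ L) K) + suc (length (descend treeEdge M ++ tail₁))
    ≡⟨ cong₂ (λ i j → i + suc j) (length-phases (2 ^ L) K) (Listₚ.length-++ (descend treeEdge M)) ⟩
  (K + K) + suc (length (descend treeEdge M) + (2 + length (rankRounds n q K ++ tail₂)))
    ≡⟨ cong₂ (λ i j → (K + K) + suc (i + (2 + j))) (length-descend treeEdge M) (Listₚ.length-++ (rankRounds n q K)) ⟩
  (K + K) + suc (M + (2 + (length (rankRounds n q K) + length tail₂)))
    ≡⟨ cong₂ (λ i j → (K + K) + suc (M + (2 + (i + j)))) (length-rankRounds n q K)
         (trans (Listₚ.length-++ (descend sameRank M)) (cong (_+ 1) (length-descend sameRank M))) ⟩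
  (K + K) + suc (M + (2 + (K + (M + 1)))) ∎
  where
  open ≡-Reasoning
  tail₂ = descend sameRank M ++ shareTotals ∷ []
  tail₁ = shareSizes ∷ pathIds ∷ rankRounds n q K ++ tail₂

-- A label has two digits of `idBits` bits per double phase. The cap allows each of `n` vertices to
-- be charged for up to `n * n` edges of weight at most `n ^ c₀`. `bits` adds up the lengths of
-- labels, path codes and packed pairs in order to dominate each of them.
logBits idBits labelBits weightBits bits weightCap : ℕ → ℕ → ℕ
logBits    c₀ n = suc ⌊log₂ n ⌋
idBits     c₀ n = polylog c₀ n
labelBits  c₀ n = (idBits c₀ n + idBits c₀ n) * logBits c₀ n
weightBits c₀ n = suc (logBits c₀ n * (3 + c₀))
bits       c₀ n = labelBits c₀ n + ((idBits c₀ n + logBits c₀ n) + (weightBits c₀ n + weightBits c₀ n))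
weightCap  c₀ n = n ^ (3 + c₀)

-- In a simple graph an edge is determined by its ordered pair of endpoints.
edges≤n² : ∀ {n} (G : Graph n) → Graph.m G ≤ n * n
edges≤n² G = Finₚ.injective⇒≤ {f = λ f → combine (src G f) (dst G f)} λ {f} {g} eq →
  Graph.simple G f g (inj₁ (cong₂ _,_ (proj₁ (Finₚ.combine-injective (src G f) (dst G f) (src G g) (dst G g) eq))
                                      (proj₂ (Finₚ.combine-injective (src G f) (dst G f) (src G g) (dst G g) eq))))

cutAlgorithm : ℕ → ℕ → Algorithm
cutAlgorithm c₀ n = algorithm (bits c₀ n) (program n (idBits c₀ n) (logBits c₀ n) (labelBits c₀ n) (weightCap c₀ n))
                              (output (weightCap c₀ n))

n<2^logBits : ∀ c₀ n → n < 2 ^ logBits c₀ n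
n<2^logBits c₀ n = n<2^[1+log] n

label-range : ∀ c₀ n → (2 ^ idBits c₀ n * 2 ^ idBits c₀ n) ^ logBits c₀ n ≡ 2 ^ labelBits c₀ n
label-range c₀ n = trans (cong (_^ logBits c₀ n) (sym (ℕₚ.^-distribˡ-+-* 2 (idBits c₀ n) (idBits c₀ n))))
                         (ℕₚ.^-*-assoc 2 (idBits c₀ n + idBits c₀ n) (logBits c₀ n))

packed-range : ∀ c₀ n → suc (weightCap c₀ n) * suc (weightCap c₀ n) ≤ 2 ^ bits c₀ n
packed-range c₀ n = begin
  suc (weightCap c₀ n) * suc (weightCap c₀ n)  ≤⟨ ℕₚ.*-mono-≤ cap< cap< ⟩
  2 ^ weightBits c₀ n * 2 ^ weightBits c₀ n    ≡⟨ sym (ℕₚ.^-distribˡ-+-* 2 (weightBits c₀ n) (weightBits c₀ n)) ⟩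
  2 ^ (weightBits c₀ n + weightBits c₀ n)      ≤⟨ ℕₚ.^-monoʳ-≤ 2 (ℕₚ.≤-trans (ℕₚ.m≤n+m _ (idBits c₀ n + logBits c₀ n)) (ℕₚ.m≤n+m _ (labelBits c₀ n))) ⟩
  2 ^ bits c₀ n                                ∎
  where
  open ℕₚ.≤-Reasoning
  e = logBits c₀ n * (3 + c₀)
  cap≤ : weightCap c₀ n ≤ 2 ^ e
  cap≤ = ℕₚ.≤-trans (ℕₚ.^-monoˡ-≤ (3 + c₀) (ℕₚ.<⇒≤ (n<2^logBits c₀ n))) (ℕₚ.≤-reflexive (ℕₚ.^-*-assoc 2 (logBits c₀ n) (3 + c₀)))
  cap< : suc (weightCap c₀ n) ≤ 2 ^ weightBits c₀ n
  cap< = ℕₚ.≤-trans (ℕₚ.+-mono-≤ (ℕₚ.m^n>0 2 e) cap≤) (ℕₚ.≤-reflexive (cong (2 ^ e +_) (sym (ℕₚ.+-identityʳ (2 ^ e)))))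

total-weight : ∀ c₀ {n} (G : Graph n) (w : Fin (Graph.m G) → ℕ) → (∀ f → w f ≤ n ^ c₀) →
               n * sumFin (Graph.m G) w ≤ weightCap c₀ n
total-weight c₀ {n} G w w≤ = ℕₚ.*-monoʳ-≤ n (begin
  sumFin (Graph.m G) w     ≤⟨ sum-bound w≤ ⟩
  Graph.m G * n ^ c₀       ≤⟨ ℕₚ.*-monoˡ-≤ (n ^ c₀) (edges≤n² G) ⟩
  n * n * n ^ c₀           ≡⟨ ℕₚ.*-assoc n n (n ^ c₀) ⟩
  n * (n * n ^ c₀)         ∎)
  where open ℕₚ.≤-Reasoning

-- In units of `P`, messages take `2 * c₀ + (c₀ + 1) + 2 * (4 + c₀)`, which is `9 + 5 * c₀`; rounds
-- take at most `7 + 4 * c₀`. The number also serves as the exponent in `polylog`, being at least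
-- `suc c₀`.
exponent : ℕ → ℕ
exponent c₀ = 9 + 5 * c₀

module Budget (c₀ n : ℕ) where
  open ℕₚ.≤-Reasoning
  open +-*-Solver renaming (con to lit)

  private
    K = logBits c₀ n
    p = K ^ c₀
    P = K ^ suc c₀

  1≤p : 1 ≤ p
  1≤p = ℕₚ.m^n>0 K c₀

  K≤P : K ≤ P
  K≤P = ℕₚ.≤-trans (ℕₚ.≤-reflexive (sym (ℕₚ.*-identityʳ K))) (ℕₚ.*-monoʳ-≤ K 1≤p)

  p≤P : p ≤ P
  p≤P = ℕₚ.m≤m+n p _

  1≤P : 1 ≤ P
  1≤P = ℕₚ.≤-trans 1≤p p≤P

  within : exponent c₀ * P ≤ polylog (exponent c₀) n
  within = ℕₚ.*-monoʳ-≤ (exponent c₀) (ℕₚ.^-monoʳ-≤ K (ℕₚ.+-mono-≤ {1} {9} (s≤s z≤n) (ℕₚ.m≤m+n c₀ (4 * c₀))))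

  labelBits≡ : labelBits c₀ n ≡ (2 * c₀) * P
  labelBits≡ = solve 3 (λ c k q → (c :* q :+ c :* q) :* k := (lit 2 :* c) :* (k :* q)) refl c₀ K p

  idBits≤ : idBits c₀ n ≤ c₀ * P
  idBits≤ = ℕₚ.*-monoʳ-≤ c₀ p≤P

  weightBits≤ : weightBits c₀ n ≤ (4 + c₀) * P
  weightBits≤ = begin
    1 + K * (3 + c₀)      ≤⟨ ℕₚ.+-mono-≤ 1≤P (ℕₚ.*-monoˡ-≤ (3 + c₀) K≤P) ⟩
    P + P * (3 + c₀)      ≡⟨ cong (P +_) (ℕₚ.*-comm P (3 + c₀)) ⟩
    (4 + c₀) * P          ∎

  bits≤ : bits c₀ n ≤ polylog (exponent c₀) n
  bits≤ = begin
    labelBits c₀ n + ((idBits c₀ n + K) + (weightBits c₀ n + weightBits c₀ n))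
      ≤⟨ ℕₚ.+-mono-≤ (ℕₚ.≤-reflexive labelBits≡) (ℕₚ.+-mono-≤ (ℕₚ.+-mono-≤ idBits≤ K≤P) (ℕₚ.+-mono-≤ weightBits≤ weightBits≤)) ⟩
    (2 * c₀) * P + ((c₀ * P + P) + ((4 + c₀) * P + (4 + c₀) * P))
      ≡⟨ solve 2 (λ c q → (lit 2 :* c) :* q :+ ((c :* q :+ q) :+ ((lit 4 :+ c) :* q :+ (lit 4 :+ c) :* q))
                       := (lit 9 :+ lit 5 :* c) :* q) refl c₀ P ⟩
    exponent c₀ * P
      ≤⟨ within ⟩
    polylog (exponent c₀) n ∎

  rounds≤ : Algorithm.R (cutAlgorithm c₀ n) ≤ polylog (exponent c₀) n
  rounds≤ = begin
    Algorithm.R (cutAlgorithm c₀ n)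
      ≡⟨ length-program n (idBits c₀ n) K (labelBits c₀ n) (weightCap c₀ n) ⟩
    (K + K) + suc (labelBits c₀ n + (2 + (K + (labelBits c₀ n + 1))))
      ≡⟨ cong (λ l → (K + K) + suc (l + (2 + (K + (l + 1))))) labelBits≡ ⟩
    (K + K) + suc ((2 * c₀) * P + (2 + (K + ((2 * c₀) * P + 1))))
      ≡⟨ solve 3 (λ c k q → (k :+ k) :+ (lit 1 :+ ((lit 2 :* c) :* q :+ (lit 2 :+ (k :+ ((lit 2 :* c) :* q :+ lit 1)))))
                         := lit 3 :* k :+ (lit 4 :* lit 1 :+ (lit 4 :* c) :* q)) refl c₀ K P ⟩
    3 * K + (4 * 1 + (4 * c₀) * P)
      ≤⟨ ℕₚ.+-mono-≤ (ℕₚ.*-monoʳ-≤ 3 K≤P) (ℕₚ.+-monoˡ-≤ ((4 * c₀) * P) (ℕₚ.*-monoʳ-≤ 4 1≤P)) ⟩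
    3 * P + (4 * P + (4 * c₀) * P)
      ≡⟨ solve 2 (λ c q → lit 3 :* q :+ (lit 4 :* q :+ (lit 4 :* c) :* q) := (lit 7 :+ lit 4 :* c) :* q) refl c₀ P ⟩
    (7 + 4 * c₀) * P
      ≤⟨ ℕₚ.*-monoˡ-≤ P (ℕₚ.+-mono-≤ {7} {9} (ℕₚ.m≤m+n 7 2) (ℕₚ.*-monoˡ-≤ c₀ (ℕₚ.n≤1+n 4))) ⟩
    exponent c₀ * P
      ≤⟨ within ⟩
    polylog (exponent c₀) n ∎

theorem5p1 : (c₀ : ℕ) →
    Σ (ℕ → Algorithm) λ A → Σ ℕ λ c →
    (∀ n → Algorithm.B (A n) ≤ polylog c n × Algorithm.R (A n) ≤ polylog c n) ×
    (∀ n (G : Graph n) (w : Fin (Graph.m G) → ℕ) (ident : Fin n → ℕ)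
    (T : Subset (Graph.m G)) (r : Fin n) (up : Fin (Graph.m G) → Maybe (Fin n)) →
    Connected G →
    (∀ f → 1 ≤ w f × w f ≤ n ^ c₀) →
    Injective _≡_ _≡_ ident →
    (∀ v → ident v < 2 ^ polylog c₀ n) →
    IsSpanningTree G T →
    ParentInfo G T r up →
    ComputesCuts (A n) G w ident T up)
theorem5p1 c₀ = cutAlgorithm c₀ , exponent c₀ , (λ n → Budget.bits≤ c₀ n , Budget.rounds≤ c₀ n) ,
  λ n G w ident T r toward _ w-bounds ident-injective ident< spanning info cfg run f f∈T →
    subst (CutIs G T w f)
      (sym (Correctness.correct (bits c₀ n) (idBits c₀ n) (logBits c₀ n) (labelBits c₀ n) (weightCap c₀ n) n G w ident
        (Spanning.oriented G T r spanning) toward ident-injective ident<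
        (Spanning.parentInfo-kind G T r spanning ident ident-injective info)
        (ℕₚ.n<1+n ⌊log₂ n ⌋) (n<2^logBits c₀ n)
        (ℕₚ.≤-trans (ℕₚ.m≤m+n (idBits c₀ n + logBits c₀ n) _) (ℕₚ.m≤n+m _ (labelBits c₀ n))) (ℕₚ.m≤m+n (labelBits c₀ n) _)
        (label-range c₀ n) (packed-range c₀ n) (total-weight c₀ G w (proj₂ ∘ w-bounds)) cfg run f))
      (Spanning.cut-correct G T r spanning w f∈T)
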